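{- Let $\lambda$ be a set partition of $\{1,\ldots,21\}$ into six blocks of sizes $4,4,4,3,3,3$, and let $\mathsf{M}$ be the matroid arising from $\lambda$. Then the normalized inverse Kazhdan–Lusztig polynomial $\mathcal{B}(Q_{\mathsf{M}})(x)$ is not real-rooted.
   Context: The matroid arising from a set partition $\lambda$ of $[n]$ is the dual of the loopless rank-$2$ matroid on $[n]$ whose rank-$1$ flats are exactly the blocks of $\lambda$ (so here $\mathsf{M}$ has rank $19$). $\mu(\mathsf{N})$ is the Möbius value $\mu(\varnothing,E)$ of the lattice of flats $\mathcal{L}(\mathsf{N})$. The inverse Kazhdan–Lusztig polynomial $Q_{\mathsf{N}}$ is the unique assignment to loopless matroids with $Q_{\mathsf{N}}=1$ in rank $0$, $\deg Q_{\mathsf{N}}<\operatorname{rk}(\mathsf{N})/2$ in positive rank, and $\sum_{F}(-1)^{\operatorname{rk}\mathsf{N}-\operatorname{rk}F}\mu(\mathsf{N}/F)x^{\operatorname{rk}\mathsf{N}-\operatorname{rk}F}Q_{\mathsf{N}|_F}(x)$ palindromic of degree $\operatorname{rk}\mathsf{N}$. If $Q_{\mathsf{M}}(x)=\sum_{j=0}^sq_jx^j$ with $s=\deg Q_{\mathsf{M}}$, then $\mathcal{B}(Q_{\mathsf{M}})(x)=\sum_{j=0}^s\binom{s}{j}q_jx^j$. A polynomial is real-rooted if all its complex roots are real. -}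

module Defs where

open import Data.Bool using (Bool; true; false; _∧_; _∨_; not; if_then_else_; T)
open import Data.Nat as ℕ using (ℕ; zero; suc; _∸_; _≤ᵇ_; _<ᵇ_; _⊓_)
open import Data.Integer as ℤ using (ℤ; +_; 0ℤ; 1ℤ; -1ℤ)
open import Data.Fin using (Fin)
open import Data.Fin.Subset using (Subset; ⁅_⁆; _∪_; ∁; ∣_∣; ⊤; ⊥; _∈_; _∉_)
open import Data.Vec using (Vec; []; _∷_; lookup)
open import Data.List using (List; []; _∷_; [_]; map; _++_; filter; foldr; allFin; length)
open import Data.List.Relation.Unary.Any using (any?)
open import Data.Product using (_×_; _,_; Σ; ∃; proj₁; proj₂)
open import Data.Sum using (_⊎_)
open import Data.Empty using ()
open import Relation.Nullary using (¬_; Dec; yes; no; does)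
open import Relation.Binary.PropositionalEquality using (_≡_; _≢_)
open import Data.Nat.Combinatorics using (_C_)

subsets : ∀ n → List (Subset n)
subsets zero    = [ [] ]
subsets (suc n) = map (false ∷_) (subsets n) ++ map (true ∷_) (subsets n)

subᵇ : ∀ {n} → Subset n → Subset n → Bool
subᵇ []      []      = true
subᵇ (a ∷ A) (b ∷ B) = (not a ∨ b) ∧ subᵇ A B

eqᵇ : ∀ {n} → Subset n → Subset n → Bool
eqᵇ A B = subᵇ A B ∧ subᵇ B A

allᵇ : ∀ n → (Fin n → Bool) → Bool
allᵇ n f = foldr (λ i acc → f i ∧ acc) true (allFin n)

countᵇ : ∀ n → (Fin n → Bool) → ℕ
countᵇ n f = length (filter (λ i → T? (f i)) (allFin n))
  where
  T? : (b : Bool) → Dec (T b)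
  T? true  = yes _
  T? false = no (λ ())

sumℤ : List ℤ → ℤ
sumℤ = foldr ℤ._+_ 0ℤ

RankFn : ℕ → Set
RankFn n = Subset n → ℕ

module _ {n : ℕ} (r : RankFn n) where

  flatᵇ : Subset n → Bool
  flatᵇ F = allᵇ n (λ e → lookup F e ∨ (r F <ᵇ r (F ∪ ⁅ e ⁆)))

  Flat : Subset n → Set
  Flat F = T (flatᵇ F)

  interval : Subset n → Subset n → List (Subset n)
  interval G F = filter (λ H → T? (flatᵇ H ∧ subᵇ G H ∧ subᵇ H F)) (subsets n)
    where
    T? : (b : Bool) → Dec (T b)
    T? true  = yes _
    T? false = no (λ ())

  IsMobius : (Subset n → Subset n → ℤ) → Set
  IsMobius m = ∀ G F → Flat G → Flat F → T (subᵇ G F) →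
    sumℤ (map (m G) (interval G F)) ≡ (if eqᵇ G F then 1ℤ else 0ℤ)

Poly : Set
Poly = ℕ → ℤ

onePoly : Poly
onePoly zero    = 1ℤ
onePoly (suc _) = 0ℤ

negpow : ℕ → ℤ
negpow zero    = 1ℤ
negpow (suc d) = ℤ.- negpow d

IsDegree : Poly → ℕ → Set
IsDegree p s = (p s ≢ 0ℤ) × (∀ j → s ℕ.< j → p j ≡ 0ℤ)

-- normalization B(Q)(x) = Σ_j binom(s,j) q_j x^j  (s = deg Q)
normB : ℕ → Poly → Poly
normB s p j = (+ (s C j)) ℤ.* p j

-- Inverse Kazhdan–Lusztig polynomials of a loopless matroid, specified
-- on the family of restrictions M|F (F a flat of M).  q F stands for Q_{M|F}.
-- Note: flats of M|F are the flats G ⊆ F of M, and μ((M|F)/G) = μ_{L(M)}(G,F).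

module _ {n : ℕ} (r : RankFn n) (m : Subset n → Subset n → ℤ) (q : Subset n → Poly) where

  -- coefficient of x^k in
  --   Σ_{G ⊆ F flat} (-1)^{rk F - rk G} μ(G,F) x^{rk F - rk G} Q_{M|G}(x)
  klSumCoeff : Subset n → ℕ → ℤ
  klSumCoeff F k = sumℤ (map term (interval r ⊥ F))
    where
    term : Subset n → ℤ
    term G = let d = r F ∸ r G in
      if d ≤ᵇ k then negpow d ℤ.* m G F ℤ.* q G (k ∸ d) else 0ℤ

  IsInverseKL : Set
  IsInverseKL =
    (∀ F → Flat r F → r F ≡ 0 → ∀ k → q F k ≡ onePoly k) ×
    (∀ F → Flat r F → 0 ℕ.< r F → ∀ k → r F ℕ.≤ 2 ℕ.* k → q F k ≡ 0ℤ) ×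
    (∀ F → Flat r F → ∀ k → k ℕ.≤ r F → klSumCoeff F k ≡ klSumCoeff F (r F ∸ k)) ×
    (∀ F → Flat r F → ∀ k → r F ℕ.< k → klSumCoeff F k ≡ 0ℤ)

blocksMeeting : ∀ {n k} → (Fin n → Fin k) → Subset n → ℕ
blocksMeeting {n} {k} b A =
  countᵇ k (λ i → not (allᵇ n (λ e → not (lookup A e ∧ eqFin (b e) i))))
  where
  eqFin : Fin k → Fin k → Bool
  eqFin x y = does (x Data.Fin.≟ y)

-- loopless rank-2 matroid whose rank-1 flats are the blocks
rank2 : ∀ {n k} → (Fin n → Fin k) → RankFn n
rank2 b A = 2 ⊓ blocksMeeting b A

dualRank : ∀ {n} → RankFn n → RankFn n
dualRank r A = (∣ A ∣ ℕ.+ r (∁ A)) ∸ r ⊤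

partitionMatroid : ∀ {n k} → (Fin n → Fin k) → RankFn n
partitionMatroid b = dualRank (rank2 b)

blockSizes : ∀ {n k} → (Fin n → Fin k) → List ℕ
blockSizes {n} {k} b = map (λ i → countᵇ n (λ e → does (b e Data.Fin.≟ i))) (allFin k)

record CompleteOrderedField : Set₁ where
  infixl 6 _+_
  infixl 7 _*_
  infix 4 _<_ _≤_
  field
    Carrier : Set
    0# 1# : Carrier
    _+_ _*_ : Carrier → Carrier → Carrier
    -_ : Carrier → Carrier
    _<_ : Carrier → Carrier → Set
    +-assoc : ∀ x y z → (x + y) + z ≡ x + (y + z)
    +-comm : ∀ x y → x + y ≡ y + x
    +-identityˡ : ∀ x → 0# + x ≡ x
    -‿inverseˡ : ∀ x → (- x) + x ≡ 0#
    *-assoc : ∀ x y z → (x * y) * z ≡ x * (y * z)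
    *-comm : ∀ x y → x * y ≡ y * x
    *-identityˡ : ∀ x → 1# * x ≡ x
    distribʳ : ∀ x y z → (y + z) * x ≡ (y * x) + (z * x)
    0≢1 : 0# ≢ 1#
    inverse : ∀ x → x ≢ 0# → ∃ λ y → x * y ≡ 1#
    <-irrefl : ∀ x → ¬ (x < x)
    <-trans : ∀ {x y z} → x < y → y < z → x < z
    <-trichotomy : ∀ x y → x < y ⊎ x ≡ y ⊎ y < x
    +-mono-< : ∀ {x y} z → x < y → x + z < y + z
    *-pos : ∀ {x y} → 0# < x → 0# < y → 0# < x * y
  _≤_ : Carrier → Carrier → Set
  x ≤ y = x < y ⊎ x ≡ y
  field
    lub : (P : Carrier → Set) → (∃ λ x → P x) → (∃ λ u → ∀ x → P x → x ≤ u) →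
          ∃ λ l → (∀ x → P x → x ≤ l) × (∀ u → (∀ x → P x → x ≤ u) → l ≤ u)

module Complex (R : CompleteOrderedField) where
  open CompleteOrderedField R

  ℂ : Set
  ℂ = Carrier × Carrier

  _+ℂ_ : ℂ → ℂ → ℂ
  (a , b) +ℂ (c , d) = (a + c , b + d)

  _*ℂ_ : ℂ → ℂ → ℂ
  (a , b) *ℂ (c , d) = (a * c + - (b * d) , a * d + b * c)

  fromℕ : ℕ → Carrier
  fromℕ zero    = 0#
  fromℕ (suc k) = 1# + fromℕ k

  fromℤ : ℤ → Carrier
  fromℤ (+ k)       = fromℕ k
  fromℤ ℤ.-[1+ k ]  = - fromℕ (suc k)

  powℂ : ℂ → ℕ → ℂ
  powℂ z zero    = (1# , 0#)
  powℂ z (suc k) = z *ℂ powℂ z k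

  evalℂ : ℕ → Poly → ℂ → ℂ
  evalℂ zero    p z = (fromℤ (p 0) , 0#) *ℂ powℂ z 0
  evalℂ (suc N) p z = evalℂ N p z +ℂ ((fromℤ (p (suc N)) , 0#) *ℂ powℂ z (suc N))

RealRooted : CompleteOrderedField → ℕ → Poly → Set
RealRooted R N p = ∀ a b → evalℂ N p (a , b) ≡ (0# , 0#) → b ≡ 0#
  where
  open CompleteOrderedField R
  open Complex R

{-# OPTIONS --safe #-}
-- A flat F of the matroid is described by its complement Y. Either F is everything, or Y lies in one
-- block and has at least two elements, or every block misses at least two elements of Y; in the last
-- case all subsets of F are flats. In each case the Möbius value μ(G , F) has a closed form depending
-- only on the numbers of elements of the complement of G inside and outside the blocks, and a sum over
-- flats becomes a sum over all subsets of functions of |Y ∩ B| and |Y ∖ B| for single blocks B, hence an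
-- iterated binomial sum. Palindromicity and the degree bound determine Q, recursively in F: it is 1 in
-- the boolean case, the polynomial of a circuit in the one-block case, and on the top an explicit
-- polynomial of degree 9. The normalization of the latter has a pair of complex roots near
-- -1.0298 ± 0.1098 i. Their existence follows from Newton's method: after expanding at
-- (-206 + 22 i) / 200 the simplified Newton step is a contraction of the box |Re w| , |Im w| ≤ 1, in the
-- scale 1 / 200, and the box does not meet the real axis.
module Submission where

open import Defs
open import Algebra.Bundles using (CommutativeMonoid; CommutativeRing)
import Algebra.Properties.CommutativeMonoid.Sum
import Algebra.Properties.AbelianGroup
import Algebra.Properties.Ring
import Algebra.Solver.Ring
open import Algebra.Solver.Ring.AlmostCommutativeRing using (AlmostCommutativeRing; fromCommutativeRing; _-Raw-AlmostCommutative⟶_)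
open import Data.Bool using (Bool; true; false; _∧_; _∨_; not; if_then_else_; T)
open import Data.Bool.Properties using (∧-zeroʳ)
open import Data.Empty using (⊥-elim)
open import Data.Fin as Fin using (Fin; zero; suc)
open import Data.Fin.Subset using (Subset; ⊤; ⊥; ∣_∣; ∁; _∪_; ⁅_⁆)
open import Data.Fin.Subset.Properties using (∪-identityʳ)
open import Data.Integer as ℤ using (ℤ; 0ℤ; 1ℤ; -1ℤ)
import Data.Integer.Properties as ℤ
open import Data.Integer.Tactic.RingSolver using (solve-∀)
open import Data.List as List using (List; []; _∷_; map; _++_; filter; allFin; length)
open import Data.List.Properties using (map-++; map-∘; map-cong)
open import Data.List.Relation.Binary.Permutation.Propositional as ↭ using (_↭_; ↭-sym)
open import Data.List.Relation.Binary.Permutation.Propositional.Properties using (All-resp-↭)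
open import Data.List.Relation.Unary.All using (All; []; _∷_)
import Data.List.Relation.Unary.All.Properties as All
import Data.Maybe as Maybe
open import Data.Nat as ℕ using (ℕ; zero; suc; z≤n; s≤s; _∸_; _<ᵇ_; _≤ᵇ_; _⊓_)
open import Data.Nat.Combinatorics using (nCk≡nC[n∸k]; nCk+nC[k+1]≡[n+1]C[k+1]; k>n⇒nCk≡0) renaming (_C_ to _choose_)
import Data.Nat.Properties as ℕ
open import Data.Product using (∃; _×_; _,_; proj₁; proj₂)
open import Data.Sum using (_⊎_; inj₁; inj₂)
open import Data.Vec using ([]; _∷_; lookup; tabulate)
open import Data.Vec.Properties using (lookup∘tabulate)
open import Function using (_∘_)
open import Relation.Binary.Definitions using (tri<; tri≈; tri>)
open import Relation.Binary.PropositionalEquality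
open import Relation.Nullary using (Dec; yes; no; ¬_; does)
open import Relation.Nullary.Decidable using (dec-true; dec-false; toWitness; True)
open import Relation.Nullary.Decidable.Core using (dec⇒maybe)
open import Algebra.Properties.CommutativeMonoid.Sum ℕ.+-0-commutativeMonoid using (sum-cong-≗; ∑-distrib-+) renaming (sum to sumℕ)
open import Algebra.Properties.CommutativeMonoid.Sum ℤ.+-0-commutativeMonoid using () renaming (sum to Σᶠ; sum-cong-≗ to Σᶠ-cong)
open import Algebra.Properties.AbelianGroup ℤ.+-0-abelianGroup using () renaming (∙-cancelˡ to +ℤ-cancelˡ)

-- The hypotheses give `μ` and `Q` only through identities on flats, so both have to be identified
-- by uniqueness before anything can be evaluated. The closed form for μ comes from duality. Let N
-- be the rank-2 matroid. The minor of the matroid between flats G and F is dual to N contracted by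
-- the complement of F and restricted to `F ∖ G`; up to sign its Möbius value is the Tutte
-- polynomial of that minor of N at (0,1), the alternating count of independent sets. As these have
-- at most two elements, the count is a polynomial of degree at most 2 in the sizes.
--
-- The obstacle is size: sums over the subsets of 21 elements cannot be evaluated directly.
-- Therefore the condition of being a flat is absorbed into corrections that each see a single
-- block, after which every sum is binomial and rows of Pascal's triangle suffice.
--
-- A nonreal root has to be constructed from the supremum axiom alone. A contraction reduces this to
-- a few inequalities between integers, checked exactly. The centre is the approximate root rounded
-- to a multiple of 1/200 in each coordinate.

module Enumeration where
  open import Data.Integer using (_+_; _*_; -_)

  -- Sums over intervals of subsets, and binomial sums

  [_⇒_] : Bool → ℤ → ℤ
  [ c ⇒ x ] = if c then x else 0ℤ

  interchange : ∀ a b c d → (a + b) + (c + d) ≡ (a + c) + (b + d)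
  interchange = solve-∀

  sumℤ-filter : ∀ {A : Set} (f : A → Bool) (P? : ∀ x → Dec (T (f x))) (g : A → ℤ) xs →
    sumℤ (map g (filter P? xs)) ≡ sumℤ (map (λ x → [ f x ⇒ g x ]) xs)
  sumℤ-filter f P? g [] = refl
  sumℤ-filter f P? g (x ∷ xs) with f x | P? x
  ... | true  | yes _ = cong (g x +_) (sumℤ-filter f P? g xs)
  ... | true  | no ¬t = ⊥-elim (¬t _)
  ... | false | no _  = trans (sumℤ-filter f P? g xs) (sym (ℤ.+-identityˡ _))

  sumℤ-++ : ∀ xs ys → sumℤ (xs ++ ys) ≡ sumℤ xs + sumℤ ys
  sumℤ-++ [] ys = sym (ℤ.+-identityˡ _)
  sumℤ-++ (x ∷ xs) ys = trans (cong (x +_) (sumℤ-++ xs ys)) (sym (ℤ.+-assoc x _ _))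

  sumℤ-cong : ∀ {A : Set} {f g : A → ℤ} → (∀ x → f x ≡ g x) → ∀ xs →
    sumℤ (map f xs) ≡ sumℤ (map g xs)
  sumℤ-cong h [] = refl
  sumℤ-cong h (x ∷ xs) = cong₂ _+_ (h x) (sumℤ-cong h xs)

  sumℤ-zero : ∀ {A : Set} {f : A → ℤ} → (∀ x → f x ≡ 0ℤ) → ∀ xs → sumℤ (map f xs) ≡ 0ℤ
  sumℤ-zero h [] = refl
  sumℤ-zero h (x ∷ xs) = cong₂ _+_ (h x) (sumℤ-zero h xs)

  sumℤ-subsets : ∀ n (f : Subset (suc n) → ℤ) →
    sumℤ (map f (subsets (suc n))) ≡
    sumℤ (map (λ H → f (false ∷ H)) (subsets n)) + sumℤ (map (λ H → f (true ∷ H)) (subsets n))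
  sumℤ-subsets n f
    rewrite map-++ f (map (false ∷_) (subsets n)) (map (true ∷_) (subsets n))
          | sym (map-∘ {g = f} {f = false ∷_} (subsets n))
          | sym (map-∘ {g = f} {f = true ∷_} (subsets n)) = sumℤ-++ (map (λ H → f (false ∷ H)) (subsets n)) _

  -- Recursion on both ends builds the bounds into the sum: a coordinate branches exactly when it
  -- lies in `F` and not in `G`, so later inductions need no filtering.
  intervalSum : ∀ {n} → Subset n → Subset n → (Subset n → ℤ) → ℤ
  intervalSum []          []          f = f []
  intervalSum (false ∷ G) (false ∷ F) f = intervalSum G F (λ H → f (false ∷ H))
  intervalSum (false ∷ G) (true ∷ F)  f =
    intervalSum G F (λ H → f (false ∷ H)) + intervalSum G F (λ H → f (true ∷ H))
  intervalSum (true ∷ G)  (false ∷ F) f = 0ℤ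
  intervalSum (true ∷ G)  (true ∷ F)  f = intervalSum G F (λ H → f (true ∷ H))

  sumℤ-between : ∀ {n} (G F : Subset n) (c : Subset n → Bool) (g : Subset n → ℤ) →
    sumℤ (map (λ H → [ c H ∧ subᵇ G H ∧ subᵇ H F ⇒ g H ]) (subsets n)) ≡
    intervalSum G F (λ H → [ c H ⇒ g H ])
  sumℤ-between [] [] c g with c []
  ... | true  = ℤ.+-identityʳ _
  ... | false = refl
  sumℤ-between {suc n} (false ∷ G) (false ∷ F) c g =
    trans (sumℤ-subsets n _) (trans (cong₂ _+_ (sumℤ-between G F (λ H → c (false ∷ H)) (λ H → g (false ∷ H)))
        (sumℤ-zero vanish (subsets n))) (ℤ.+-identityʳ _))
    where
    vanish : ∀ H → [ c (true ∷ H) ∧ subᵇ G H ∧ false ⇒ g (true ∷ H) ] ≡ 0ℤ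
    vanish H rewrite ∧-zeroʳ (subᵇ G H) | ∧-zeroʳ (c (true ∷ H)) = refl
  sumℤ-between {suc n} (false ∷ G) (true ∷ F) c g =
    trans (sumℤ-subsets n _) (cong₂ _+_ (sumℤ-between G F (λ H → c (false ∷ H)) (λ H → g (false ∷ H)))
        (sumℤ-between G F (λ H → c (true ∷ H)) (λ H → g (true ∷ H))))
  sumℤ-between {suc n} (true ∷ G) (false ∷ F) c g =
    trans (sumℤ-subsets n _) (cong₂ _+_ (sumℤ-zero vanish₁ (subsets n)) (sumℤ-zero vanish₂ (subsets n)))
    where
    vanish₁ : ∀ H → [ c (false ∷ H) ∧ false ⇒ g (false ∷ H) ] ≡ 0ℤ
    vanish₁ H rewrite ∧-zeroʳ (c (false ∷ H)) = refl
    vanish₂ : ∀ H → [ c (true ∷ H) ∧ subᵇ G H ∧ false ⇒ g (true ∷ H) ] ≡ 0ℤ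
    vanish₂ H rewrite ∧-zeroʳ (subᵇ G H) | ∧-zeroʳ (c (true ∷ H)) = refl
  sumℤ-between {suc n} (true ∷ G) (true ∷ F) c g =
    trans (sumℤ-subsets n _) (trans (cong₂ _+_ (sumℤ-zero vanish (subsets n))
        (sumℤ-between G F (λ H → c (true ∷ H)) (λ H → g (true ∷ H)))) (ℤ.+-identityˡ _))
    where
    vanish : ∀ H → [ c (false ∷ H) ∧ false ⇒ g (false ∷ H) ] ≡ 0ℤ
    vanish H rewrite ∧-zeroʳ (c (false ∷ H)) = refl

  sumℤ-interval : ∀ {n} (r : RankFn n) G F (g : Subset n → ℤ) →
    sumℤ (map g (interval r G F)) ≡ intervalSum G F (λ H → [ flatᵇ r H ⇒ g H ])
  sumℤ-interval {n} r G F g =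
    trans (sumℤ-filter (λ H → flatᵇ r H ∧ subᵇ G H ∧ subᵇ H F) _ g (subsets n)) (sumℤ-between G F _ g)

  intervalSum-cong : ∀ {n} (G F : Subset n) {f g : Subset n → ℤ} →
    (∀ H → T (subᵇ G H) → T (subᵇ H F) → f H ≡ g H) → intervalSum G F f ≡ intervalSum G F g
  intervalSum-cong []          []          h = h [] _ _
  intervalSum-cong (false ∷ G) (false ∷ F) h = intervalSum-cong G F (λ H → h (false ∷ H))
  intervalSum-cong (false ∷ G) (true ∷ F)  h =
    cong₂ _+_ (intervalSum-cong G F (λ H → h (false ∷ H))) (intervalSum-cong G F (λ H → h (true ∷ H)))
  intervalSum-cong (true ∷ G)  (false ∷ F) h = refl
  intervalSum-cong (true ∷ G)  (true ∷ F)  h = intervalSum-cong G F (λ H → h (true ∷ H))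

  intervalSum-+ : ∀ {n} (G F : Subset n) (f g : Subset n → ℤ) →
    intervalSum G F (λ H → f H + g H) ≡ intervalSum G F f + intervalSum G F g
  intervalSum-+ []          []          f g = refl
  intervalSum-+ (false ∷ G) (false ∷ F) f g = intervalSum-+ G F _ _
  intervalSum-+ (false ∷ G) (true ∷ F)  f g =
    trans (cong₂ _+_ (intervalSum-+ G F _ _) (intervalSum-+ G F _ _))
          (interchange (intervalSum G F _) (intervalSum G F _) (intervalSum G F _) _)
  intervalSum-+ (true ∷ G)  (false ∷ F) f g = refl
  intervalSum-+ (true ∷ G)  (true ∷ F)  f g = intervalSum-+ G F _ _

  intervalSum-zero : ∀ {n} (G F : Subset n) → intervalSum G F (λ _ → 0ℤ) ≡ 0ℤ
  intervalSum-zero []          []          = refl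
  intervalSum-zero (false ∷ G) (false ∷ F) = intervalSum-zero G F
  intervalSum-zero (false ∷ G) (true ∷ F)  = cong₂ _+_ (intervalSum-zero G F) (intervalSum-zero G F)
  intervalSum-zero (true ∷ G)  (false ∷ F) = refl
  intervalSum-zero (true ∷ G)  (true ∷ F)  = intervalSum-zero G F

  infixl 6 _∖_
  _∖_ : ∀ {n} → Subset n → Subset n → Subset n
  []      ∖ []      = []
  (a ∷ F) ∖ (b ∷ H) = (a ∧ not b) ∷ (F ∖ H)

  codim : ∀ {n} → Subset n → Subset n → ℕ
  codim F H = ∣ F ∖ H ∣

  -- All terms except those at `F` agree, and the additive form avoids a subtraction. Both
  -- uniqueness proofs, for the Möbius function and for Q, isolate the value at `F` in this way.
  intervalSum-top : ∀ {n} (G F : Subset n) → T (subᵇ G F) → {f g : Subset n → ℤ} →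
    (∀ H → T (subᵇ G H) → T (subᵇ H F) → 0 ℕ.< codim F H → f H ≡ g H) →
    intervalSum G F f + g F ≡ intervalSum G F g + f F
  intervalSum-top []          []          s {f} {g} h = ℤ.+-comm (f []) (g [])
  intervalSum-top (false ∷ G) (false ∷ F) s h = intervalSum-top G F s (λ H → h (false ∷ H))
  intervalSum-top (false ∷ G) (true ∷ F)  s h =
    trans (ℤ.+-assoc (intervalSum G F _) _ _)
      (trans (cong₂ _+_ (intervalSum-cong G F (λ H a b → h (false ∷ H) a b ℕ.z<s))
                        (intervalSum-top G F s (λ H → h (true ∷ H))))
             (sym (ℤ.+-assoc (intervalSum G F _) _ _)))
  intervalSum-top (true ∷ G)  (true ∷ F)  s h = intervalSum-top G F s (λ H → h (true ∷ H))

  inside outside : ∀ {n} → Subset n → Subset n → ℕ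
  inside []          []          = 0
  inside (true ∷ B)  (true ∷ D)  = suc (inside B D)
  inside (true ∷ B)  (false ∷ D) = inside B D
  inside (false ∷ B) (_ ∷ D)     = inside B D
  outside []          []          = 0
  outside (false ∷ B) (true ∷ D)  = suc (outside B D)
  outside (false ∷ B) (false ∷ D) = outside B D
  outside (true ∷ B)  (_ ∷ D)     = outside B D

  -- bin p φ = Σ_i C(p,i) φ(i)
  bin : ℕ → (ℕ → ℤ) → ℤ
  bin zero    φ = φ 0
  bin (suc p) φ = bin p φ + bin p (λ i → φ (suc i))

  bin-cong : ∀ p {φ ψ : ℕ → ℤ} → (∀ i → φ i ≡ ψ i) → bin p φ ≡ bin p ψ
  bin-cong zero    h = h 0
  bin-cong (suc p) h = cong₂ _+_ (bin-cong p h) (bin-cong p (λ i → h (suc i)))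

  bin-+ : ∀ p (φ ψ : ℕ → ℤ) → bin p (λ i → φ i + ψ i) ≡ bin p φ + bin p ψ
  bin-+ zero    φ ψ = refl
  bin-+ (suc p) φ ψ = trans (cong₂ _+_ (bin-+ p _ _) (bin-+ p _ _)) (interchange (bin p φ) _ (bin p (λ i → φ (suc i))) _)

  bin-* : ∀ p c (φ : ℕ → ℤ) → bin p (λ i → c * φ i) ≡ c * bin p φ
  bin-* zero    c φ = refl
  bin-* (suc p) c φ = trans (cong₂ _+_ (bin-* p c _) (bin-* p c _)) (sym (ℤ.*-distribˡ-+ c _ _))

  bin-zero : ∀ p → bin p (λ _ → 0ℤ) ≡ 0ℤ
  bin-zero zero    = refl
  bin-zero (suc p) = cong₂ _+_ (bin-zero p) (bin-zero p)

  -- As `H` varies, `F ∖ H` runs through all subsets of `F ∖ G`, that is, through independent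
  -- choices inside and outside `B`, and the summand sees only the two counts.
  intervalSum-bin₂ : ∀ {n} (G F B : Subset n) → T (subᵇ G F) → (φ : ℕ → ℕ → ℤ) →
    intervalSum G F (λ H → φ (inside B (F ∖ H)) (outside B (F ∖ H))) ≡
    bin (inside B (F ∖ G)) (λ i → bin (outside B (F ∖ G)) (φ i))
  intervalSum-bin₂ [] [] [] s φ = refl
  intervalSum-bin₂ (false ∷ G) (false ∷ F) (false ∷ B) s φ = intervalSum-bin₂ G F B s φ
  intervalSum-bin₂ (false ∷ G) (false ∷ F) (true ∷ B) s φ = intervalSum-bin₂ G F B s φ
  intervalSum-bin₂ (true ∷ G) (true ∷ F) (false ∷ B) s φ = intervalSum-bin₂ G F B s φ
  intervalSum-bin₂ (true ∷ G) (true ∷ F) (true ∷ B) s φ = intervalSum-bin₂ G F B s φ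
  intervalSum-bin₂ (false ∷ G) (true ∷ F) (true ∷ B) s φ =
    trans (cong₂ _+_ (intervalSum-bin₂ G F B s _) (intervalSum-bin₂ G F B s _)) (ℤ.+-comm (bin (inside B (F ∖ G)) _) _)
  intervalSum-bin₂ (false ∷ G) (true ∷ F) (false ∷ B) s φ =
    trans (cong₂ _+_ (intervalSum-bin₂ G F B s _) (intervalSum-bin₂ G F B s _))
          (trans (ℤ.+-comm (bin (inside B (F ∖ G)) _) _) (sym (bin-+ (inside B (F ∖ G)) _ _)))

  intervalSum-bin₁ : ∀ {n} (G F : Subset n) → T (subᵇ G F) → (φ : ℕ → ℤ) →
    intervalSum G F (λ H → φ (codim F H)) ≡ bin (codim F G) φ
  intervalSum-bin₁ [] [] s φ = refl
  intervalSum-bin₁ (false ∷ G) (false ∷ F) s φ = intervalSum-bin₁ G F s φ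
  intervalSum-bin₁ (true ∷ G) (true ∷ F) s φ = intervalSum-bin₁ G F s φ
  intervalSum-bin₁ (false ∷ G) (true ∷ F) s φ =
    trans (cong₂ _+_ (intervalSum-bin₁ G F s _) (intervalSum-bin₁ G F s _)) (ℤ.+-comm (bin (codim F G) _) _)

  -- Profiles that meet few blocks

  module SparseSum {c ℓ} (M : CommutativeMonoid c ℓ) where
    open CommutativeMonoid M renaming (refl to ≈-refl; trans to ≈-trans; sym to ≈-sym)
    open import Algebra.Properties.CommutativeMonoid.Sum M using (sum)

    sum-none : ∀ {k} (f : Fin k → Carrier) → (∀ i → f i ≈ ε) → sum f ≈ ε
    sum-none {zero}  f h = ≈-refl
    sum-none {suc k} f h = ≈-trans (∙-cong (h zero) (sum-none (f ∘ suc) (h ∘ suc))) (identityˡ ε)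

    sum-one : ∀ {k} (f : Fin k → Carrier) B → (∀ i → i ≢ B → f i ≈ ε) → sum f ≈ f B
    sum-one f zero    h =
      ≈-trans (∙-cong ≈-refl (sum-none (f ∘ suc) (λ i → h (suc i) (λ ())))) (identityʳ _)
    sum-one f (suc B) h =
      ≈-trans (∙-cong (h zero (λ ())) (sum-one (f ∘ suc) B (λ i i≢B → h (suc i) (λ { refl → i≢B refl }))))
              (identityˡ _)

    sum-two : ∀ {k} (f : Fin k → Carrier) B C → B ≢ C →
      (∀ i → i ≢ B → i ≢ C → f i ≈ ε) → sum f ≈ f B ∙ f C
    sum-two f zero    zero    B≢C h = ⊥-elim (B≢C refl)
    sum-two f zero    (suc C) B≢C h =
      ∙-cong ≈-refl (sum-one (f ∘ suc) C (λ i i≢C → h (suc i) (λ ()) (λ { refl → i≢C refl })))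
    sum-two f (suc B) zero    B≢C h =
      ≈-trans (∙-cong ≈-refl (sum-one (f ∘ suc) B (λ i i≢B → h (suc i) (λ { refl → i≢B refl }) (λ ()))))
              (comm _ _)
    sum-two f (suc B) (suc C) B≢C h =
      ≈-trans (∙-cong (h zero (λ ()) (λ ()))
                (sum-two (f ∘ suc) B C (B≢C ∘ cong suc)
                  (λ i i≢B i≢C → h (suc i) (λ { refl → i≢B refl }) (λ { refl → i≢C refl }))))
              (identityˡ _)

  module ℕΣ = SparseSum ℕ.+-0-commutativeMonoid
  module ℤΣ = SparseSum ℤ.+-0-commutativeMonoid

  ind : ℕ → ℕ
  ind zero    = 0
  ind (suc _) = 1

  ind≤ : ∀ m → ind m ℕ.≤ m
  ind≤ zero    = z≤n
  ind≤ (suc m) = s≤s z≤n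

  ind≤1 : ∀ m → ind m ℕ.≤ 1
  ind≤1 zero    = z≤n
  ind≤1 (suc m) = ℕ.≤-refl

  support : ∀ {k} → (Fin k → ℕ) → ℕ
  support p = sumℕ (λ i → ind (p i))

  support≤ : ∀ {k} (p : Fin k → ℕ) → support p ℕ.≤ sumℕ p
  support≤ {zero}  p = z≤n
  support≤ {suc k} p = ℕ.+-mono-≤ (ind≤ (p zero)) (support≤ (p ∘ suc))

  -- Each block met besides `B` uses up at least one further element. When three blocks are met,
  -- this leaves two elements outside any given block, as `bool` demands.
  support+≤ : ∀ {k} (p : Fin k → ℕ) B → support p ℕ.+ p B ℕ.≤ suc (sumℕ p)
  support+≤ p zero rewrite ℕ.+-assoc (ind (p zero)) (support (p ∘ suc)) (p zero) | ℕ.+-comm (support (p ∘ suc)) (p zero) =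
    ℕ.+-mono-≤ (ind≤1 (p zero)) (ℕ.+-monoʳ-≤ (p zero) (support≤ (p ∘ suc)))
  support+≤ p (suc B) rewrite ℕ.+-assoc (ind (p zero)) (support (p ∘ suc)) (p (suc B)) =
    subst (λ x → ind (p zero) ℕ.+ (support (p ∘ suc) ℕ.+ p (suc B)) ℕ.≤ x) (ℕ.+-suc (p zero) _) (ℕ.+-mono-≤ (ind≤ (p zero)) (support+≤ (p ∘ suc) B))

  data Shape {k} (p : Fin k → ℕ) : Set where
    none : (∀ i → p i ≡ 0) → Shape p
    one  : ∀ B c → p B ≡ suc c → (∀ i → i ≢ B → p i ≡ 0) → Shape p
    two  : ∀ B C c d → B ≢ C → p B ≡ suc c → p C ≡ suc d →
           (∀ i → i ≢ B → i ≢ C → p i ≡ 0) → Shape p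
    many : 3 ℕ.≤ support p → Shape p

  shape : ∀ {k} (p : Fin k → ℕ) → Shape p
  shape {zero}  p = none (λ ())
  shape {suc k} p with p zero in eq | shape (p ∘ suc)
  ... | zero  | none h = none (λ { zero → eq ; (suc i) → h i })
  ... | zero  | one B c e h =
    one (suc B) c e (λ { zero _ → eq ; (suc i) i≢B → h i (i≢B ∘ cong suc) })
  ... | zero  | two B C c d B≢C e e′ h =
    two (suc B) (suc C) c d (λ { refl → B≢C refl }) e e′
      (λ { zero _ _ → eq ; (suc i) i≢B i≢C → h i (i≢B ∘ cong suc) (i≢C ∘ cong suc) })
  ... | zero  | many h = many (ℕ.≤-trans h (ℕ.m≤n+m _ (ind (p zero))))
  ... | suc a | none h =
    one zero a eq (λ { zero 0≢0 → ⊥-elim (0≢0 refl) ; (suc i) _ → h i })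
  ... | suc a | one B c e h =
    two zero (suc B) a c (λ ()) eq e
      (λ { zero 0≢0 _ → ⊥-elim (0≢0 refl) ; (suc i) _ i≢B → h i (i≢B ∘ cong suc) })
  ... | suc a | two B C c d B≢C e e′ h = many (subst (λ x → 3 ℕ.≤ ind x ℕ.+ support (p ∘ suc)) (sym eq)
    (s≤s (ℕ.≤-reflexive (sym (trans
      (ℕΣ.sum-two (λ i → ind (p (suc i))) B C B≢C (λ i i≢B i≢C → cong ind (h i i≢B i≢C)))
      (cong₂ ℕ._+_ (cong ind e) (cong ind e′)))))))
  ... | suc a | many h = many (ℕ.≤-trans h (ℕ.m≤n+m _ (ind (p zero))))

  inside+outside : ∀ {n} (B D : Subset n) → inside B D ℕ.+ outside B D ≡ ∣ D ∣
  inside+outside [] [] = refl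
  inside+outside (true ∷ B)  (true ∷ D)  = cong suc (inside+outside B D)
  inside+outside (true ∷ B)  (false ∷ D) = inside+outside B D
  inside+outside (false ∷ B) (true ∷ D)  = trans (ℕ.+-suc _ _) (cong suc (inside+outside B D))
  inside+outside (false ∷ B) (false ∷ D) = inside+outside B D

  inside-diff : ∀ {n} (B G H F : Subset n) → T (subᵇ G H) → T (subᵇ H F) →
    inside B (F ∖ G) ≡ inside B (F ∖ H) ℕ.+ inside B (H ∖ G)
  inside-diff [] [] [] [] _ _ = refl
  inside-diff (false ∷ B) (false ∷ G) (false ∷ H) (f ∷ F) s t = inside-diff B G H F s t
  inside-diff (false ∷ B) (false ∷ G) (true ∷ H) (true ∷ F) s t = inside-diff B G H F s t
  inside-diff (false ∷ B) (true ∷ G) (true ∷ H) (true ∷ F) s t = inside-diff B G H F s t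
  inside-diff (true ∷ B) (false ∷ G) (false ∷ H) (false ∷ F) s t = inside-diff B G H F s t
  inside-diff (true ∷ B) (false ∷ G) (false ∷ H) (true ∷ F) s t = cong suc (inside-diff B G H F s t)
  inside-diff (true ∷ B) (false ∷ G) (true ∷ H) (true ∷ F) s t = trans (cong suc (inside-diff B G H F s t)) (sym (ℕ.+-suc _ _))
  inside-diff (true ∷ B) (true ∷ G) (true ∷ H) (true ∷ F) s t = inside-diff B G H F s t

  outside-diff : ∀ {n} (B G H F : Subset n) → T (subᵇ G H) → T (subᵇ H F) →
    outside B (F ∖ G) ≡ outside B (F ∖ H) ℕ.+ outside B (H ∖ G)
  outside-diff [] [] [] [] _ _ = refl
  outside-diff (true ∷ B) (false ∷ G) (false ∷ H) (f ∷ F) s t = outside-diff B G H F s t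
  outside-diff (true ∷ B) (false ∷ G) (true ∷ H) (true ∷ F) s t = outside-diff B G H F s t
  outside-diff (true ∷ B) (true ∷ G) (true ∷ H) (true ∷ F) s t = outside-diff B G H F s t
  outside-diff (false ∷ B) (false ∷ G) (false ∷ H) (false ∷ F) s t = outside-diff B G H F s t
  outside-diff (false ∷ B) (false ∷ G) (false ∷ H) (true ∷ F) s t = cong suc (outside-diff B G H F s t)
  outside-diff (false ∷ B) (false ∷ G) (true ∷ H) (true ∷ F) s t = trans (cong suc (outside-diff B G H F s t)) (sym (ℕ.+-suc _ _))
  outside-diff (false ∷ B) (true ∷ G) (true ∷ H) (true ∷ F) s t = outside-diff B G H F s t

  ⊤∖ : ∀ {n} (H : Subset n) → ⊤ ∖ H ≡ ∁ H
  ⊤∖ []      = refl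
  ⊤∖ (x ∷ H) = cong (not x ∷_) (⊤∖ H)

  ∖⊥ : ∀ {n} (H : Subset n) → H ∖ ⊥ ≡ H
  ∖⊥ []          = refl
  ∖⊥ (true ∷ H)  = cong (true ∷_) (∖⊥ H)
  ∖⊥ (false ∷ H) = cong (false ∷_) (∖⊥ H)

  subᵇ-⊤ : ∀ {n} (H : Subset n) → T (subᵇ H ⊤)
  subᵇ-⊤ []          = _
  subᵇ-⊤ (true ∷ H)  = subᵇ-⊤ H
  subᵇ-⊤ (false ∷ H) = subᵇ-⊤ H

  subᵇ-⊥ : ∀ {n} (H : Subset n) → T (subᵇ ⊥ H)
  subᵇ-⊥ []      = _
  subᵇ-⊥ (_ ∷ H) = subᵇ-⊥ H

  subᵇ-refl : ∀ {n} (H : Subset n) → T (subᵇ H H)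
  subᵇ-refl []          = _
  subᵇ-refl (true ∷ H)  = subᵇ-refl H
  subᵇ-refl (false ∷ H) = subᵇ-refl H

  inside-∁ : ∀ {n} (B H F : Subset n) → T (subᵇ H F) →
    inside B (∁ H) ≡ inside B (∁ F) ℕ.+ inside B (F ∖ H)
  inside-∁ B H F s = subst₂ (λ x y → inside B x ≡ inside B y ℕ.+ inside B (F ∖ H)) (⊤∖ H) (⊤∖ F)
    (inside-diff B H F ⊤ s (subᵇ-⊤ F))

  outside-∁ : ∀ {n} (B H F : Subset n) → T (subᵇ H F) →
    outside B (∁ H) ≡ outside B (∁ F) ℕ.+ outside B (F ∖ H)
  outside-∁ B H F s = subst₂ (λ x y → outside B x ≡ outside B y ℕ.+ outside B (F ∖ H)) (⊤∖ H) (⊤∖ F)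
    (outside-diff B H F ⊤ s (subᵇ-⊤ F))

  size-diff : ∀ {n} (G H F : Subset n) → T (subᵇ G H) → T (subᵇ H F) →
    (codim F G) ≡ codim F H ℕ.+ (codim H G)
  size-diff [] [] [] _ _ = refl
  size-diff (false ∷ G) (false ∷ H) (false ∷ F) s t = size-diff G H F s t
  size-diff (false ∷ G) (false ∷ H) (true ∷ F) s t = cong suc (size-diff G H F s t)
  size-diff (false ∷ G) (true ∷ H) (true ∷ F) s t = trans (cong suc (size-diff G H F s t)) (sym (ℕ.+-suc _ _))
  size-diff (true ∷ G) (true ∷ H) (true ∷ F) s t = size-diff G H F s t

  size-∖ : ∀ {n} (H F : Subset n) → T (subᵇ H F) → ∣ F ∣ ≡ codim F H ℕ.+ ∣ H ∣
  size-∖ H F s = subst₂ (λ x y → ∣ x ∣ ≡ codim F H ℕ.+ ∣ y ∣) (∖⊥ F) (∖⊥ H) (size-diff ⊥ H F (subᵇ-⊥ H) s)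

  inside≤ : ∀ {n} (B D : Subset n) → inside B D ℕ.≤ ∣ D ∣
  inside≤ B D = subst (inside B D ℕ.≤_) (inside+outside B D) (ℕ.m≤m+n _ _)

  inside-insert : ∀ {n} (B H : Subset n) e → lookup H e ≡ false →
    inside B (∁ H) ≡ (if lookup B e then 1 else 0) ℕ.+ inside B (∁ (H ∪ ⁅ e ⁆))
  inside-insert (true ∷ B)  (false ∷ H) zero    h = cong (λ D → suc (inside B (∁ D))) (sym (∪-identityʳ H))
  inside-insert (false ∷ B) (false ∷ H) zero    h = cong (λ D → inside B (∁ D)) (sym (∪-identityʳ H))
  inside-insert (true ∷ B)  (true ∷ H)  (suc e) h = inside-insert B H e h
  inside-insert (true ∷ B)  (false ∷ H) (suc e) h = trans (cong suc (inside-insert B H e h)) (sym (ℕ.+-suc _ _))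
  inside-insert (false ∷ B) (x ∷ H)     (suc e) h = inside-insert B H e h

  size-insert : ∀ {n} (H : Subset n) e → lookup H e ≡ false → ∣ H ∪ ⁅ e ⁆ ∣ ≡ suc ∣ H ∣
  size-insert (false ∷ H) zero    h = cong (λ D → suc ∣ D ∣) (∪-identityʳ H)
  size-insert (true ∷ H)  (suc e) h = cong suc (size-insert H e h)
  size-insert (false ∷ H) (suc e) h = size-insert H e h

  inside-witness : ∀ {n} (B H : Subset n) {c} → inside B (∁ H) ≡ suc c →
    ∃ λ e → lookup H e ≡ false × lookup B e ≡ true
  inside-witness [] [] ()
  inside-witness (true ∷ B)  (false ∷ H) h = zero , refl , refl
  inside-witness (true ∷ B)  (true ∷ H)  h with e , p , q ← inside-witness B H h = suc e , p , q
  inside-witness (false ∷ B) (x ∷ H)     h with e , p , q ← inside-witness B H h = suc e , p , q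

  -- Quantifiers, counts and block profiles

  allFin? : ∀ {n} → (Fin n → Bool) → Bool
  allFin? {zero}  f = true
  allFin? {suc n} f = f zero ∧ allFin? (f ∘ suc)

  countFin : ∀ {n} → (Fin n → Bool) → ℕ
  countFin {zero}  f = 0
  countFin {suc n} f = (if f zero then 1 else 0) ℕ.+ countFin (f ∘ suc)

  allᵇ-tabulate : ∀ {m n} (f : Fin m → Bool) (g : Fin n → Fin m) →
    List.foldr (λ i acc → f i ∧ acc) true (List.tabulate g) ≡ allFin? (f ∘ g)
  allᵇ-tabulate {n = zero}  f g = refl
  allᵇ-tabulate {n = suc n} f g = cong (f (g zero) ∧_) (allᵇ-tabulate f (g ∘ suc))

  filter-tabulate : ∀ {m n} (f : Fin m → Bool) (P? : ∀ i → Dec (T (f i))) (g : Fin n → Fin m) →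
    List.length (List.filter P? (List.tabulate g)) ≡ countFin (f ∘ g)
  filter-tabulate {n = zero}  f P? g = refl
  filter-tabulate {n = suc n} f P? g with f (g zero) | P? (g zero)
  ... | true  | yes _ = cong suc (filter-tabulate f P? (g ∘ suc))
  ... | true  | no ¬t = ⊥-elim (¬t _)
  ... | false | no _  = filter-tabulate f P? (g ∘ suc)

  countᵇ≡countFin : ∀ n (f : Fin n → Bool) → countᵇ n f ≡ countFin f
  countᵇ≡countFin n f = filter-tabulate f _ (λ i → i)

  countFin-cong : ∀ {n} {f g : Fin n → Bool} → (∀ i → f i ≡ g i) → countFin f ≡ countFin g
  countFin-cong {zero}  h = refl
  countFin-cong {suc n} h = cong₂ ℕ._+_ (cong (if_then 1 else 0) (h zero)) (countFin-cong (h ∘ suc))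

  allFin?-true : ∀ {n} (f : Fin n → Bool) → (∀ i → f i ≡ true) → allFin? f ≡ true
  allFin?-true {zero}  f h = refl
  allFin?-true {suc n} f h rewrite h zero = allFin?-true (f ∘ suc) (h ∘ suc)

  allFin?-false : ∀ {n} (f : Fin n → Bool) i → f i ≡ false → allFin? f ≡ false
  allFin?-false f zero    h rewrite h = refl
  allFin?-false f (suc i) h rewrite allFin?-false (f ∘ suc) i h = ∧-zeroʳ _

  inside-⊤ : ∀ {n} (c : Fin n → Bool) → inside (tabulate c) ⊤ ≡ countFin c
  inside-⊤ {zero}  c = refl
  inside-⊤ {suc n} c with c zero
  ... | true  = cong suc (inside-⊤ (c ∘ suc))
  ... | false = inside-⊤ (c ∘ suc)

  meets : ∀ {n} (c : Fin n → Bool) (A : Subset n) →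
    (if not (allFin? (λ e → not (lookup A e ∧ c e))) then 1 else 0) ≡ ind (inside (tabulate c) A)
  meets c [] = refl
  meets c (true ∷ A) with c zero
  ... | true  = refl
  ... | false = meets (c ∘ suc) A
  meets c (false ∷ A) with c zero
  ... | true  = meets (c ∘ suc) A
  ... | false = meets (c ∘ suc) A

  -- A flat is described through its complement Y, and Y through its profile: the numbers In Y i of
  -- elements of Y in block i, and the numbers Out Y i of elements of Y outside block i.
  module Blocks {n k : ℕ} (b : Fin n → Fin k) where

    block : Fin k → Subset n
    block i = tabulate (λ e → does (b e Fin.≟ i))

    In Out : Subset n → Fin k → ℕ
    In Y i  = inside (block i) Y
    Out Y i = outside (block i) Y

    blocksMeeting≡support : ∀ Y → blocksMeeting b Y ≡ support (In Y)
    blocksMeeting≡support Y = trans (countᵇ≡countFin k _) (countFin≡sumℕ _ _ lemma)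
      where
      countFin≡sumℕ : ∀ {k} (f : Fin k → Bool) (g : Fin k → ℕ) →
        (∀ i → (if f i then 1 else 0) ≡ g i) → countFin f ≡ sumℕ g
      countFin≡sumℕ {zero}  f g h = refl
      countFin≡sumℕ {suc k} f g h = cong₂ ℕ._+_ (h zero) (countFin≡sumℕ (f ∘ suc) (g ∘ suc) (h ∘ suc))
      lemma : ∀ i → (if not (allᵇ n (λ e → not (lookup Y e ∧ does (b e Fin.≟ i)))) then 1 else 0) ≡ ind (In Y i)
      lemma i = trans (cong (λ x → if not x then 1 else 0) (allᵇ-tabulate (λ e → not (lookup Y e ∧ does (b e Fin.≟ i))) (λ e → e)))
                      (meets (λ e → does (b e Fin.≟ i)) Y)

    sum-In : ∀ Y → sumℕ (In Y) ≡ ∣ Y ∣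
    sum-In Y = go b Y
      where
      go : ∀ {n} (b : Fin n → Fin k) (Y : Subset n) →
        sumℕ (λ i → inside (tabulate (λ e → does (b e Fin.≟ i))) Y) ≡ ∣ Y ∣
      go b [] = ℕΣ.sum-none {k} (λ _ → 0) (λ _ → refl)
      go b (false ∷ Y) = trans (sum-cong-≗ (λ i → step i)) (go (b ∘ suc) Y)
        where
        step : ∀ i → inside (does (b zero Fin.≟ i) ∷ tabulate (λ e → does (b (suc e) Fin.≟ i))) (false ∷ Y) ≡
                     inside (tabulate (λ e → does (b (suc e) Fin.≟ i))) Y
        step i with does (b zero Fin.≟ i)
        ... | true  = refl
        ... | false = refl
      go b (true ∷ Y) = trans (sum-cong-≗ step) (trans (∑-distrib-+ δ _)
          (cong₂ ℕ._+_ (trans (ℕΣ.sum-one δ (b zero) off) on) (go (b ∘ suc) Y)))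
        where
        δ : Fin k → ℕ
        δ i = if does (b zero Fin.≟ i) then 1 else 0
        step : ∀ i → inside (does (b zero Fin.≟ i) ∷ tabulate (λ e → does (b (suc e) Fin.≟ i))) (true ∷ Y) ≡
                     δ i ℕ.+ inside (tabulate (λ e → does (b (suc e) Fin.≟ i))) Y
        step i with does (b zero Fin.≟ i)
        ... | true  = refl
        ... | false = refl
        off : ∀ i → i ≢ b zero → δ i ≡ 0
        off i ne rewrite dec-false (b zero Fin.≟ i) (ne ∘ sym) = refl
        on : δ (b zero) ≡ 1
        on rewrite dec-true (b zero Fin.≟ b zero) refl = refl

    In+Out : ∀ Y i → In Y i ℕ.+ Out Y i ≡ ∣ Y ∣
    In+Out Y i = inside+outside (block i) Y

    data Kind (Y : Subset n) : Set where
      empty  : ∣ Y ∣ ≡ 0 → Kind Y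
      single : ∀ B c → In Y B ≡ suc c → Out Y B ≡ 0 → (∀ i → i ≢ B → In Y i ≡ 0) → Kind Y
      -- two blocks, one of which is met in a single element; the only nonempty complements of
      -- non-flats besides singletons
      pinch  : ∀ B C c → B ≢ C → In Y B ≡ suc c → Out Y B ≡ 1 → In Y C ≡ 1 → Out Y C ≡ suc c →
               (∀ i → i ≢ B → i ≢ C → In Y i ≡ 0) → Kind Y
      bool   : 2 ℕ.≤ support (In Y) → (∀ i → 2 ℕ.≤ Out Y i) → 3 ℕ.≤ ∣ Y ∣ → Kind Y

    kind : ∀ Y → Kind Y
    kind Y with shape (In Y)
    ... | none h = empty (trans (sym (sum-In Y)) (ℕΣ.sum-none (In Y) h))
    ... | one B c e h = single B c e out h
      where
      out : Out Y B ≡ 0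
      out = ℕ.+-cancelˡ-≡ (In Y B) _ _ (trans (In+Out Y B) (trans (sym (sum-In Y))
              (trans (ℕΣ.sum-one (In Y) B h) (sym (ℕ.+-identityʳ _)))))
    ... | two B C c d B≢C e e′ h = split c d e e′
      where
      total : ∣ Y ∣ ≡ In Y B ℕ.+ In Y C
      total = trans (sym (sum-In Y)) (ℕΣ.sum-two (In Y) B C B≢C h)
      outB : Out Y B ≡ In Y C
      outB = ℕ.+-cancelˡ-≡ (In Y B) _ _ (trans (In+Out Y B) total)
      outC : Out Y C ≡ In Y B
      outC = ℕ.+-cancelˡ-≡ (In Y C) _ _ (trans (In+Out Y C) (trans total (ℕ.+-comm (In Y B) _)))
      split : ∀ c d → In Y B ≡ suc c → In Y C ≡ suc d → Kind Y
      -- Two single elements also land here, with `c` zero. The next clause swaps the blocks, since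
      -- the second block of `pinch` is the one met once.
      split c zero    e e′ = pinch B C c B≢C e (trans outB e′) e′ (trans outC e) h
      split zero (suc d) e e′ = pinch C B (suc d) (B≢C ∘ sym) e′ (trans outC e) e (trans outB e′) (λ i p q → h i q p)
      split (suc c) (suc d) e e′ = bool
        (ℕ.≤-reflexive (sym (trans (ℕΣ.sum-two (λ i → ind (In Y i)) B C B≢C (λ i p q → cong ind (h i p q)))
          (cong₂ ℕ._+_ (cong ind e) (cong ind e′)))))
        out (ℕ.≤-trans (s≤s (s≤s (s≤s z≤n))) (ℕ.≤-reflexive (sym size)))
        where
        size : ∣ Y ∣ ≡ 4 ℕ.+ (c ℕ.+ d)
        size = trans total (trans (cong₂ ℕ._+_ e e′) (cong (2 ℕ.+_) (trans (ℕ.+-suc c _) (cong suc (ℕ.+-suc c d)))))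
        out : ∀ i → 2 ℕ.≤ Out Y i
        out i with i Fin.≟ B | i Fin.≟ C
        ... | yes refl | _ = subst (2 ℕ.≤_) (sym (trans outB e′)) (s≤s (s≤s z≤n))
        ... | no _ | yes refl = subst (2 ℕ.≤_) (sym (trans outC e)) (s≤s (s≤s z≤n))
        ... | no p | no q = subst (2 ℕ.≤_) (trans (sym size) (trans (sym (In+Out Y i)) (cong (ℕ._+ Out Y i) (h i p q)))) (s≤s (s≤s z≤n))
    ... | many h = bool (ℕ.≤-trans (ℕ.n≤1+n 2) h) out (ℕ.≤-trans h (subst (support (In Y) ℕ.≤_) (sum-In Y) (support≤ (In Y))))
      where
      out : ∀ i → 2 ℕ.≤ Out Y i
      out i = ℕ.≤-pred (ℕ.+-cancelˡ-≤ (In Y i) _ _ (begin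
        In Y i ℕ.+ 3                ≤⟨ ℕ.+-monoʳ-≤ (In Y i) h ⟩
        In Y i ℕ.+ support (In Y)   ≡⟨ ℕ.+-comm (In Y i) _ ⟩
        support (In Y) ℕ.+ In Y i   ≤⟨ support+≤ (In Y) i ⟩
        suc (sumℕ (In Y))           ≡⟨ cong suc (trans (sum-In Y) (sym (In+Out Y i))) ⟩
        suc (In Y i ℕ.+ Out Y i)    ≡⟨ sym (ℕ.+-suc _ _) ⟩
        In Y i ℕ.+ suc (Out Y i)    ∎))
        where open ℕ.≤-Reasoning

  outside-insert : ∀ {n} (B H : Subset n) e → lookup H e ≡ false →
    outside B (∁ H) ℕ.≤ suc (outside B (∁ (H ∪ ⁅ e ⁆)))
  outside-insert (true ∷ B)  (false ∷ H) zero    h rewrite ∪-identityʳ H = ℕ.n≤1+n _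
  outside-insert (false ∷ B) (false ∷ H) zero    h rewrite ∪-identityʳ H = ℕ.≤-refl
  outside-insert (true ∷ B)  (x ∷ H)     (suc e) h = outside-insert B H e h
  outside-insert (false ∷ B) (true ∷ H)  (suc e) h = outside-insert B H e h
  outside-insert (false ∷ B) (false ∷ H) (suc e) h = s≤s (outside-insert B H e h)

  support-cong : ∀ {k} {p q : Fin k → ℕ} → (∀ i → p i ≡ q i) → support p ≡ support q
  support-cong h = sum-cong-≗ (λ i → cong ind (h i))

  -- Rank and flats of the dual matroid

  module Flats {n k : ℕ} (b : Fin n → Fin k) where
    open Blocks b public

    module _ (rank≥2 : 2 ℕ.≤ support (In ⊤)) where

      r : RankFn n
      r = partitionMatroid b

      rank-support : ∀ H → r H ≡ (∣ H ∣ ℕ.+ (2 ⊓ support (In (∁ H)))) ∸ 2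
      rank-support H = cong₂ (λ x y → (∣ H ∣ ℕ.+ (2 ⊓ x)) ∸ y) (blocksMeeting≡support (∁ H))
        (trans (cong (2 ⊓_) (blocksMeeting≡support ⊤)) (ℕ.m≤n⇒m⊓n≡m rank≥2))

      rank-0 : ∀ H → support (In (∁ H)) ≡ 0 → r H ≡ ∣ H ∣ ∸ 2
      rank-0 H e = trans (rank-support H) (trans (cong (λ x → (∣ H ∣ ℕ.+ (2 ⊓ x)) ∸ 2) e)
                     (cong (_∸ 2) (ℕ.+-identityʳ ∣ H ∣)))

      rank-1 : ∀ H → support (In (∁ H)) ≡ 1 → r H ≡ ∣ H ∣ ∸ 1
      rank-1 H e = trans (rank-support H) (trans (cong (λ x → (∣ H ∣ ℕ.+ (2 ⊓ x)) ∸ 2) e)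
                     (cong (_∸ 2) (ℕ.+-comm ∣ H ∣ 1)))

      rank-2 : ∀ H → 2 ℕ.≤ support (In (∁ H)) → r H ≡ ∣ H ∣
      rank-2 H h = trans (rank-support H) (trans (cong (λ x → (∣ H ∣ ℕ.+ x) ∸ 2) (ℕ.m≤n⇒m⊓n≡m h))
                     (cong (_∸ 2) (ℕ.+-comm ∣ H ∣ 2)))

      In≡0 : ∀ {Y} → ∣ Y ∣ ≡ 0 → ∀ i → In Y i ≡ 0
      In≡0 {Y} e i = ℕ.n≤0⇒n≡0 (subst (In Y i ℕ.≤_) e (inside≤ (block i) Y))

      support-empty : ∀ {Y} → ∣ Y ∣ ≡ 0 → support (In Y) ≡ 0
      support-empty {Y} e = ℕΣ.sum-none (λ i → ind (In Y i)) (λ i → cong ind (In≡0 {Y} e i))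

      support-single : ∀ {Y} B {c} → In Y B ≡ suc c → (∀ i → i ≢ B → In Y i ≡ 0) → support (In Y) ≡ 1
      support-single {Y} B e h = trans (ℕΣ.sum-one (λ i → ind (In Y i)) B (λ i p → cong ind (h i p))) (cong ind e)

      support-pinch : ∀ {Y} B C {c} → B ≢ C → In Y B ≡ suc c → In Y C ≡ 1 →
        (∀ i → i ≢ B → i ≢ C → In Y i ≡ 0) → support (In Y) ≡ 2
      support-pinch {Y} B C B≢C e e′ h =
        trans (ℕΣ.sum-two (λ i → ind (In Y i)) B C B≢C (λ i p q → cong ind (h i p q)))
              (cong₂ ℕ._+_ (cong ind e) (cong ind e′))

      -- The complement of the empty set meets at least two blocks. Positive size makes the
      -- truncated `∣ H ∣ ∸ 1` in `rank-1` an honest predecessor.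
      ∁-nonfull : ∀ H → support (In (∁ H)) ℕ.< 2 → 1 ℕ.≤ ∣ H ∣
      ∁-nonfull H lt with ∣ H ∣ in eq
      ... | suc _ = s≤s z≤n
      ... | zero  = ⊥-elim (ℕ.<-irrefl refl (ℕ.≤-<-trans
          (subst (2 ℕ.≤_) (support-cong same) rank≥2) lt))
        where
        same : ∀ i → In ⊤ i ≡ In (∁ H) i
        same i = trans (cong (inside (block i)) (trans (sym (∖⊥ ⊤)) (⊤∖ ⊥)))
          (trans (inside-∁ (block i) ⊥ H (subᵇ-⊥ H))
          (trans (cong (In (∁ H) i ℕ.+_) (trans (cong (inside (block i)) (∖⊥ H)) (In≡0 {H} eq i)))
                 (ℕ.+-identityʳ _)))

      removed : ∀ H e → lookup H e ≡ false →
        (In (∁ H) (b e) ≡ suc (In (∁ (H ∪ ⁅ e ⁆)) (b e))) ×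
        (∀ i → i ≢ b e → In (∁ H) i ≡ In (∁ (H ∪ ⁅ e ⁆)) i)
      removed H e h = same , other
        where
        same : In (∁ H) (b e) ≡ suc (In (∁ (H ∪ ⁅ e ⁆)) (b e))
        same = trans (inside-insert (block (b e)) H e h)
          (cong (λ x → (if x then 1 else 0) ℕ.+ In (∁ (H ∪ ⁅ e ⁆)) (b e))
            (trans (lookup∘tabulate _ e) (dec-true (b e Fin.≟ b e) refl)))
        other : ∀ i → i ≢ b e → In (∁ H) i ≡ In (∁ (H ∪ ⁅ e ⁆)) i
        other i ne = trans (inside-insert (block i) H e h)
          (cong (λ x → (if x then 1 else 0) ℕ.+ In (∁ (H ∪ ⁅ e ⁆)) i)
            (trans (lookup∘tabulate _ e) (dec-false (b e Fin.≟ i) (ne ∘ sym))))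

      witness : ∀ H B {c} → In (∁ H) B ≡ suc c → ∃ λ e → lookup H e ≡ false × b e ≡ B
      witness H B h with e , p , q ← inside-witness (block B) H h = e , p , eq
        where
        eq : b e ≡ B
        eq with b e Fin.≟ B | trans (sym q) (lookup∘tabulate (λ e → does (b e Fin.≟ B)) e)
        ... | yes p | _ = p
        ... | no _ | ()

      flat-by : ∀ H → (∀ e → lookup H e ≡ false → r H ℕ.< r (H ∪ ⁅ e ⁆)) → flatᵇ r H ≡ true
      flat-by H h = trans (allᵇ-tabulate (λ e → lookup H e ∨ (r H <ᵇ r (H ∪ ⁅ e ⁆))) (λ e → e))
        (allFin?-true _ step)
        where
        step : ∀ e → lookup H e ∨ (r H <ᵇ r (H ∪ ⁅ e ⁆)) ≡ true
        step e with lookup H e in eq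
        ... | true  = refl
        ... | false with r H <ᵇ r (H ∪ ⁅ e ⁆) | ℕ.<⇒<ᵇ (h e eq)
        ...   | true | _ = refl

      nonflat-by : ∀ H e → lookup H e ≡ false → r (H ∪ ⁅ e ⁆) ℕ.≤ r H → flatᵇ r H ≡ false
      nonflat-by H e h le = trans (allᵇ-tabulate (λ e → lookup H e ∨ (r H <ᵇ r (H ∪ ⁅ e ⁆))) (λ e → e))
        (allFin?-false _ e step)
        where
        step : lookup H e ∨ (r H <ᵇ r (H ∪ ⁅ e ⁆)) ≡ false
        step rewrite h with r H <ᵇ r (H ∪ ⁅ e ⁆) in eq
        ... | false = refl
        ... | true = ⊥-elim (ℕ.<⇒≱ (ℕ.<ᵇ⇒< (r H) (r (H ∪ ⁅ e ⁆)) (subst T (sym eq) _)) le)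

      -- Flats of a dual matroid are the complements of unions of circuits. The circuits of the
      -- rank-2 matroid are the pairs within a block and the triples from three different blocks, so
      -- the nonempty sets that fail are singletons and those where one of two blocks is met once.
      kindFlat : ∀ {Y} → Kind Y → Bool
      kindFlat (empty _)              = true
      kindFlat (single _ c _ _ _)     = 0 <ᵇ c
      kindFlat (pinch _ _ _ _ _ _ _ _ _) = false
      kindFlat (bool _ _ _)           = true

      -- Removing one element from a `bool` complement may leave a `pinch`, so only one element
      -- outside each block is guaranteed. That still suffices for `rank-2`. The index of type
      -- `Fin k` excludes the empty complement.
      support≥2 : ∀ {Y} → (∀ i → 1 ℕ.≤ Out Y i) → Fin k → 2 ℕ.≤ support (In Y)
      support≥2 {Y} h i with kind Y
      ... | empty e = ⊥-elim (ℕ.<⇒≱ (h i) (ℕ.≤-trans (ℕ.m≤n+m _ (In Y i)) (ℕ.≤-reflexive (trans (In+Out Y i) e))))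
      ... | single B c p o z = ⊥-elim (ℕ.<⇒≱ (h B) (ℕ.≤-reflexive o))
      ... | pinch B C c B≢C p o p′ o′ z = ℕ.≤-reflexive (sym (support-pinch {Y} B C B≢C p p′ z))
      ... | bool s _ _ = s

      kindFlat-correct : ∀ H (κ : Kind (∁ H)) → flatᵇ r H ≡ kindFlat κ
      kindFlat-correct H (empty e) = flat-by H (λ x h → ⊥-elim (contra x h))
        where
        contra : ∀ x → lookup H x ≡ false → _
        contra x h with () ← trans (sym (proj₁ (removed H x h))) (In≡0 {∁ H} e (b x))
      -- Adding the last missing element takes the number of blocks met from one to none, which
      -- cancels the gain in size.
      kindFlat-correct H (single B zero p o z) with x , h , refl ← witness H B p =
        nonflat-by H x h (ℕ.≤-reflexive (begin
          r (H ∪ ⁅ x ⁆)      ≡⟨ rank-0 (H ∪ ⁅ x ⁆) (ℕΣ.sum-none (λ i → ind (In (∁ (H ∪ ⁅ x ⁆)) i)) (λ i → cong ind (vanish i))) ⟩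
          ∣ H ∪ ⁅ x ⁆ ∣ ∸ 2  ≡⟨ cong (_∸ 2) (size-insert H x h) ⟩
          ∣ H ∣ ∸ 1          ≡⟨ sym (rank-1 H (support-single {∁ H} B p z)) ⟩
          r H                ∎))
        where
        open ≡-Reasoning
        vanish : ∀ i → In (∁ (H ∪ ⁅ x ⁆)) i ≡ 0
        vanish i with i Fin.≟ b x
        ... | yes refl = ℕ.suc-injective (trans (sym (proj₁ (removed H x h))) p)
        ... | no ne = trans (sym (proj₂ (removed H x h) i ne)) (z i ne)
      kindFlat-correct H (single B (suc c) p o z) = flat-by H grow
        where
        supp : support (In (∁ H)) ≡ 1
        supp = support-single {∁ H} B p z
        size : 1 ℕ.≤ ∣ H ∣
        size = ∁-nonfull H (s≤s (ℕ.≤-reflexive supp))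
        grow : ∀ x → lookup H x ≡ false → r H ℕ.< r (H ∪ ⁅ x ⁆)
        grow x h with b x Fin.≟ B
        ... | no ne with () ← trans (sym (proj₁ (removed H x h))) (z (b x) ne)
        ... | yes refl = begin-strict
          r H                ≡⟨ rank-1 H supp ⟩
          ∣ H ∣ ∸ 1          <⟨ ℕ.≤-reflexive (ℕ.m+[n∸m]≡n size) ⟩
          ∣ H ∣              ≡⟨ sym (cong (_∸ 1) (size-insert H x h)) ⟩
          ∣ H ∪ ⁅ x ⁆ ∣ ∸ 1  ≡⟨ sym (rank-1 (H ∪ ⁅ x ⁆) (support-single {∁ (H ∪ ⁅ x ⁆)} B
                                  (ℕ.suc-injective (trans (sym (proj₁ (removed H x h))) p))
                                  (λ i ne → trans (sym (proj₂ (removed H x h) i ne)) (z i ne)))) ⟩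
          r (H ∪ ⁅ x ⁆)      ∎
          where open ℕ.≤-Reasoning
      -- Adding the only missing element of `C` takes the number of blocks met from two to one,
      -- which again cancels the gain in size.
      kindFlat-correct H (pinch B C c B≢C p o p′ o′ z) with x , h , refl ← witness H C p′ =
        nonflat-by H x h (ℕ.≤-reflexive (begin
          r (H ∪ ⁅ x ⁆)      ≡⟨ rank-1 (H ∪ ⁅ x ⁆) (support-single {∁ (H ∪ ⁅ x ⁆)} B
                                  (trans (sym (proj₂ (removed H x h) B B≢C)) p) vanish) ⟩
          ∣ H ∪ ⁅ x ⁆ ∣ ∸ 1  ≡⟨ cong (_∸ 1) (size-insert H x h) ⟩
          ∣ H ∣              ≡⟨ sym (rank-2 H (ℕ.≤-reflexive (sym (support-pinch {∁ H} B C B≢C p p′ z)))) ⟩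
          r H                ∎))
        where
        open ≡-Reasoning
        vanish : ∀ i → i ≢ B → In (∁ (H ∪ ⁅ x ⁆)) i ≡ 0
        vanish i i≢B with i Fin.≟ b x
        ... | yes refl = ℕ.suc-injective (trans (sym (proj₁ (removed H x h))) p′)
        ... | no ne = trans (sym (proj₂ (removed H x h) i ne)) (z i i≢B ne)
      kindFlat-correct H (bool s out _) = flat-by H grow
        where
        grow : ∀ x → lookup H x ≡ false → r H ℕ.< r (H ∪ ⁅ x ⁆)
        grow x h = begin-strict
          r H             ≡⟨ rank-2 H s ⟩
          ∣ H ∣           <⟨ ℕ.≤-reflexive (sym (size-insert H x h)) ⟩
          ∣ H ∪ ⁅ x ⁆ ∣   ≡⟨ sym (rank-2 (H ∪ ⁅ x ⁆) (support≥2 {∁ (H ∪ ⁅ x ⁆)} out′ (b x))) ⟩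
          r (H ∪ ⁅ x ⁆)   ∎
          where
          open ℕ.≤-Reasoning
          out′ : ∀ i → 1 ℕ.≤ Out (∁ (H ∪ ⁅ x ⁆)) i
          out′ i = ℕ.≤-pred (ℕ.≤-trans (out i) (outside-insert (block i) H x h))

  -- The Möbius function on flats

  δ : ℕ → ℕ → ℤ
  δ zero    zero    = 1ℤ
  δ zero    (suc _) = 0ℤ
  δ (suc _) zero    = 0ℤ
  δ (suc j) (suc i) = δ j i

  choose2 : ℕ → ℤ
  choose2 zero    = 0ℤ
  choose2 (suc x) = choose2 x + ℤ.+ x

  bin-δ0 : ∀ p → bin p (δ 0) ≡ 1ℤ
  bin-δ0 zero    = refl
  bin-δ0 (suc p) = cong₂ _+_ (bin-δ0 p) (bin-zero p)

  bin-δ1 : ∀ p → bin p (δ 1) ≡ ℤ.+ p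
  bin-δ1 zero    = refl
  bin-δ1 (suc p) = trans (cong₂ _+_ (bin-δ1 p) (bin-δ0 p)) (ℤ.+-comm (ℤ.+ p) 1ℤ)

  bin-δ2 : ∀ p → bin p (δ 2) ≡ choose2 p
  bin-δ2 zero    = refl
  bin-δ2 (suc p) = cong₂ _+_ (bin-δ2 p) (bin-δ1 p)

  bin-negpow : ∀ p → bin p negpow ≡ δ 0 p
  bin-negpow zero    = refl
  bin-negpow (suc p) =
    trans (sym (bin-+ p negpow (λ i → - negpow i)))
          (trans (bin-cong p (λ i → ℤ.+-inverseʳ (negpow i))) (bin-zero p))

  negpow-+ : ∀ a b → negpow (a ℕ.+ b) ≡ negpow a * negpow b
  negpow-+ zero    b = sym (ℤ.*-identityˡ _)
  negpow-+ (suc a) b = trans (cong -_ (negpow-+ a b)) (ℤ.neg-distribˡ-* (negpow a) (negpow b))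

  negpow² : ∀ a → negpow a * negpow a ≡ 1ℤ
  negpow² zero    = refl
  negpow² (suc a) = trans (lemma (negpow a)) (negpow² a)
    where
    lemma : ∀ x → (- x) * (- x) ≡ x * x
    lemma = solve-∀

  δ0-* : ∀ p q → δ 0 p * δ 0 q ≡ δ 0 (p ℕ.+ q)
  δ0-* zero    q = ℤ.*-identityˡ _
  δ0-* (suc p) q = refl

  negpow-δ0 : ∀ a → negpow a * δ 0 a ≡ δ 0 a
  negpow-δ0 zero    = refl
  negpow-δ0 (suc a) = ℤ.*-zeroʳ (- negpow a)

  intervalSum-* : ∀ {n} (G F : Subset n) c (f : Subset n → ℤ) →
    intervalSum G F (λ H → c * f H) ≡ c * intervalSum G F f
  intervalSum-* []          []          c f = refl
  intervalSum-* (false ∷ G) (false ∷ F) c f = intervalSum-* G F c _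
  intervalSum-* (false ∷ G) (true ∷ F)  c f =
    trans (cong₂ _+_ (intervalSum-* G F c _) (intervalSum-* G F c _)) (sym (ℤ.*-distribˡ-+ c _ _))
  intervalSum-* (true ∷ G)  (false ∷ F) c f = sym (ℤ.*-zeroʳ c)
  intervalSum-* (true ∷ G)  (true ∷ F)  c f = intervalSum-* G F c _

  intervalSum-Σᶠ : ∀ {n k} (G F : Subset n) (f : Fin k → Subset n → ℤ) →
    intervalSum G F (λ H → Σᶠ (λ i → f i H)) ≡ Σᶠ (λ i → intervalSum G F (f i))
  intervalSum-Σᶠ {k = zero}  G F f = intervalSum-zero G F
  intervalSum-Σᶠ {k = suc k} G F f =
    trans (intervalSum-+ G F (f zero) _) (cong (intervalSum G F (f zero) +_) (intervalSum-Σᶠ G F (f ∘ suc)))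

  -- Pulls out a sign that does not depend on `H`; what remains is a function of `F ∖ H`, as the
  -- binomial sums require.
  sign-split : ∀ {n} (G H F : Subset n) → T (subᵇ G H) → T (subᵇ H F) →
    negpow (codim H G) ≡ negpow (codim F G) * negpow (codim F H)
  sign-split G H F s t = sym (begin
    negpow (codim F G) * negpow y             ≡⟨ cong (λ a → negpow a * negpow y) (size-diff G H F s t) ⟩
    negpow (y ℕ.+ x) * negpow y             ≡⟨ cong (_* negpow y) (negpow-+ y x) ⟩
    (negpow y * negpow x) * negpow y        ≡⟨ lemma (negpow y) (negpow x) ⟩
    (negpow y * negpow y) * negpow x        ≡⟨ cong (_* negpow x) (negpow² y) ⟩
    1ℤ * negpow x                           ≡⟨ ℤ.*-identityˡ _ ⟩
    negpow x                                ∎)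
    where
    open ≡-Reasoning
    y = (codim F H)
    x = (codim H G)
    lemma : ∀ a b → (a * b) * a ≡ (a * a) * b
    lemma = solve-∀

  eqᵇ-δ0 : ∀ {n} (G F : Subset n) → T (subᵇ G F) → (if eqᵇ G F then 1ℤ else 0ℤ) ≡ δ 0 (codim F G)
  eqᵇ-δ0 []          []          s = refl
  eqᵇ-δ0 (false ∷ G) (false ∷ F) s = eqᵇ-δ0 G F s
  eqᵇ-δ0 (false ∷ G) (true ∷ F)  s with subᵇ G F
  ... | true  = refl
  ... | false = refl
  eqᵇ-δ0 (true ∷ G)  (true ∷ F)  s = eqᵇ-δ0 G F s

  []-* : ∀ c x y → [ c ⇒ x * y ] ≡ x * [ c ⇒ y ]
  []-* true  x y = refl
  []-* false x y = sym (ℤ.*-zeroʳ x)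

  []-true : ∀ {c} x → T c → [ c ⇒ x ] ≡ x
  []-true {true} x _ = refl

  module Möbius {n k : ℕ} (b : Fin n → Fin k) where
    open Flats b public

    module _ (rank≥2 : 2 ℕ.≤ support (In ⊤)) where

      private
        R = r rank≥2
        flat? : ∀ {Y} → Kind Y → Bool
        flat? = kindFlat rank≥2
        flat?-correct = kindFlat-correct rank≥2

      somePoint : Fin k
      somePoint = go b rank≥2
        where
        go : ∀ {n k} (b : Fin n → Fin k) → 2 ℕ.≤ support (Blocks.In b ⊤) → Fin k
        go {k = suc k} b _ = zero

      topWeight : Subset n → ℤ
      topWeight G = 1ℤ + - (ℤ.+ ∣ ∁ G ∣) + choose2 ∣ ∁ G ∣ + - Σᶠ (λ i → choose2 (In (∁ G) i))

      -- The alternating count of independent sets in the minor of the rank-2 matroid dual to the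
      -- interval. Contracting a `bool` complement leaves rank 0 and only the empty set; contracting
      -- part of block `B` leaves rank 1, with the elements outside `B` as nonloops; contracting
      -- nothing gives `topWeight`, whose last two terms count pairs from different blocks.
      value : Subset n → ∀ {Y} → Kind Y → ℤ
      value G (empty _)                   = topWeight G
      value G (single B _ _ _ _)          = 1ℤ + - (ℤ.+ Out (∁ G) B)
      value G (pinch _ _ _ _ _ _ _ _ _)   = 0ℤ
      value G (bool _ _ _)                = 1ℤ

      möb : Subset n → Subset n → ℤ
      möb G F = negpow (codim F G) * value G (kind (∁ F))

      term : ∀ (G F H : Subset n) → T (subᵇ G H) → T (subᵇ H F) →
        [ flatᵇ R H ⇒ möb G H ] ≡
        negpow (codim F G) * [ flat? (kind (∁ H)) ⇒ negpow (codim F H) * value G (kind (∁ H)) ]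
      term G F H s t = begin
        [ flatᵇ R H ⇒ möb G H ]            ≡⟨ cong [_⇒ möb G H ] (flat?-correct H κ) ⟩
        [ flat? κ ⇒ negpow (codim H G) * v ]   ≡⟨ cong (λ x → [ flat? κ ⇒ x * v ]) (sign-split G H F s t) ⟩
        [ flat? κ ⇒ c * y * v ]            ≡⟨ cong [ flat? κ ⇒_] (ℤ.*-assoc c y v) ⟩
        [ flat? κ ⇒ c * (y * v) ]          ≡⟨ []-* (flat? κ) c (y * v) ⟩
        c * [ flat? κ ⇒ y * v ]            ∎
        where
        open ≡-Reasoning
        κ = kind (∁ H)
        v = value G κ
        c = negpow (codim F G)
        y = negpow (codim F H)

      Out≥2⇒bool : ∀ G {Y} (κ : Kind Y) → (∀ i → 2 ℕ.≤ Out Y i) → flat? κ ≡ true × value G κ ≡ 1ℤ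
      Out≥2⇒bool G {Y} (empty e) h with () ← ℕ.≤-trans (h somePoint)
        (ℕ.≤-trans (ℕ.m≤n+m _ (In Y somePoint)) (ℕ.≤-reflexive (trans (In+Out Y somePoint) e)))
      Out≥2⇒bool G (single B c p o z) h with () ← ℕ.≤-trans (h B) (ℕ.≤-reflexive o)
      Out≥2⇒bool G (pinch B C c B≢C p o p′ o′ z) h with s≤s () ← ℕ.≤-trans (h B) (ℕ.≤-reflexive o)
      Out≥2⇒bool G (bool _ _ _) h = refl , refl

      Out-mono : ∀ H F → T (subᵇ H F) → ∀ i → Out (∁ F) i ℕ.≤ Out (∁ H) i
      Out-mono H F s i = subst (Out (∁ F) i ℕ.≤_) (sym (outside-∁ (block i) H F s)) (ℕ.m≤m+n _ _)

      möbius-sum-bool : ∀ G F → T (subᵇ G F) → (∀ i → 2 ℕ.≤ Out (∁ F) i) →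
        intervalSum G F (λ H → [ flatᵇ R H ⇒ möb G H ]) ≡ δ 0 (codim F G)
      möbius-sum-bool G F s out = begin
        intervalSum G F (λ H → [ flatᵇ R H ⇒ möb G H ])   ≡⟨ intervalSum-cong G F simplify ⟩
        intervalSum G F (λ H → c * negpow (codim F H))      ≡⟨ intervalSum-* G F c _ ⟩
        c * intervalSum G F (λ H → negpow (codim F H))      ≡⟨ cong (c *_) (intervalSum-bin₁ G F s negpow) ⟩
        c * bin (codim F G) negpow                          ≡⟨ cong (c *_) (bin-negpow (codim F G)) ⟩
        c * δ 0 (codim F G)                                 ≡⟨ negpow-δ0 (codim F G) ⟩
        δ 0 (codim F G)                                     ∎
        where
        open ≡-Reasoning
        c = negpow (codim F G)
        simplify : ∀ H → T (subᵇ G H) → T (subᵇ H F) → [ flatᵇ R H ⇒ möb G H ] ≡ c * negpow (codim F H)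
        simplify H u t with p , q ← Out≥2⇒bool G (kind (∁ H)) (λ i → ℕ.≤-trans (out i) (Out-mono H F t i)) =
          trans (term G F H u t) (cong (c *_) (trans (cong₂ (λ x y → [ x ⇒ negpow (codim F H) * y ]) p q) (ℤ.*-identityʳ _)))

      -- The weights by the number `j` of removed elements outside the block: `1 - q` at 0, zero at
      -- 1 where no flat occurs, and the sign beyond. Written as corrections of the sign, they can
      -- be summed separately, and the terms in `q` cancel.
      ψ : ℕ → ℕ → ℤ
      ψ q j = negpow j + (- (ℤ.+ q) * δ 0 j + δ 1 j)

      bin-ψ : ∀ q → bin q (ψ q) ≡ δ 0 q
      bin-ψ q = begin
        bin q (ψ q)                                             ≡⟨ trans (bin-+ q negpow _) (cong (bin q negpow +_) (bin-+ q _ (δ 1))) ⟩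
        bin q negpow + (bin q (λ j → - (ℤ.+ q) * δ 0 j) + bin q (δ 1))
          ≡⟨ cong₂ _+_ (bin-negpow q) (cong₂ _+_ (trans (bin-* q (- (ℤ.+ q)) (δ 0)) (cong (- (ℤ.+ q) *_) (bin-δ0 q))) (bin-δ1 q)) ⟩
        δ 0 q + (- (ℤ.+ q) * 1ℤ + ℤ.+ q)                        ≡⟨ lemma (δ 0 q) (ℤ.+ q) ⟩
        δ 0 q                                                   ∎
        where
        open ≡-Reasoning
        lemma : ∀ d q → d + ((- q) * 1ℤ + q) ≡ d
        lemma = solve-∀

      single-term : ∀ G {Y} (κ : Kind Y) B → 2 ℕ.≤ In Y B → ∀ i j → Out Y B ≡ j →
        [ flat? κ ⇒ negpow (i ℕ.+ j) * value G κ ] ≡ negpow i * ψ (Out (∁ G) B) j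
      single-term G {Y} (empty e) B h i j o with () ← ℕ.≤-trans h (ℕ.≤-trans (inside≤ (block B) Y) (ℕ.≤-reflexive e))
      single-term G (single B′ c p o′ z) B h i j o with B Fin.≟ B′
      ... | no ne with () ← subst (2 ℕ.≤_) (z B ne) h
      single-term G (single B′ zero p o′ z) B h i j o | yes refl with s≤s () ← subst (2 ℕ.≤_) p h
      single-term G (single B′ (suc c) p o′ z) B h i .(Out _ B) refl | yes refl rewrite o′ | ℕ.+-identityʳ i =
        cong (negpow i *_) (lemma (ℤ.+ Out (∁ G) B))
        where
        lemma : ∀ q → 1ℤ + - q ≡ 1ℤ + ((- q) * 1ℤ + 0ℤ)
        lemma = solve-∀
      single-term G (pinch B′ C c B≢C p o′ p′ o″ z) B h i j o with B Fin.≟ B′ | B Fin.≟ C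
      ... | no ne | no ne′ with () ← subst (2 ℕ.≤_) (z B ne ne′) h
      single-term G (pinch B′ C c B≢C p o′ p′ o″ z) B h i j o | no ne | yes refl with s≤s () ← subst (2 ℕ.≤_) p′ h
      single-term G (pinch B′ C c B≢C p o′ p′ o″ z) B h i .(Out _ B) refl | yes refl | _ rewrite o′ =
        lemma (negpow i) (ℤ.+ Out (∁ G) B)
        where
        lemma : ∀ s q → 0ℤ ≡ s * (-1ℤ + ((- q) * 0ℤ + 1ℤ))
        lemma = solve-∀
      single-term G (bool _ out _) B h i j o with j | subst (2 ℕ.≤_) o (out B)
      ... | suc (suc j) | _ = trans (cong (_* 1ℤ) (negpow-+ i (2 ℕ.+ j))) (lemma (negpow i) (negpow (2 ℕ.+ j)) (ℤ.+ Out (∁ G) B))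
        where
        lemma : ∀ s t q → s * t * 1ℤ ≡ s * (t + ((- q) * 0ℤ + 0ℤ))
        lemma = solve-∀
      ... | suc zero | s≤s ()

      möbius-sum-single : ∀ G F → T (subᵇ G F) → ∀ B → 2 ℕ.≤ In (∁ F) B → Out (∁ F) B ≡ 0 →
        intervalSum G F (λ H → [ flatᵇ R H ⇒ möb G H ]) ≡ δ 0 (codim F G)
      möbius-sum-single G F s B big out = begin
        intervalSum G F (λ H → [ flatᵇ R H ⇒ möb G H ])
          ≡⟨ intervalSum-cong G F simplify ⟩
        intervalSum G F (λ H → c * (negpow (inside (block B) (F ∖ H)) * ψ q (outside (block B) (F ∖ H))))
          ≡⟨ intervalSum-* G F c _ ⟩
        c * intervalSum G F (λ H → negpow (inside (block B) (F ∖ H)) * ψ q (outside (block B) (F ∖ H)))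
          ≡⟨ cong (c *_) (intervalSum-bin₂ G F (block B) s (λ i j → negpow i * ψ q j)) ⟩
        c * bin p (λ i → bin q′ (λ j → negpow i * ψ q j))
          ≡⟨ cong (λ x → c * bin p (λ i → bin x (λ j → negpow i * ψ q j))) (sym q≡q′) ⟩
        c * bin p (λ i → bin q (λ j → negpow i * ψ q j))
          ≡⟨ cong (c *_) (bin-cong p (λ i → trans (bin-* q (negpow i) (ψ q))
               (trans (cong (negpow i *_) (bin-ψ q)) (ℤ.*-comm (negpow i) _)))) ⟩
        c * bin p (λ i → δ 0 q * negpow i)
          ≡⟨ cong (c *_) (trans (bin-* p (δ 0 q) negpow) (trans (cong (δ 0 q *_) (bin-negpow p)) (ℤ.*-comm (δ 0 q) _))) ⟩
        c * (δ 0 p * δ 0 q)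
          ≡⟨ cong (c *_) (trans (δ0-* p q) (cong (δ 0) (trans (cong (p ℕ.+_) q≡q′) (inside+outside (block B) (F ∖ G))))) ⟩
        c * δ 0 (codim F G)
          ≡⟨ negpow-δ0 (codim F G) ⟩
        δ 0 (codim F G) ∎
        where
        open ≡-Reasoning
        c = negpow (codim F G)
        q = Out (∁ G) B
        p = inside (block B) (F ∖ G)
        q′ = outside (block B) (F ∖ G)
        q≡q′ : q ≡ q′
        q≡q′ = trans (outside-∁ (block B) G F s) (cong (ℕ._+ q′) out)
        simplify : ∀ H → T (subᵇ G H) → T (subᵇ H F) → [ flatᵇ R H ⇒ möb G H ] ≡
          c * (negpow (inside (block B) (F ∖ H)) * ψ q (outside (block B) (F ∖ H)))
        simplify H u t = trans (term G F H u t) (cong (c *_) (trans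
          (cong (λ x → [ flat? (kind (∁ H)) ⇒ negpow x * value G (kind (∁ H)) ]) (sym (inside+outside (block B) (F ∖ H))))
          (single-term G (kind (∁ H)) B
            (ℕ.≤-trans big (subst (In (∁ F) B ℕ.≤_) (sym (inside-∁ (block B) H F t)) (ℕ.m≤m+n _ _)))
            (inside (block B) (F ∖ H)) (outside (block B) (F ∖ H))
            (trans (outside-∁ (block B) H F t) (cong (ℕ._+ outside (block B) (F ∖ H)) out)))))

      -- The weight of a complement below the top is split into a function of its size and one
      -- correction for each block. `α` treats every set of at least three elements as boolean. `φ`
      -- corrects the sets with at most one element outside a block: `φ₀` those contained in it,
      -- `φ₁` those with one element elsewhere.
      α : ℤ → ℕ → ℤ
      α w zero                = w
      α w (suc zero)          = 0ℤ
      α w (suc (suc zero))    = 0ℤ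
      α w (suc (suc (suc y))) = negpow (3 ℕ.+ y)

      φ₀ : ℕ → ℕ → ℤ
      φ₀ q zero                = 0ℤ
      φ₀ q (suc zero)          = 0ℤ
      φ₀ q (suc (suc zero))    = 1ℤ + - (ℤ.+ q)
      φ₀ q (suc (suc (suc i))) = - (negpow (3 ℕ.+ i) * ℤ.+ q)

      φ₁ : ℕ → ℤ
      φ₁ zero                = 0ℤ
      φ₁ (suc zero)          = 0ℤ
      φ₁ (suc (suc i))       = negpow (2 ℕ.+ i)

      φ : ℕ → ℕ → ℕ → ℤ
      φ q i j = φ₀ q i * δ 0 j + φ₁ i * δ 1 j

      bin-α : ∀ w x → bin x (α w) ≡ δ 0 x + ((w + -1ℤ) + (ℤ.+ x + - choose2 x))
      bin-α w x = begin
        bin x (α w)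
          ≡⟨ bin-cong x split ⟩
        bin x (λ y → negpow y + ((w + -1ℤ) * δ 0 y + (δ 1 y + -1ℤ * δ 2 y)))
          ≡⟨ trans (bin-+ x negpow _) (cong (bin x negpow +_) (trans (bin-+ x _ _) (cong (bin x (λ y → (w + -1ℤ) * δ 0 y) +_) (bin-+ x (δ 1) _)))) ⟩
        bin x negpow + (bin x (λ y → (w + -1ℤ) * δ 0 y) + (bin x (δ 1) + bin x (λ y → -1ℤ * δ 2 y)))
          ≡⟨ cong₂ _+_ (bin-negpow x) (cong₂ _+_ (trans (bin-* x (w + -1ℤ) (δ 0)) (cong ((w + -1ℤ) *_) (bin-δ0 x)))
               (cong₂ _+_ (bin-δ1 x) (trans (bin-* x -1ℤ (δ 2)) (cong (-1ℤ *_) (bin-δ2 x))))) ⟩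
        δ 0 x + ((w + -1ℤ) * 1ℤ + (ℤ.+ x + -1ℤ * choose2 x))
          ≡⟨ lemma (δ 0 x) w (ℤ.+ x) (choose2 x) ⟩
        δ 0 x + ((w + -1ℤ) + (ℤ.+ x + - choose2 x)) ∎
        where
        open ≡-Reasoning
        lemma : ∀ d w x c → d + ((w + -1ℤ) * 1ℤ + (x + -1ℤ * c)) ≡ d + ((w + -1ℤ) + (x + - c))
        lemma = solve-∀
        split : ∀ y → α w y ≡ negpow y + ((w + -1ℤ) * δ 0 y + (δ 1 y + -1ℤ * δ 2 y))
        split zero = l w
          where
          l : ∀ w → w ≡ 1ℤ + ((w + -1ℤ) * 1ℤ + (0ℤ + -1ℤ * 0ℤ))
          l = solve-∀
        split (suc zero) = l w
          where
          l : ∀ w → 0ℤ ≡ -1ℤ + ((w + -1ℤ) * 0ℤ + (1ℤ + -1ℤ * 0ℤ))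
          l = solve-∀
        split (suc (suc zero)) = l w
          where
          l : ∀ w → 0ℤ ≡ 1ℤ + ((w + -1ℤ) * 0ℤ + (0ℤ + -1ℤ * 1ℤ))
          l = solve-∀
        split (suc (suc (suc y))) = l w (negpow (3 ℕ.+ y))
          where
          l : ∀ w s → s ≡ s + ((w + -1ℤ) * 0ℤ + (0ℤ + -1ℤ * 0ℤ))
          l = solve-∀

      -- The `q` ways of adding one outside element cancel the multiple of `q` in the weight of the
      -- set itself. Only pairs within the block keep a 1, because `α` vanishes on them; this is
      -- where the sum of `choose2` over the blocks in `topWeight` arises.
      bin-φ : ∀ q i → bin q (φ q i) ≡ δ 2 i
      bin-φ q i = begin
        bin q (φ q i)                     ≡⟨ bin-+ q _ _ ⟩
        bin q (λ j → φ₀ q i * δ 0 j) + bin q (λ j → φ₁ i * δ 1 j)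
          ≡⟨ cong₂ _+_ (trans (bin-* q (φ₀ q i) (δ 0)) (cong (φ₀ q i *_) (bin-δ0 q)))
                       (trans (bin-* q (φ₁ i) (δ 1)) (cong (φ₁ i *_) (bin-δ1 q))) ⟩
        φ₀ q i * 1ℤ + φ₁ i * ℤ.+ q        ≡⟨ cases i ⟩
        δ 2 i                             ∎
        where
        open ≡-Reasoning
        cases : ∀ i → φ₀ q i * 1ℤ + φ₁ i * ℤ.+ q ≡ δ 2 i
        cases zero = refl
        cases (suc zero) = refl
        cases (suc (suc zero)) = l (ℤ.+ q)
          where
          l : ∀ q → (1ℤ + - q) * 1ℤ + 1ℤ * q ≡ 1ℤ
          l = solve-∀
        cases (suc (suc (suc i))) = l (negpow (3 ℕ.+ i)) (ℤ.+ q)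
          where
          l : ∀ s q → - (s * q) * 1ℤ + s * q ≡ 0ℤ
          l = solve-∀

      φ-far : ∀ q i j → 2 ℕ.≤ j → φ q i j ≡ 0ℤ
      φ-far q i (suc (suc j)) _ = cong₂ _+_ (ℤ.*-zeroʳ (φ₀ q i)) (ℤ.*-zeroʳ (φ₁ i))
      φ-far q i (suc zero) (s≤s ())

      φ-0 : ∀ q {i} j → i ≡ 0 → φ q i j ≡ 0ℤ
      φ-0 q j refl = refl

      top-term : ∀ G {Y} (κ : Kind Y) → [ flat? κ ⇒ negpow ∣ Y ∣ * value G κ ] ≡
        α (topWeight G) ∣ Y ∣ + Σᶠ (λ i → φ (Out (∁ G) i) (In Y i) (Out Y i))
      top-term G {Y} (empty e) = trans (trans (cong (λ y → negpow y * topWeight G) e) (ℤ.*-identityˡ _))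
        (sym (trans (cong₂ _+_ (cong (α (topWeight G)) e) (ℤΣ.sum-none f (λ i → φ-0 _ (Out Y i) (In≡0 rank≥2 {Y} e i))))
                    (ℤ.+-identityʳ _)))
        where
        f = λ i → φ (Out (∁ G) i) (In Y i) (Out Y i)
      top-term G {Y} (single B c p o z) = trans (trans (cong (λ y → [ 0 <ᵇ c ⇒ negpow y * (1ℤ + - Q) ]) size) (cases c))
        (sym (cong₂ _+_ (cong (α (topWeight G)) size)
          (trans (ℤΣ.sum-one f B (λ i ne → φ-0 _ (Out Y i) (z i ne))) (cong₂ (φ (Out (∁ G) B)) p o))))
        where
        f = λ i → φ (Out (∁ G) i) (In Y i) (Out Y i)
        size : ∣ Y ∣ ≡ suc c
        size = trans (sym (In+Out Y B)) (trans (cong₂ ℕ._+_ p o) (ℕ.+-identityʳ _))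
        Q = ℤ.+ Out (∁ G) B
        cases : ∀ c → [ 0 <ᵇ c ⇒ negpow (suc c) * (1ℤ + - Q) ] ≡ α (topWeight G) (suc c) + φ (Out (∁ G) B) (suc c) 0
        cases zero = refl
        cases (suc zero) = l Q
          where
          l : ∀ q → 1ℤ * (1ℤ + - q) ≡ 0ℤ + ((1ℤ + - q) * 1ℤ + 1ℤ * 0ℤ)
          l = solve-∀
        cases (suc (suc c)) = l (negpow (3 ℕ.+ c)) Q
          where
          l : ∀ s q → s * (1ℤ + - q) ≡ s + (- (s * q) * 1ℤ + s * 0ℤ)
          l = solve-∀
      top-term G {Y} (pinch B C c B≢C p o p′ o′ z) =
        trans (cases c)
        (sym (cong₂ _+_ (cong (α (topWeight G)) size)
          (trans (ℤΣ.sum-two f B C B≢C (λ i ne ne′ → φ-0 _ (Out Y i) (z i ne ne′)))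
                 (cong₂ _+_ (cong₂ (φ (Out (∁ G) B)) p o) (cong₂ (φ (Out (∁ G) C)) p′ o′)))))
        where
        f = λ i → φ (Out (∁ G) i) (In Y i) (Out Y i)
        size : ∣ Y ∣ ≡ suc (suc c)
        size = trans (sym (In+Out Y C)) (cong₂ ℕ._+_ p′ o′)
        -- For positive `c` the correction of `B`, which holds all elements but one, cancels `α`;
        -- the block `C` contributes nothing.
        cases : ∀ c → 0ℤ ≡ α (topWeight G) (2 ℕ.+ c) + (φ (Out (∁ G) B) (suc c) 1 + φ (Out (∁ G) C) 1 (suc c))
        cases zero = refl
        cases (suc zero) = l (ℤ.+ Out (∁ G) B)
          where
          l : ∀ q → 0ℤ ≡ -1ℤ + (((1ℤ + - q) * 0ℤ + 1ℤ) + 0ℤ)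
          l = solve-∀
        cases (suc (suc c)) = l (φ₀ (Out (∁ G) B) (3 ℕ.+ c)) (negpow (3 ℕ.+ c))
          where
          l : ∀ x s → 0ℤ ≡ - s + ((x * 0ℤ + s * 1ℤ) + 0ℤ)
          l = solve-∀
      top-term G {Y} (bool _ out three) =
        trans (ℤ.*-identityʳ _) (trans (lemma ∣ Y ∣ three) (trans (sym (ℤ.+-identityʳ _))
          (cong (α (topWeight G) ∣ Y ∣ +_) (sym (ℤΣ.sum-none f (λ i → φ-far _ (In Y i) _ (out i)))))))
        where
        f = λ i → φ (Out (∁ G) i) (In Y i) (Out Y i)
        lemma : ∀ y → 3 ℕ.≤ y → negpow y ≡ α (topWeight G) y
        lemma (suc (suc (suc y))) _ = refl
        lemma (suc (suc zero)) (s≤s (s≤s ()))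
        lemma (suc zero) (s≤s ())

      Out≡0 : ∀ {Y} → ∣ Y ∣ ≡ 0 → ∀ i → Out Y i ≡ 0
      Out≡0 {Y} e i = ℕ.m+n≡0⇒n≡0 (In Y i) (trans (In+Out Y i) e)

      size-∁ : ∀ (H F : Subset n) → T (subᵇ H F) → ∣ ∁ H ∣ ≡ ∣ ∁ F ∣ ℕ.+ codim F H
      size-∁ H F t = subst₂ (λ x y → ∣ x ∣ ≡ ∣ y ∣ ℕ.+ codim F H) (⊤∖ H) (⊤∖ F) (size-diff H F ⊤ t (subᵇ-⊤ F))

      möbius-sum-top : ∀ G F → T (subᵇ G F) → ∣ ∁ F ∣ ≡ 0 →
        intervalSum G F (λ H → [ flatᵇ R H ⇒ möb G H ]) ≡ δ 0 (codim F G)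
      möbius-sum-top G F s full = begin
        intervalSum G F (λ H → [ flatᵇ R H ⇒ möb G H ])
          ≡⟨ intervalSum-cong G F simplify ⟩
        intervalSum G F (λ H → c * (α w (codim F H) + Σᶠ (f H)))
          ≡⟨ intervalSum-* G F c _ ⟩
        c * intervalSum G F (λ H → α w (codim F H) + Σᶠ (f H))
          ≡⟨ cong (c *_) (trans (intervalSum-+ G F _ _) (cong₂ _+_ (intervalSum-bin₁ G F s (α w))
               (trans (intervalSum-Σᶠ G F (λ i H → f H i)) (Σᶠ-cong blockSum)))) ⟩
        c * (bin x (α w) + Σᶠ (λ i → choose2 (In (∁ G) i)))
          ≡⟨ cong (λ z → c * (z + S)) (bin-α w x) ⟩
        c * (δ 0 x + ((w + -1ℤ) + (ℤ.+ x + - choose2 x)) + S)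
          -- The complement of `F` is empty, so the size of the complement of `G` is the codimension
          -- `x`. Then `topWeight` is exactly the value that cancels everything but `δ 0 x`.
          ≡⟨ cong (λ y → c * (δ 0 x + (((1ℤ + - (ℤ.+ y) + choose2 y + - S) + -1ℤ) + (ℤ.+ x + - choose2 x)) + S)) (∁-codim G s) ⟩
        c * (δ 0 x + (((1ℤ + - (ℤ.+ x) + choose2 x + - S) + -1ℤ) + (ℤ.+ x + - choose2 x)) + S)
          ≡⟨ cong (c *_) (lemma (δ 0 x) (ℤ.+ x) (choose2 x) S) ⟩
        c * δ 0 x
          ≡⟨ negpow-δ0 x ⟩
        δ 0 x ∎
        where
        open ≡-Reasoning
        x = codim F G
        c = negpow x
        w = topWeight G
        S = Σᶠ (λ i → choose2 (In (∁ G) i))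
        lemma : ∀ d x c S → d + (((1ℤ + - x + c + - S) + -1ℤ) + (x + - c)) + S ≡ d
        lemma = solve-∀
        ∁-codim : ∀ H → T (subᵇ H F) → ∣ ∁ H ∣ ≡ codim F H
        ∁-codim H t = trans (size-∁ H F t) (cong (ℕ._+ codim F H) full)
        f : Subset n → Fin k → ℤ
        f H i = φ (Out (∁ G) i) (inside (block i) (F ∖ H)) (outside (block i) (F ∖ H))
        inTop : ∀ H → T (subᵇ H F) → ∀ i → In (∁ H) i ≡ inside (block i) (F ∖ H)
        inTop H t i = trans (inside-∁ (block i) H F t) (cong (ℕ._+ inside (block i) (F ∖ H)) (In≡0 rank≥2 {∁ F} full i))
        outTop : ∀ H → T (subᵇ H F) → ∀ i → Out (∁ H) i ≡ outside (block i) (F ∖ H)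
        outTop H t i = trans (outside-∁ (block i) H F t) (cong (ℕ._+ outside (block i) (F ∖ H)) (Out≡0 {∁ F} full i))
        blockSum : ∀ i → intervalSum G F (λ H → f H i) ≡ choose2 (In (∁ G) i)
        blockSum i = trans (intervalSum-bin₂ G F (block i) s (φ (Out (∁ G) i)))
          (trans (cong₂ (λ p q → bin p (λ a → bin q (φ (Out (∁ G) i) a))) (sym (inTop G s i)) (sym (outTop G s i)))
          (trans (bin-cong (In (∁ G) i) (bin-φ (Out (∁ G) i))) (bin-δ2 (In (∁ G) i))))
        simplify : ∀ H → T (subᵇ G H) → T (subᵇ H F) → [ flatᵇ R H ⇒ möb G H ] ≡ c * (α w (codim F H) + Σᶠ (f H))
        simplify H u t = trans (term G F H u t) (cong (c *_)
          (trans (cong (λ y → [ flat? (kind (∁ H)) ⇒ negpow y * value G (kind (∁ H)) ]) (sym (∁-codim H t)))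
          (trans (top-term G (kind (∁ H)))
          (cong₂ _+_ (cong (α w) (∁-codim H t)) (Σᶠ-cong (λ i → cong₂ (φ (Out (∁ G) i)) (inTop H t i) (outTop H t i)))))))

      data FlatKind (F : Subset n) : Set where
        top    : ∣ ∁ F ∣ ≡ 0 → FlatKind F
        oneBlock : ∀ B → 2 ℕ.≤ In (∁ F) B → Out (∁ F) B ≡ 0 → (∀ i → i ≢ B → In (∁ F) i ≡ 0) → FlatKind F
        boolean : 2 ℕ.≤ support (In (∁ F)) → (∀ i → 2 ℕ.≤ Out (∁ F) i) → FlatKind F

      flatKind : ∀ F → Flat R F → FlatKind F
      flatKind F fl with kind (∁ F) | flat?-correct F (kind (∁ F))
      ... | empty e | _ = top e
      ... | single B (suc c) p o z | _ = oneBlock B (subst (2 ℕ.≤_) (sym p) (s≤s (s≤s z≤n))) o z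
      ... | single B zero p o z | eq = ⊥-elim (subst T eq fl)
      ... | pinch B C c B≢C p o p′ o′ z | eq = ⊥-elim (subst T eq fl)
      ... | bool s o _ | _ = boolean s o

      möb-isMobius : IsMobius R möb
      möb-isMobius G F _ fF s = trans (sumℤ-interval R G F (möb G)) (trans (go (flatKind F fF)) (sym (eqᵇ-δ0 G F s)))
        where
        go : FlatKind F → _
        go (top e)              = möbius-sum-top G F s e
        go (oneBlock B big o _) = möbius-sum-single G F s B big o
        go (boolean _ o)        = möbius-sum-bool G F s o

      codim-pos : ∀ (G H F : Subset n) → T (subᵇ G H) → T (subᵇ H F) → 0 ℕ.< codim F H → codim H G ℕ.< codim F G
      codim-pos G H F s t pos = subst (codim H G ℕ.<_) (sym (size-diff G H F s t)) (ℕ.+-monoˡ-≤ (codim H G) pos)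

      -- The defining identity expresses the value at `F` through the values at flats strictly below
      -- it, which have smaller codimension over `G`.
      mobius-unique : ∀ {m} → IsMobius R m → ∀ G F → Flat R G → Flat R F → T (subᵇ G F) → m G F ≡ möb G F
      mobius-unique {m} isM G F fG fF s = go (suc (codim F G)) F ℕ.≤-refl fF s
        where
        go : ∀ N F → codim F G ℕ.< N → Flat R F → T (subᵇ G F) → m G F ≡ möb G F
        go (suc N) F (s≤s lt) fF s = sym (subst₂ _≡_ (drop (möb G F)) (drop (m G F))
            (+ℤ-cancelˡ (intervalSum G F (λ H → [ flatᵇ R H ⇒ m G H ])) _ _
              (trans (intervalSum-top G F s below) (cong (_+ [ flatᵇ R F ⇒ m G F ]) (sym same)))))
          where
          drop : ∀ x → [ flatᵇ R F ⇒ x ] ≡ x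
          drop x = []-true x fF
          same : intervalSum G F (λ H → [ flatᵇ R H ⇒ m G H ]) ≡ intervalSum G F (λ H → [ flatᵇ R H ⇒ möb G H ])
          same = trans (trans (sym (sumℤ-interval R G F (m G))) (trans (isM G F fG fF s)
            (sym (möb-isMobius G F fG fF s)))) (sumℤ-interval R G F (möb G))
          below : ∀ H → T (subᵇ G H) → T (subᵇ H F) → 0 ℕ.< codim F H →
            [ flatᵇ R H ⇒ m G H ] ≡ [ flatᵇ R H ⇒ möb G H ]
          below H u t pos with flatᵇ R H in eq
          ... | false = refl
          ... | true  = go N H (ℕ.<-≤-trans (codim-pos G H F u t pos) lt) (subst T (sym eq) _) u

  -- Kazhdan-Lusztig sums and uniqueness of Q

  shift : ℕ → Poly → Poly
  shift d p k = if d ≤ᵇ k then p (k ∸ d) else 0ℤ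

  shift-onePoly : ∀ d k → shift d onePoly k ≡ δ d k
  shift-onePoly zero          zero    = refl
  shift-onePoly zero          (suc k) = refl
  shift-onePoly (suc d)       zero    = refl
  shift-onePoly (suc zero)    (suc k) = shift-onePoly zero k
  shift-onePoly (suc (suc d)) (suc k) = shift-onePoly (suc d) k

  bin-choose : ∀ p k → bin p (λ d → δ d k) ≡ ℤ.+ (p choose k)
  bin-choose zero    zero    = refl
  bin-choose zero    (suc k) = cong ℤ.+_ (sym (k>n⇒nCk≡0 {0} {suc k} ℕ.z<s))
  bin-choose (suc p) zero    = cong₂ _+_ (bin-choose p 0) (bin-zero p)
  bin-choose (suc p) (suc k) = trans (cong₂ _+_ (bin-choose p (suc k)) (bin-choose p k))
    (cong ℤ.+_ (trans (ℕ.+-comm (p choose suc k) (p choose k)) (nCk+nC[k+1]≡[n+1]C[k+1] p k)))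

  codim-refl : ∀ {n} (F : Subset n) → codim F F ≡ 0
  codim-refl []          = refl
  codim-refl (true ∷ F)  = codim-refl F
  codim-refl (false ∷ F) = codim-refl F

  Σᶠ-* : ∀ {k} c (f : Fin k → ℤ) → Σᶠ (λ i → f i * c) ≡ Σᶠ f * c
  Σᶠ-* {zero}  c f = refl
  Σᶠ-* {suc k} c f = trans (cong (f zero * c +_) (Σᶠ-* c (f ∘ suc))) (sym (ℤ.*-distribʳ-+ c (f zero) _))

  -- Contribution to the Kazhdan–Lusztig sum of a flat below F, where the complement of F lies in a single
  -- block with inverse Kazhdan–Lusztig polynomial P, in terms of the numbers of elements removed from F
  -- inside and outside that block.
  blockCoeff : Poly → ℕ → ℕ → ℕ → ℤ
  blockCoeff P k i zero          = shift i P k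
  blockCoeff P k i (suc zero)    = 0ℤ
  blockCoeff P k i (suc (suc j)) = ℤ.+ suc j * δ (i ℕ.+ suc j) k

  -- The part of the sum at the top that sees only the number of removed elements. Every set of at
  -- least two is treated as a boolean complement, where the rank drops by two less than the size;
  -- pairs within a block are not yet subtracted from its weight.
  topCoeff : Poly → ℕ → ℕ → ℤ
  topCoeff P k zero          = P k
  topCoeff P k (suc zero)    = 0ℤ
  topCoeff P k (suc (suc y)) = (1ℤ + - (ℤ.+ (2 ℕ.+ y)) + choose2 (2 ℕ.+ y)) * δ y k

  -- Subtracts the pairs within the block. When nothing is removed outside it, the boolean
  -- contribution is also replaced by that of the block polynomial, with the rank drop one larger.
  topBlockCoeff : Poly → ℕ → ℕ → ℕ → ℤ
  topBlockCoeff P k zero          c = 0ℤ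
  topBlockCoeff P k (suc zero)    c = 0ℤ
  topBlockCoeff P k (suc (suc a)) c =
    - choose2 (2 ℕ.+ a) * δ (a ℕ.+ c) k + δ 0 c * (ℤ.+ suc a * (δ a k + shift (suc a) P k))

  module KazhdanLusztig {n k : ℕ} (b : Fin n → Fin k) where
    open Möbius b public

    module _ (rank≥2 : 2 ℕ.≤ support (In ⊤)) where

      private
        R = r rank≥2
        flat? : ∀ {Y} → Kind Y → Bool
        flat? = kindFlat rank≥2
        flat?-correct = kindFlat-correct rank≥2
        μ₀ = möb rank≥2

      klTerm : (Subset n → Subset n → ℤ) → (Subset n → Poly) → Subset n → ℕ → Subset n → ℤ
      klTerm m q F k G = let d = R F ∸ R G in
        if d ≤ᵇ k then negpow d * m G F * q G (k ∸ d) else 0ℤ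

      klSum : (Subset n → Subset n → ℤ) → (Subset n → Poly) → Subset n → ℕ → ℤ
      klSum m q F k = intervalSum ⊥ F (λ G → [ flatᵇ R G ⇒ klTerm m q F k G ])

      klSumCoeff≡klSum : ∀ m q F k → klSumCoeff R m q F k ≡ klSum m q F k
      klSumCoeff≡klSum m q F k = sumℤ-interval R ⊥ F (klTerm m q F k)

      klTerm-shift : ∀ m q F k G d c → R F ∸ R G ≡ d → negpow d * m G F ≡ c → klTerm m q F k G ≡ c * shift d (q G) k
      klTerm-shift m q F k G d c refl refl with R F ∸ R G ≤ᵇ k
      ... | true  = refl
      ... | false = sym (ℤ.*-zeroʳ (negpow (R F ∸ R G) * m G F))

      klTerm-cong : ∀ {m m′ : Subset n → Subset n → ℤ} {q q′ : Subset n → Poly} F k G →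
        m G F ≡ m′ G F → (∀ j → q G j ≡ q′ G j) → klTerm m q F k G ≡ klTerm m′ q′ F k G
      klTerm-cong {m} {m′} {q} {q′} F k G e h = trans (klTerm-shift m q F k G _ _ refl refl)
        (trans (cong₂ (λ x y → negpow (R F ∸ R G) * x * y) e (go (R F ∸ R G ≤ᵇ k)))
          (sym (klTerm-shift m′ q′ F k G _ _ refl refl)))
        where
        go : ∀ c → (if c then q G (k ∸ (R F ∸ R G)) else 0ℤ) ≡ (if c then q′ G (k ∸ (R F ∸ R G)) else 0ℤ)
        go true  = h _
        go false = refl

      -- Read off from the Möbius identity on the interval from `F` to itself, which spares a case
      -- distinction on the kind of complement.
      möb-refl : ∀ F → Flat R F → μ₀ F F ≡ 1ℤ
      möb-refl F fl = sym (trans (trans (trans (cong (δ 0) (sym (codim-refl F)))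
        (trans (sym (eqᵇ-δ0 F F (subᵇ-refl F))) (sym (trans (sym (sumℤ-interval R F F (μ₀ F))) (möb-isMobius rank≥2 F F fl fl (subᵇ-refl F))))))
        only) ([]-true (μ₀ F F) fl))
        where
        f = λ H → [ flatᵇ R H ⇒ μ₀ F H ]
        only : intervalSum F F f ≡ f F
        only = trans (sym (ℤ.+-identityʳ _)) (trans (intervalSum-top F F (subᵇ-refl F) {f} {λ _ → 0ℤ}
          (λ H s t pos → ⊥-elim (ℕ.<⇒≱ pos (ℕ.≤-trans (ℕ.m≤m+n _ (codim H F))
             (ℕ.≤-reflexive (trans (sym (size-diff F H F s t)) (codim-refl F)))))))
          (trans (cong (_+ f F) (intervalSum-zero F F)) (ℤ.+-identityˡ _)))

      module Candidate (blockPoly : Fin k → Poly) (topPoly : Poly) where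

        kindPoly : ∀ {Y} → Kind Y → Poly
        kindPoly (empty _)                   = topPoly
        kindPoly (single B _ _ _ _)          = blockPoly B
        kindPoly (pinch _ _ _ _ _ _ _ _ _)   = λ _ → 0ℤ
        kindPoly (bool _ _ _)                = onePoly

        cand : Subset n → Poly
        cand F = kindPoly (kind (∁ F))

        -- Given agreement below `F`, the two sums differ by the difference of the two polynomials
        -- at `F`. From half the rank upwards both polynomials vanish, so the sums agree there;
        -- palindromicity carries this to the lower half, where it forces the polynomials to agree
        -- too.
        step : ∀ {m q} → IsMobius R m → IsInverseKL R m q → ∀ F → Flat R F → 0 ℕ.< R F →
          (∀ k → R F ℕ.≤ 2 ℕ.* k → cand F k ≡ 0ℤ) →
          (∀ k → k ℕ.≤ R F → klSum μ₀ cand F k ≡ klSum μ₀ cand F (R F ∸ k)) →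
          (∀ H → Flat R H → T (subᵇ H F) → 0 ℕ.< codim F H → ∀ k → q H k ≡ cand H k) →
          ∀ k → q F k ≡ cand F k
        step {m} {q} isM (_ , deg , sym-q , _) F fl pos deg′ sym-c ih k = go (ℕ.≤-total (R F) (2 ℕ.* k))
          where
          -- The term at `F` itself has exponent 0 and Möbius value 1, hence is the unknown
          -- coefficient.
          top-m : ∀ j → [ flatᵇ R F ⇒ klTerm m q F j F ] ≡ q F j
          top-m j = trans ([]-true _ fl) (trans (klTerm-shift m q F j F 0 1ℤ (ℕ.n∸n≡0 (R F))
            (trans (ℤ.*-identityˡ _) (trans (mobius-unique rank≥2 isM F F fl fl (subᵇ-refl F)) (möb-refl F fl)))) (ℤ.*-identityˡ _))
          top-c : ∀ j → [ flatᵇ R F ⇒ klTerm μ₀ cand F j F ] ≡ cand F j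
          top-c j = trans ([]-true _ fl) (trans (klTerm-shift μ₀ cand F j F 0 1ℤ (ℕ.n∸n≡0 (R F))
            (trans (ℤ.*-identityˡ _) (möb-refl F fl))) (ℤ.*-identityˡ _))
          compare : ∀ j → klSum m q F j + cand F j ≡ klSum μ₀ cand F j + q F j
          compare j = subst₂ (λ x y → klSum m q F j + x ≡ klSum μ₀ cand F j + y) (top-c j) (top-m j)
            (intervalSum-top ⊥ F (subᵇ-⊥ F) below)
            where
            below : ∀ H → T (subᵇ ⊥ H) → T (subᵇ H F) → 0 ℕ.< codim F H →
              [ flatᵇ R H ⇒ klTerm m q F j H ] ≡ [ flatᵇ R H ⇒ klTerm μ₀ cand F j H ]
            below H _ t lt with flatᵇ R H in eq
            ... | false = refl
            ... | true  = klTerm-cong {m} {μ₀} {q} {cand} F j H (mobius-unique rank≥2 isM H F (subst T (sym eq) _) fl t)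
                            (ih H (subst T (sym eq) _) t lt)
          sym-q′ : ∀ j → j ℕ.≤ R F → klSum m q F j ≡ klSum m q F (R F ∸ j)
          sym-q′ j le = trans (sym (klSumCoeff≡klSum m q F j)) (trans (sym-q F fl j le) (klSumCoeff≡klSum m q F (R F ∸ j)))
          go : _ → q F k ≡ cand F k
          go (inj₁ le) = trans (deg F fl pos k le) (sym (deg′ k le))
          go (inj₂ ge) = sym (+ℤ-cancelˡ (klSum m q F k) _ _ (trans (compare k) (cong (_+ q F k) (sym equal))))
            where
            k≤ : k ℕ.≤ R F
            k≤ = ℕ.≤-trans (ℕ.m≤m+n k _) ge
            k′ = R F ∸ k
            le : R F ℕ.≤ 2 ℕ.* k′
            le = ℕ.+-cancelʳ-≤ (2 ℕ.* k) (R F) (2 ℕ.* k′) (begin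
              R F ℕ.+ 2 ℕ.* k           ≤⟨ ℕ.+-monoʳ-≤ (R F) ge ⟩
              R F ℕ.+ R F               ≡⟨ cong (R F ℕ.+_) (sym (ℕ.+-identityʳ (R F))) ⟩
              2 ℕ.* R F                 ≡⟨ cong (2 ℕ.*_) (sym (ℕ.m∸n+n≡m k≤)) ⟩
              2 ℕ.* (k′ ℕ.+ k)          ≡⟨ ℕ.*-distribˡ-+ 2 k′ k ⟩
              2 ℕ.* k′ ℕ.+ 2 ℕ.* k      ∎)
              where open ℕ.≤-Reasoning
            mirror : klSum m q F k′ ≡ klSum μ₀ cand F k′
            mirror = trans (sym (ℤ.+-identityʳ _)) (trans (subst₂ (λ x y → klSum m q F k′ + x ≡ klSum μ₀ cand F k′ + y)
              (deg′ k′ le) (deg F fl pos k′ le) (compare k′)) (ℤ.+-identityʳ _))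
            equal : klSum m q F k ≡ klSum μ₀ cand F k
            equal = trans (sym-q′ k k≤) (trans mirror (sym (sym-c k k≤)))

        Out≥2⇒onePoly : ∀ {Y} (κ : Kind Y) → (∀ i → 2 ℕ.≤ Out Y i) → ∀ j → kindPoly κ j ≡ onePoly j
        Out≥2⇒onePoly {Y} (empty e) h j with () ← subst (2 ℕ.≤_) (Out≡0 rank≥2 {Y} e (somePoint rank≥2)) (h (somePoint rank≥2))
        Out≥2⇒onePoly (single B c p o z) h j with () ← subst (2 ℕ.≤_) o (h B)
        Out≥2⇒onePoly (pinch B C c B≢C p o p′ o′ z) h j with s≤s () ← subst (2 ℕ.≤_) o (h B)
        Out≥2⇒onePoly (bool _ _ _) h j = refl

        Out≥2⇒support : ∀ {Y} → (∀ i → 2 ℕ.≤ Out Y i) → 2 ℕ.≤ support (In Y)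
        Out≥2⇒support {Y} h = support≥2 rank≥2 {Y} (λ i → ℕ.≤-trans (s≤s z≤n) (h i)) (somePoint rank≥2)

        shift-cong : ∀ d {p q : Poly} j → (∀ i → p i ≡ q i) → shift d p j ≡ shift d q j
        shift-cong d j h with d ≤ᵇ j
        ... | true  = h _
        ... | false = refl

        negpow²′ : ∀ d x → negpow d * (negpow d * x) ≡ x
        negpow²′ d x = trans (sym (ℤ.*-assoc (negpow d) (negpow d) x)) (trans (cong (_* x) (negpow² d)) (ℤ.*-identityˡ x))

        -- All subsets of `F` are flats with polynomial 1, and signs and Möbius values cancel. So
        -- the sum is the power of `1 + x` whose exponent is the size of `F`, visibly palindromic.
        klSum-bool : ∀ F → (∀ i → 2 ℕ.≤ Out (∁ F) i) → ∀ j → klSum μ₀ cand F j ≡ ℤ.+ (∣ F ∣ choose j)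
        klSum-bool F out j = trans (intervalSum-cong ⊥ F simplify)
          (trans (intervalSum-bin₁ ⊥ F (subᵇ-⊥ F) (λ d → δ d j))
          (trans (cong (λ x → bin ∣ x ∣ (λ d → δ d j)) (∖⊥ F)) (bin-choose ∣ F ∣ j)))
          where
          simplify : ∀ H → T (subᵇ ⊥ H) → T (subᵇ H F) → [ flatᵇ R H ⇒ klTerm μ₀ cand F j H ] ≡ δ (codim F H) j
          simplify H _ t = begin
            [ flatᵇ R H ⇒ klTerm μ₀ cand F j H ]
              ≡⟨ cong [_⇒ klTerm μ₀ cand F j H ] (trans (flat?-correct H (kind (∁ H))) (proj₁ (Out≥2⇒bool rank≥2 H (kind (∁ H)) outH))) ⟩
            klTerm μ₀ cand F j H
              ≡⟨ klTerm-shift μ₀ cand F j H (codim F H) 1ℤ rank (trans (negpow²′ (codim F H) _) (proj₂ (Out≥2⇒bool rank≥2 H (kind (∁ F)) out))) ⟩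
            1ℤ * shift (codim F H) (cand H) j
              ≡⟨ trans (ℤ.*-identityˡ _) (shift-cong (codim F H) j (Out≥2⇒onePoly (kind (∁ H)) outH)) ⟩
            shift (codim F H) onePoly j
              ≡⟨ shift-onePoly (codim F H) j ⟩
            δ (codim F H) j ∎
            where
            open ≡-Reasoning
            outH : ∀ i → 2 ℕ.≤ Out (∁ H) i
            outH i = ℕ.≤-trans (out i) (Out-mono rank≥2 H F t i)
            rank : R F ∸ R H ≡ codim F H
            rank = trans (cong₂ _∸_ (trans (rank-2 rank≥2 F (Out≥2⇒support {∁ F} out)) (size-∖ H F t)) (rank-2 rank≥2 H (Out≥2⇒support {∁ H} outH)))
              (ℕ.m+n∸n≡m (codim F H) ∣ H ∣)

        single-value : ∀ G {Y} (κ : Kind Y) B → 2 ℕ.≤ In Y B → Out Y B ≡ 0 → value rank≥2 G κ ≡ 1ℤ + - (ℤ.+ Out (∁ G) B)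
        single-value G {Y} (empty e) B h o with () ← ℕ.≤-trans h (ℕ.≤-reflexive (In≡0 rank≥2 {Y} e B))
        single-value G (single B′ c p o′ z) B h o with B Fin.≟ B′
        ... | yes refl = refl
        ... | no ne with () ← subst (2 ℕ.≤_) (z B ne) h
        single-value G (pinch B′ C c B≢C p o′ p′ o″ z) B h o with B Fin.≟ B′ | B Fin.≟ C
        ... | yes refl | _ with () ← trans (sym o′) o
        single-value G (pinch B′ C c B≢C p o′ p′ o″ z) B h o | no _ | yes refl with () ← trans (sym o″) o
        single-value G (pinch B′ C c B≢C p o′ p′ o″ z) B h o | no ne | no ne′ with () ← subst (2 ℕ.≤_) (z B ne ne′) h
        single-value G (bool _ out _) B h o with () ← subst (2 ℕ.≤_) o (out B)

        klSum-single : ∀ F B → 2 ℕ.≤ In (∁ F) B → Out (∁ F) B ≡ 0 → (∀ i → i ≢ B → In (∁ F) i ≡ 0) → ∀ j →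
          klSum μ₀ cand F j ≡ bin (inside (block B) F) (λ a → bin (outside (block B) F) (blockCoeff (blockPoly B) j a))
        klSum-single F B big out others j = trans (intervalSum-cong ⊥ F (λ H _ t → simplify H t (kind (∁ H)) (λ _ → refl)))
          (trans (intervalSum-bin₂ ⊥ F (block B) (subᵇ-⊥ F) (blockCoeff (blockPoly B) j))
            (cong (λ x → bin (inside (block B) x) (λ a → bin (outside (block B) x) (blockCoeff (blockPoly B) j a))) (∖⊥ F)))
          where
          supp : support (In (∁ F)) ≡ 1
          supp = go (In (∁ F) B) refl big
            where
            go : ∀ x → In (∁ F) B ≡ x → 2 ℕ.≤ x → support (In (∁ F)) ≡ 1
            go (suc c) eq _ = support-single rank≥2 {∁ F} B eq others
          simplify : ∀ H → T (subᵇ H F) → (κ : Kind (∁ H)) → (∀ i → cand H i ≡ kindPoly κ i) →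
            [ flatᵇ R H ⇒ klTerm μ₀ cand F j H ] ≡
            blockCoeff (blockPoly B) j (inside (block B) (F ∖ H)) (outside (block B) (F ∖ H))
          simplify H t κ poly = trans (cong [_⇒ klTerm μ₀ cand F j H ] (flat?-correct H κ)) (go κ poly)
            where
            i o g : ℕ
            i = inside (block B) (F ∖ H)
            o = outside (block B) (F ∖ H)
            g = ∣ H ∣
            In-H : In (∁ H) B ≡ In (∁ F) B ℕ.+ i
            In-H = inside-∁ (block B) H F t
            Out-H : Out (∁ H) B ≡ o
            Out-H = trans (outside-∁ (block B) H F t) (cong (ℕ._+ o) out)
            bigH : 2 ℕ.≤ In (∁ H) B
            bigH = subst (2 ℕ.≤_) (sym In-H) (ℕ.≤-trans big (ℕ.m≤m+n _ i))
            rankF : R F ≡ i ℕ.+ o ℕ.+ g ∸ 1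
            rankF = trans (rank-1 rank≥2 F supp) (cong (_∸ 1) (trans (size-∖ H F t)
              (cong (ℕ._+ g) (sym (inside+outside (block B) (F ∖ H))))))
            μ-H : ∀ {o′} → o ≡ o′ → μ₀ H F ≡ negpow (i ℕ.+ o′) * (1ℤ + - (ℤ.+ o′))
            μ-H refl = cong₂ _*_ (cong negpow (sym (inside+outside (block B) (F ∖ H))))
              (trans (single-value H (kind (∁ F)) B big out) (cong (λ x → 1ℤ + - (ℤ.+ x)) Out-H))
            go : (κ : Kind (∁ H)) → (∀ i → cand H i ≡ kindPoly κ i) →
              [ flat? κ ⇒ klTerm μ₀ cand F j H ] ≡ blockCoeff (blockPoly B) j i o
            go (empty e) poly with () ← ℕ.≤-trans bigH (ℕ.≤-reflexive (In≡0 rank≥2 {∁ H} e B))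
            go (single B′ c p o′ z) poly with B Fin.≟ B′
            ... | no ne with () ← subst (2 ℕ.≤_) (z B ne) bigH
            go (single B′ zero p o′ z) poly | yes refl with s≤s () ← subst (2 ℕ.≤_) p bigH
            go (single B′ (suc c) p o′ z) poly | yes refl = subst (λ x → klTerm μ₀ cand F j H ≡ blockCoeff (blockPoly B) j i x) (sym o≡0)
              (trans (klTerm-shift μ₀ cand F j H i 1ℤ rank coeff) (trans (ℤ.*-identityˡ _) (shift-cong i j poly)))
              where
              o≡0 : o ≡ 0
              o≡0 = trans (sym Out-H) o′
              suppH : support (In (∁ H)) ≡ 1
              suppH = support-single rank≥2 {∁ H} B p z
              coeff : negpow i * μ₀ H F ≡ 1ℤ
              coeff = trans (cong (negpow i *_) (trans (μ-H o≡0) (cong (λ x → negpow x * 1ℤ) (ℕ.+-identityʳ i)))) (negpow²′ i 1ℤ)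
              rank : R F ∸ R H ≡ i
              rank = trans (cong₂ _∸_ (trans rankF (cong (λ x → i ℕ.+ x ℕ.+ g ∸ 1) o≡0)) (rank-1 rank≥2 H suppH))
                (lemma g (∁-nonfull rank≥2 H (s≤s (ℕ.≤-reflexive suppH))))
                where
                lemma : ∀ g → 1 ℕ.≤ g → (i ℕ.+ 0 ℕ.+ g ∸ 1) ∸ (g ∸ 1) ≡ i
                lemma (suc g) _ = trans (cong (λ x → x ∸ 1 ∸ g) (trans (cong (ℕ._+ suc g) (ℕ.+-identityʳ i)) (ℕ.+-suc i g))) (ℕ.m+n∸n≡m i g)
            go (pinch B′ C c B≢C p o′ p′ o″ z) poly with B Fin.≟ B′ | B Fin.≟ C
            ... | yes refl | _ = cong (blockCoeff (blockPoly B) j i) (trans (sym o′) Out-H)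
            ... | no _ | yes refl with s≤s () ← subst (2 ℕ.≤_) p′ bigH
            go (pinch B′ C c B≢C p o′ p′ o″ z) poly | no ne | no ne′ with () ← subst (2 ℕ.≤_) (z B ne ne′) bigH
            -- The rank of `F` is one less than its size while that of `H` equals its size, so the
            -- rank drop is one less than the number of removed elements. The leftover sign turns
            -- `1 - o` into `o - 1`.
            go (bool supp₂ outH _) poly = large o refl (subst (2 ℕ.≤_) Out-H (outH B))
              where
              large : ∀ x → o ≡ x → 2 ℕ.≤ x → klTerm μ₀ cand F j H ≡ blockCoeff (blockPoly B) j i o
              large (suc zero) _ (s≤s ())
              large (suc (suc o′)) e _ = subst (λ x → klTerm μ₀ cand F j H ≡ blockCoeff (blockPoly B) j i x) (sym e)
                (trans (klTerm-shift μ₀ cand F j H (i ℕ.+ suc o′) (ℤ.+ suc o′) rank coeff)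
                  (cong (ℤ.+ suc o′ *_) (trans (shift-cong (i ℕ.+ suc o′) j poly) (shift-onePoly (i ℕ.+ suc o′) j))))
                where
                coeff : negpow (i ℕ.+ suc o′) * μ₀ H F ≡ ℤ.+ suc o′
                coeff = trans (cong (negpow (i ℕ.+ suc o′) *_) (trans (μ-H e) (cong (λ x → negpow x * (1ℤ + - (ℤ.+ suc (suc o′)))) (ℕ.+-suc i (suc o′)))))
                  (trans (lemma (negpow (i ℕ.+ suc o′)) (ℤ.+ suc o′)) (negpow²′ (i ℕ.+ suc o′) _))
                  where
                  lemma : ∀ s a → s * (- s * (1ℤ + - (1ℤ + a))) ≡ s * (s * a)
                  lemma = solve-∀
                rank : R F ∸ R H ≡ i ℕ.+ suc o′
                rank = trans (cong₂ _∸_ (trans rankF (cong (λ x → x ℕ.+ g ∸ 1) (trans (cong (i ℕ.+_) e) (ℕ.+-suc i (suc o′)))))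
                  (rank-2 rank≥2 H supp₂)) (ℕ.m+n∸n≡m (i ℕ.+ suc o′) g)

        singlePoly : ∀ {Y} (κ : Kind Y) B → 2 ℕ.≤ In Y B → Out Y B ≡ 0 → ∀ j → kindPoly κ j ≡ blockPoly B j
        singlePoly {Y} (empty e) B h o j with () ← ℕ.≤-trans h (ℕ.≤-reflexive (In≡0 rank≥2 {Y} e B))
        singlePoly (single B′ c p o′ z) B h o j with B Fin.≟ B′
        ... | yes refl = refl
        ... | no ne with () ← subst (2 ℕ.≤_) (z B ne) h
        singlePoly (pinch B′ C c B≢C p o′ p′ o″ z) B h o j with B Fin.≟ B′ | B Fin.≟ C
        ... | yes refl | _ with () ← trans (sym o′) o
        singlePoly (pinch B′ C c B≢C p o′ p′ o″ z) B h o j | no _ | yes refl with () ← trans (sym o″) o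
        singlePoly (pinch B′ C c B≢C p o′ p′ o″ z) B h o j | no ne | no ne′ with () ← subst (2 ℕ.≤_) (z B ne ne′) h
        singlePoly (bool _ out _) B h o j with () ← subst (2 ℕ.≤_) o (out B)

        topPoly≡ : ∀ {Y} (κ : Kind Y) → ∣ Y ∣ ≡ 0 → ∀ j → kindPoly κ j ≡ topPoly j
        topPoly≡ (empty _) full j = refl
        topPoly≡ {Y} (single B c p o z) full j with () ← trans (sym p) (In≡0 rank≥2 {Y} full B)
        topPoly≡ {Y} (pinch B C c B≢C p o p′ o′ z) full j with () ← trans (sym p) (In≡0 rank≥2 {Y} full B)
        topPoly≡ (bool _ _ three) full j with () ← subst (3 ℕ.≤_) full three

        topWeight-empty : ∀ H → ∣ ∁ H ∣ ≡ 0 → topWeight rank≥2 H ≡ 1ℤ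
        topWeight-empty H e = trans (cong₂ (λ x y → 1ℤ + - (ℤ.+ x) + choose2 x + - y) e
          (ℤΣ.sum-none (λ i → choose2 (In (∁ H) i)) (λ i → cong choose2 (In≡0 rank≥2 {∁ H} e i)))) refl

        klSum-top : ∀ F → ∣ ∁ F ∣ ≡ 0 → ∀ j → klSum μ₀ cand F j ≡
          bin ∣ F ∣ (topCoeff topPoly j) +
          Σᶠ (λ i → bin (inside (block i) F) (λ a → bin (outside (block i) F) (topBlockCoeff (blockPoly i) j a)))
        klSum-top F full j = trans (intervalSum-cong ⊥ F (λ H _ t → simplify H t (kind (∁ H)) (λ _ → refl)))
          (trans (intervalSum-+ ⊥ F _ _) (cong₂ _+_
            (trans (intervalSum-bin₁ ⊥ F (subᵇ-⊥ F) (topCoeff topPoly j)) (cong (λ x → bin ∣ x ∣ (topCoeff topPoly j)) (∖⊥ F)))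
            (trans (intervalSum-Σᶠ ⊥ F (λ i H → f H i)) (Σᶠ-cong (λ i →
              trans (intervalSum-bin₂ ⊥ F (block i) (subᵇ-⊥ F) (topBlockCoeff (blockPoly i) j))
                (cong (λ x → bin (inside (block i) x) (λ a → bin (outside (block i) x) (topBlockCoeff (blockPoly i) j a))) (∖⊥ F)))))))
          where
          f : Subset n → Fin k → ℤ
          f H i = topBlockCoeff (blockPoly i) j (inside (block i) (F ∖ H)) (outside (block i) (F ∖ H))
          simplify : ∀ H → T (subᵇ H F) → (κ : Kind (∁ H)) → (∀ i → cand H i ≡ kindPoly κ i) →
            [ flatᵇ R H ⇒ klTerm μ₀ cand F j H ] ≡ topCoeff topPoly j (codim F H) + Σᶠ (f H)
          simplify H t κ poly = trans (cong [_⇒ klTerm μ₀ cand F j H ] (flat?-correct H κ))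
            (trans (go κ poly) (cong₂ _+_ (cong (topCoeff topPoly j) y≡) (Σᶠ-cong (λ i → cong₂ (topBlockCoeff (blockPoly i) j) (inTop i) (outTop i)))))
            where
            Y = ∁ H
            y g : ℕ
            y = ∣ ∁ H ∣
            g = ∣ H ∣
            y≡ : y ≡ codim F H
            y≡ = trans (size-∁ rank≥2 H F t) (cong (ℕ._+ codim F H) full)
            inTop : ∀ i → In Y i ≡ inside (block i) (F ∖ H)
            inTop i = trans (inside-∁ (block i) H F t) (cong (ℕ._+ inside (block i) (F ∖ H)) (In≡0 rank≥2 {∁ F} full i))
            outTop : ∀ i → Out Y i ≡ outside (block i) (F ∖ H)
            outTop i = trans (outside-∁ (block i) H F t) (cong (ℕ._+ outside (block i) (F ∖ H)) (Out≡0 rank≥2 {∁ F} full i))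
            w = topWeight rank≥2 H
            f′ : Fin k → ℤ
            f′ i = topBlockCoeff (blockPoly i) j (In Y i) (Out Y i)
            f′-0 : ∀ i → In Y i ≡ 0 → f′ i ≡ 0ℤ
            f′-0 i e = cong (λ x → topBlockCoeff (blockPoly i) j x (Out Y i)) e
            rankF : R F ≡ y ℕ.+ g ∸ 2
            rankF = trans (rank-0 rank≥2 F (support-empty rank≥2 {∁ F} full)) (cong (_∸ 2) (trans (size-∖ H F t) (cong (ℕ._+ g) (sym y≡))))
            μ-H : ∀ {y′} → y ≡ y′ → μ₀ H F ≡ negpow y′ * w
            μ-H refl = cong₂ _*_ (cong negpow (sym y≡)) (topValue (kind (∁ F)))
              where
              topValue : (κ : Kind (∁ F)) → value rank≥2 H κ ≡ w
              topValue (empty _) = refl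
              topValue (single B c p o z) with () ← trans (sym p) (In≡0 rank≥2 {∁ F} full B)
              topValue (pinch B C c B≢C p o p′ o′ z) with () ← trans (sym p) (In≡0 rank≥2 {∁ F} full B)
              topValue (bool _ _ three) with () ← subst (3 ℕ.≤_) full three
            go : (κ : Kind (∁ H)) → (∀ i → cand H i ≡ kindPoly κ i) →
              [ flat? κ ⇒ klTerm μ₀ cand F j H ] ≡ topCoeff topPoly j y + Σᶠ f′
            go (empty e) poly = trans (trans (klTerm-shift μ₀ cand F j H 0 1ℤ rank coeff) (trans (ℤ.*-identityˡ _) (poly j)))
              (sym (trans (cong₂ _+_ (cong (topCoeff topPoly j) e) (ℤΣ.sum-none f′ (λ i → f′-0 i (In≡0 rank≥2 {Y} e i)))) (ℤ.+-identityʳ _)))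
              where
              coeff : negpow 0 * μ₀ H F ≡ 1ℤ
              coeff = trans (ℤ.*-identityˡ _) (trans (μ-H e) (trans (ℤ.*-identityˡ _) (topWeight-empty H e)))
              rank : R F ∸ R H ≡ 0
              rank = trans (cong₂ _∸_ (trans rankF (cong (λ x → x ℕ.+ g ∸ 2) e)) (rank-0 rank≥2 H (support-empty rank≥2 {Y} e))) (ℕ.n∸n≡0 (g ∸ 2))
            go (single B c p o z) poly = trans (cases c refl) (sym (cong₂ _+_ (cong (topCoeff topPoly j) size)
                (trans (ℤΣ.sum-one f′ B (λ i ne → f′-0 i (z i ne))) (cong₂ (topBlockCoeff (blockPoly B) j) p o))))
              where
              size : y ≡ suc c
              size = trans (sym (In+Out Y B)) (trans (cong₂ ℕ._+_ p o) (ℕ.+-identityʳ _))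
              suppH : support (In (∁ H)) ≡ 1
              suppH = support-single rank≥2 {∁ H} B p z
              weight : w ≡ 1ℤ + - (ℤ.+ suc c) + choose2 (suc c) + - choose2 (suc c)
              weight = cong₂ (λ x y → 1ℤ + - (ℤ.+ x) + choose2 x + - y) size
                (trans (ℤΣ.sum-one (λ i → choose2 (In Y i)) B (λ i ne → cong choose2 (z i ne))) (cong choose2 p))
              coeff : negpow c * μ₀ H F ≡ ℤ.+ c
              coeff = trans (cong (negpow c *_) (trans (μ-H size) (cong (negpow (suc c) *_) weight)))
                (trans (lemma (negpow c) (ℤ.+ c) (choose2 (suc c))) (negpow²′ c (ℤ.+ c)))
                where
                lemma : ∀ s a x → s * (- s * (1ℤ + - (1ℤ + a) + x + - x)) ≡ s * (s * a)
                lemma = solve-∀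
              rank : R F ∸ R H ≡ c
              rank = trans (cong₂ _∸_ (trans rankF (cong (λ x → x ℕ.+ g ∸ 2) size)) (rank-1 rank≥2 H suppH))
                (lemma g (∁-nonfull rank≥2 H (s≤s (ℕ.≤-reflexive suppH))))
                where
                lemma : ∀ g → 1 ℕ.≤ g → (suc c ℕ.+ g ∸ 2) ∸ (g ∸ 1) ≡ c
                lemma (suc g) _ = trans (cong (λ x → x ∸ 1 ∸ g) (ℕ.+-suc c g)) (ℕ.m+n∸n≡m c g)
              cases : ∀ c′ → c ≡ c′ → [ 0 <ᵇ c′ ⇒ klTerm μ₀ cand F j H ] ≡ topCoeff topPoly j (suc c′) + topBlockCoeff (blockPoly B) j (suc c′) 0
              cases zero _ = refl
              cases (suc a) refl = trans (klTerm-shift μ₀ cand F j H c (ℤ.+ c) rank coeff)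
                (trans (cong (ℤ.+ c *_) (shift-cong c j poly))
                  (trans (lemma (ℤ.+ c) (choose2 (suc c)) (δ a j) (shift c (blockPoly B) j))
                    (cong (λ x → (1ℤ + - (ℤ.+ suc c) + choose2 (suc c)) * δ a j + (- choose2 (suc c) * δ x j + 1ℤ * (ℤ.+ c * (δ a j + shift c (blockPoly B) j))))
                      (sym (ℕ.+-identityʳ a)))))
                where
                lemma : ∀ c x d s → c * s ≡ (1ℤ + - (1ℤ + c) + x) * d + (- x * d + 1ℤ * (c * (d + s)))
                lemma = solve-∀
            go (pinch B C c B≢C p o p′ o′ z) poly = trans (cases c)
              (sym (cong₂ _+_ (cong (topCoeff topPoly j) size)
                (trans (ℤΣ.sum-two f′ B C B≢C (λ i ne ne′ → f′-0 i (z i ne ne′)))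
                  (cong₂ _+_ (cong₂ (topBlockCoeff (blockPoly B) j) p o) (cong₂ (topBlockCoeff (blockPoly C) j) p′ o′)))))
              where
              size : y ≡ suc (suc c)
              size = trans (sym (In+Out Y C)) (cong₂ ℕ._+_ p′ o′)
              cases : ∀ c → 0ℤ ≡ topCoeff topPoly j (2 ℕ.+ c) +
                (topBlockCoeff (blockPoly B) j (suc c) 1 + topBlockCoeff (blockPoly C) j 1 (suc c))
              cases zero    = refl
              cases (suc a) = trans (lemma (ℤ.+ a) (choose2 (2 ℕ.+ a)) (δ (suc a) j) (ℤ.+ suc a * (δ a j + shift (suc a) (blockPoly B) j)))
                (cong (λ x → (1ℤ + - (ℤ.+ (3 ℕ.+ a)) + choose2 (3 ℕ.+ a)) * δ (suc a) j +
                  ((- choose2 (2 ℕ.+ a) * δ x j + 0ℤ * (ℤ.+ suc a * (δ a j + shift (suc a) (blockPoly B) j))) + 0ℤ)) (ℕ.+-comm 1 a))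
                where
                lemma : ∀ a x d s → 0ℤ ≡ (1ℤ + - (ℤ.+ 3 + a) + (x + (ℤ.+ 2 + a))) * d + ((- x * d + 0ℤ * s) + 0ℤ)
                lemma = solve-∀
            go (bool supp₂ out three) poly = large y refl three
              where
              S = Σᶠ (λ i → choose2 (In Y i))
              large : ∀ x → y ≡ x → 3 ℕ.≤ x → klTerm μ₀ cand F j H ≡ topCoeff topPoly j y + Σᶠ f′
              large (suc zero) _ (s≤s ())
              large (suc (suc y′)) e _ = trans (klTerm-shift μ₀ cand F j H y′ w rank coeff)
                (trans (cong (w *_) (trans (shift-cong y′ j poly) (shift-onePoly y′ j)))
                (trans (cong (λ x → (1ℤ + - (ℤ.+ x) + choose2 x + - S) * δ y′ j) e)
                (trans (lemma (1ℤ + - (ℤ.+ (2 ℕ.+ y′)) + choose2 (2 ℕ.+ y′)) S (δ y′ j))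
                  (cong₂ _+_ (cong (topCoeff topPoly j) (sym e)) (sym (trans (Σᶠ-cong blockwise) (Σᶠ-* (- δ y′ j) (λ i → choose2 (In Y i)))))))))
                where
                lemma : ∀ a s d → (a + - s) * d ≡ a * d + s * (- d)
                lemma = solve-∀
                coeff : negpow y′ * μ₀ H F ≡ w
                coeff = trans (cong (negpow y′ *_) (μ-H e)) (trans (cong (λ x → negpow y′ * (x * w)) (ℤ.neg-involutive (negpow y′))) (negpow²′ y′ w))
                rank : R F ∸ R H ≡ y′
                rank = trans (cong₂ _∸_ (trans rankF (cong (λ x → x ℕ.+ g ∸ 2) e)) (rank-2 rank≥2 H supp₂)) (ℕ.m+n∸n≡m y′ g)
                -- At least two elements lie outside each block, so the part of `topBlockCoeff` for
                -- sets within one block vanishes.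
                blockwise : ∀ i → f′ i ≡ choose2 (In Y i) * (- δ y′ j)
                blockwise i = at (In Y i) (Out Y i) (out i) (trans (In+Out Y i) e)
                  where
                  at : ∀ a c → 2 ℕ.≤ c → a ℕ.+ c ≡ 2 ℕ.+ y′ → topBlockCoeff (blockPoly i) j a c ≡ choose2 a * (- δ y′ j)
                  at zero c _ _ = refl
                  at (suc zero) c _ _ = refl
                  at (suc (suc a)) (suc zero) (s≤s ()) _
                  at (suc (suc a)) (suc (suc c)) _ eq = trans
                    (cong (λ x → - choose2 (2 ℕ.+ a) * δ x j + 0ℤ * s) (ℕ.+-cancelˡ-≡ 2 _ _ eq))
                    (lemma′ (choose2 (2 ℕ.+ a)) (δ y′ j) s)
                    where
                    s = ℤ.+ suc a * (δ a j + shift (suc a) (blockPoly i) j)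
                    lemma′ : ∀ x d s → - x * d + 0ℤ * s ≡ x * (- d)
                    lemma′ = solve-∀

  -- Evaluation for blocks of sizes 4 and 3

  coeffs : List ℤ → Poly
  coeffs []       _       = 0ℤ
  coeffs (x ∷ xs) zero    = x
  coeffs (x ∷ xs) (suc k) = coeffs xs k

  coeffs-beyond : ∀ xs k → length xs ℕ.≤ k → coeffs xs k ≡ 0ℤ
  coeffs-beyond []       k       _        = refl
  coeffs-beyond (x ∷ xs) (suc k) (s≤s le) = coeffs-beyond xs k le

  infixl 6 _⊕_
  _⊕_ : List ℤ → List ℤ → List ℤ
  []       ⊕ ys       = ys
  (x ∷ xs) ⊕ []       = x ∷ xs
  (x ∷ xs) ⊕ (y ∷ ys) = (x + y) ∷ (xs ⊕ ys)

  dot : List ℤ → (ℕ → ℤ) → ℤ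
  dot []       φ = 0ℤ
  dot (x ∷ xs) φ = x * φ 0 + dot xs (λ i → φ (suc i))

  dot-⊕ : ∀ xs ys φ → dot (xs ⊕ ys) φ ≡ dot xs φ + dot ys φ
  dot-⊕ []       ys       φ = sym (ℤ.+-identityˡ _)
  dot-⊕ (x ∷ xs) []       φ = sym (ℤ.+-identityʳ _)
  dot-⊕ (x ∷ xs) (y ∷ ys) φ = trans (cong₂ _+_ (ℤ.*-distribʳ-+ (φ 0) x y) (dot-⊕ xs ys _))
    (interchange (x * φ 0) _ (dot xs _) _)

  nextRow : List ℤ → List ℤ
  nextRow xs = xs ⊕ (0ℤ ∷ xs)

  pascalRow : ℕ → List ℤ
  pascalRow zero    = 1ℤ ∷ []
  pascalRow (suc p) = nextRow (pascalRow p)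

  -- bin unfolds to 2^p summands; the dot product with a row of Pascal's triangle can be evaluated
  bin≡dot : ∀ p φ → bin p φ ≡ dot (pascalRow p) φ
  bin≡dot zero    φ = l (φ 0)
    where
    l : ∀ x → x ≡ 1ℤ * x + 0ℤ
    l = solve-∀
  bin≡dot (suc p) φ = trans (cong₂ _+_ (bin≡dot p φ) (bin≡dot p _))
    (trans (cong (dot (pascalRow p) φ +_) (sym (ℤ.+-identityˡ _))) (sym (dot-⊕ (pascalRow p) (0ℤ ∷ pascalRow p) φ)))

  bin₂≡dot : (row : ℕ → List ℤ) → (∀ p φ → bin p φ ≡ dot (row p) φ) → ∀ p q (φ : ℕ → ℕ → ℤ) →
    bin p (λ i → bin q (φ i)) ≡ dot (row p) (λ i → dot (row q) (φ i))
  bin₂≡dot row bin≡ p q φ = trans (bin-cong p (λ i → bin≡ q (φ i))) (bin≡ p _)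

  sumℤ-↭ : ∀ {xs ys} (h : ℕ → ℤ) → xs ↭ ys → sumℤ (map h xs) ≡ sumℤ (map h ys)
  sumℤ-↭ h ↭.refl = refl
  sumℤ-↭ h (↭.prep x p) = cong (h x +_) (sumℤ-↭ h p)
  sumℤ-↭ h (↭.swap x y p) = trans (cong (λ z → h x + (h y + z)) (sumℤ-↭ h p)) (l (h x) (h y) _)
    where
    l : ∀ a b c → a + (b + c) ≡ b + (a + c)
    l = solve-∀
  sumℤ-↭ h (↭.trans p q) = trans (sumℤ-↭ h p) (sumℤ-↭ h q)

  -- a record, since comparing two such statements up to unfolding would evaluate f symbolically
  record Palindromic (N : ℕ) (f : ℕ → ℤ) : Set where
    constructor palindromic
    field
      mirror : ∀ k → k ℕ.≤ N → f k ≡ f (N ∸ k)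
  open Palindromic public

  -- Only the indices up to `h` are evaluated; any larger index is the mirror image of one of these
  -- because `N` is at most `2h + 1`.
  palindromic? : ∀ N h f → {(N ℕ.≤ᵇ (suc h ℕ.+ h)) ≡ true} →
    True (ℕ.allUpTo? (λ k → f k ℤ.≟ f (N ∸ k)) (suc h)) → Palindromic N f
  palindromic? N h f {N≤} t = palindromic go
    where
    go : ∀ k → k ℕ.≤ N → f k ≡ f (N ∸ k)
    go k le with k ℕ.≤? h
    ... | yes k≤h = toWitness t (s≤s k≤h)
    ... | no  k≰h = sym (trans (toWitness t (s≤s N∸k≤h)) (cong f (ℕ.m∸[m∸n]≡n le)))
      where
      N∸k≤h : N ∸ k ℕ.≤ h
      N∸k≤h = ℕ.≤-trans (ℕ.∸-monoʳ-≤ N (ℕ.≰⇒> k≰h)) (ℕ.m≤n+o⇒m∸n≤o N (suc h) (ℕ.≤ᵇ⇒≤ N _ (subst T (sym N≤) _)))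

  -- inverse Kazhdan–Lusztig polynomial of the circuit of size 21 - s
  circuitPoly : ℕ → Poly
  circuitPoly 4 = coeffs (map ℤ.+_ (16 ∷ 119 ∷ 544 ∷ 1700 ∷ 3808 ∷ 6188 ∷ 7072 ∷ 4862 ∷ []))
  circuitPoly _ = coeffs (map ℤ.+_ (17 ∷ 135 ∷ 663 ∷ 2244 ∷ 5508 ∷ 9996 ∷ 13260 ∷ 11934 ∷ 4862 ∷ []))

  -- With the circuit polynomials fixed, palindromicity of degree 19 leaves room for one polynomial
  -- of degree at most 9. `partitionSum-palindromic` confirms that it is this one.
  Q-coeffs : List ℤ
  Q-coeffs = map ℤ.+_ (163 ∷ 1790 ∷ 10323 ∷ 39217 ∷ 106659 ∷ 215169 ∷ 323646 ∷ 350404 ∷ 232662 ∷ 71162 ∷ [])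

  circuitSum : ℕ → ℕ → ℕ → ℤ
  circuitSum s p k = dot (pascalRow p) (λ i → dot (pascalRow (21 ∸ s)) (blockCoeff (circuitPoly s) k i))

  triple : ℤ → ℤ
  triple x = x + (x + x)

  -- Abstracting over the rows keeps these sums from being evaluated at a symbolic k.
  partitionBlockSum : (ℕ → List ℤ) → ℕ → ℕ → ℤ
  partitionBlockSum row k s = dot (row s) (λ i → dot (row (21 ∸ s)) (topBlockCoeff (circuitPoly s) k i))

  partitionSum : (ℕ → List ℤ) → ℕ → ℤ
  partitionSum row k = dot (row 21) (topCoeff (coeffs Q-coeffs) k) +
    (triple (partitionBlockSum row k 4) + triple (partitionBlockSum row k 3))

  palindromic-4-0 : Palindromic 16 (circuitSum 4 0)
  palindromic-4-0 = palindromic? 16 8 (circuitSum 4 0) {refl} _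

  palindromic-4-1 : Palindromic 17 (circuitSum 4 1)
  palindromic-4-1 = palindromic? 17 8 (circuitSum 4 1) {refl} _

  palindromic-4-2 : Palindromic 18 (circuitSum 4 2)
  palindromic-4-2 = palindromic? 18 9 (circuitSum 4 2) {refl} _

  palindromic-3-0 : Palindromic 17 (circuitSum 3 0)
  palindromic-3-0 = palindromic? 17 8 (circuitSum 3 0) {refl} _

  palindromic-3-1 : Palindromic 18 (circuitSum 3 1)
  palindromic-3-1 = palindromic? 18 9 (circuitSum 3 1) {refl} _

  -- The restriction to a flat missing `c` elements of a block of size `s` is a circuit on the
  -- elements outside the block, with the `p` remaining block elements as coloops. Coloops do not
  -- change Q, so `circuitPoly` depends on `s` alone. As at least two block elements are missing,
  -- five pairs of `s` and `p` remain.
  circuitSum-palindromic : ∀ s p c → s ≡ 4 ⊎ s ≡ 3 → c ℕ.+ p ≡ s → 2 ℕ.≤ c →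
    Palindromic (p ℕ.+ (21 ∸ s) ∸ 1) (circuitSum s p)
  circuitSum-palindromic .4 0 c (inj₁ refl) e _ = palindromic-4-0
  circuitSum-palindromic .4 1 c (inj₁ refl) e _ = palindromic-4-1
  circuitSum-palindromic .4 2 c (inj₁ refl) e _ = palindromic-4-2
  circuitSum-palindromic .3 0 c (inj₂ refl) e _ = palindromic-3-0
  circuitSum-palindromic .3 1 c (inj₂ refl) e _ = palindromic-3-1
  circuitSum-palindromic .4 (suc (suc (suc p))) c (inj₁ refl) e h =
    ⊥-elim (ℕ.<⇒≢ (ℕ.+-mono-≤ h (s≤s (s≤s (s≤s (z≤n {p}))))) (sym e))
  circuitSum-palindromic .3 (suc (suc p)) c (inj₂ refl) e h =
    ⊥-elim (ℕ.<⇒≢ (ℕ.+-mono-≤ h (s≤s (s≤s (z≤n {p})))) (sym e))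

  partitionSum-palindromic : Palindromic 19 (partitionSum pascalRow)
  partitionSum-palindromic = palindromic? 19 9 (partitionSum pascalRow) {refl} _

  circuitPoly-degree : ∀ s k → s ≡ 4 ⊎ s ≡ 3 → (21 ∸ s) ℕ.≤ suc (2 ℕ.* k) → circuitPoly s k ≡ 0ℤ
  circuitPoly-degree .4 k (inj₁ refl) h = coeffs-beyond (map ℤ.+_ (16 ∷ 119 ∷ 544 ∷ 1700 ∷ 3808 ∷ 6188 ∷ 7072 ∷ 4862 ∷ [])) k (ℕ.*-cancelˡ-≤ 2 (ℕ.≤-pred h))
  circuitPoly-degree .3 k (inj₂ refl) h = coeffs-beyond (map ℤ.+_ (17 ∷ 135 ∷ 663 ∷ 2244 ∷ 5508 ∷ 9996 ∷ 13260 ∷ 11934 ∷ 4862 ∷ [])) k (ℕ.*-cancelˡ-< 2 8 k (ℕ.≤-pred h))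

  -- Stated for a variable ground set, whose size is only propositionally 21: unfolding sums over
  -- the subsets of a concrete 21-element set is infeasible.
  module Determined {n k} (b : Fin n → Fin k)
    (rank≥2 : 2 ℕ.≤ support (Blocks.In b ⊤))
    (card : ∣ ⊤ {n} ∣ ≡ 21)
    (size-4⊎3 : ∀ i → Blocks.In b ⊤ i ≡ 4 ⊎ Blocks.In b ⊤ i ≡ 3)
    (Σᶠ-sizes : (h : ℕ → ℤ) → Σᶠ (λ i → h (Blocks.In b ⊤ i)) ≡ triple (h 4) + triple (h 3)) where
    open KazhdanLusztig b

    size : Fin k → ℕ
    size i = In ⊤ i

    Out-⊤ : ∀ i → Out ⊤ i ≡ 21 ∸ size i
    Out-⊤ i = trans (sym (ℕ.m+n∸m≡n (size i) (Out ⊤ i))) (cong (_∸ size i) (trans (In+Out ⊤ i) card))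

    open Candidate rank≥2 (λ i → circuitPoly (size i)) (coeffs Q-coeffs)

    private
      R = r rank≥2

    inside-∁∁ : ∀ i F → In ⊤ i ≡ In (∁ F) i ℕ.+ inside (block i) F
    inside-∁∁ i F = trans (cong (inside (block i)) (trans (sym (∖⊥ ⊤)) (⊤∖ ⊥)))
      (trans (inside-∁ (block i) ⊥ F (subᵇ-⊥ F)) (cong (λ x → In (∁ F) i ℕ.+ inside (block i) x) (∖⊥ F)))

    outside-∁∁ : ∀ i F → Out ⊤ i ≡ Out (∁ F) i ℕ.+ outside (block i) F
    outside-∁∁ i F = trans (cong (outside (block i)) (trans (sym (∖⊥ ⊤)) (⊤∖ ⊥)))
      (trans (outside-∁ (block i) ⊥ F (subᵇ-⊥ F)) (cong (λ x → Out (∁ F) i ℕ.+ outside (block i) x) (∖⊥ F)))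

    -- Induction on the size of `F`, since `step` assumes the result for all flats strictly below.
    determined : ∀ {m q} → IsMobius R m → IsInverseKL R m q → ∀ F → Flat R F → ∀ k → q F k ≡ cand F k
    determined {m} {q} isM isQ F fl = go (suc ∣ F ∣) F ℕ.≤-refl fl
      where
      go : ∀ N F → ∣ F ∣ ℕ.< N → Flat R F → ∀ k → q F k ≡ cand F k
      go (suc N) F (s≤s lt) fl = byKind (flatKind rank≥2 F fl)
        where
        ih : ∀ H → Flat R H → T (subᵇ H F) → 0 ℕ.< codim F H → ∀ k → q H k ≡ cand H k
        ih H fH t pos = go N H (ℕ.<-≤-trans (ℕ.≤-trans (ℕ.+-monoˡ-≤ ∣ H ∣ pos) (ℕ.≤-reflexive (sym (size-∖ H F t)))) lt) fH
        byKind : FlatKind rank≥2 F → ∀ k → q F k ≡ cand F k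
        byKind (boolean supp out) = positive ∣ F ∣ (rank-2 rank≥2 F supp)
          where
          cand≡ : ∀ k → cand F k ≡ onePoly k
          cand≡ = Out≥2⇒onePoly (kind (∁ F)) out
          positive : ∀ x → R F ≡ x → ∀ k → q F k ≡ cand F k
          -- Rank 0 occurs only for this kind of flat. There Q is fixed by the normalization, as the
          -- degree bound concerns positive rank.
          positive zero    e k = trans (proj₁ isQ F fl e k) (sym (cand≡ k))
          positive (suc x) e = step isM isQ F fl (subst (0 ℕ.<_) (sym e) (s≤s z≤n)) deg palin ih
            where
            deg : ∀ k → R F ℕ.≤ 2 ℕ.* k → cand F k ≡ 0ℤ
            deg zero    h with () ← subst (ℕ._≤ 0) e h
            deg (suc k) h = cand≡ (suc k)
            palin : ∀ k → k ℕ.≤ R F → _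
            palin k h = trans (klSum-bool F out k) (trans
              (cong ℤ.+_ (trans (nCk≡nC[n∸k] (subst (k ℕ.≤_) R≡ h)) (cong (λ x → ∣ F ∣ choose (x ∸ k)) (sym R≡))))
              (sym (klSum-bool F out (R F ∸ k))))
              where
              R≡ : R F ≡ ∣ F ∣
              R≡ = rank-2 rank≥2 F supp
        byKind (oneBlock B big out others) = step isM isQ F fl pos deg palin ih
          where
          p c s : ℕ
          p = inside (block B) F
          c = In (∁ F) B
          s = size B
          m≡ : outside (block B) F ≡ 21 ∸ s
          m≡ = trans (trans (cong (ℕ._+ outside (block B) F) (sym out)) (sym (outside-∁∁ B F))) (Out-⊤ B)
          supp : support (In (∁ F)) ≡ 1
          supp = go′ c refl big
            where
            go′ : ∀ x → In (∁ F) B ≡ x → 2 ℕ.≤ x → support (In (∁ F)) ≡ 1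
            go′ (suc c) eq _ = support-single rank≥2 {∁ F} B eq others
          R≡ : R F ≡ p ℕ.+ (21 ∸ s) ∸ 1
          R≡ = trans (rank-1 rank≥2 F supp) (cong (_∸ 1) (trans (sym (inside+outside (block B) F)) (cong (p ℕ.+_) m≡)))
          large : ∀ s → s ≡ 4 ⊎ s ≡ 3 → 2 ℕ.≤ 21 ∸ s
          large .4 (inj₁ refl) = s≤s (s≤s z≤n)
          large .3 (inj₂ refl) = s≤s (s≤s z≤n)
          cand≡ : ∀ k → cand F k ≡ circuitPoly s k
          cand≡ k = go′ (kind (∁ F))
            where
            go′ : (κ : Kind (∁ F)) → kindPoly κ k ≡ circuitPoly s k
            go′ κ = singlePoly κ B big out k
          pos : 0 ℕ.< R F
          pos = subst (0 ℕ.<_) (sym R≡) (ℕ.∸-monoˡ-≤ 1 (ℕ.≤-trans (large s (size-4⊎3 B)) (ℕ.m≤n+m _ p)))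
          deg : ∀ k → R F ℕ.≤ 2 ℕ.* k → cand F k ≡ 0ℤ
          deg k h = trans (cand≡ k) (circuitPoly-degree s k (size-4⊎3 B)
            (ℕ.≤-trans (ℕ.m≤n+m (21 ∸ s) p) (ℕ.≤-trans (ℕ.m≤n+m∸n (p ℕ.+ (21 ∸ s)) 1) (s≤s (subst (ℕ._≤ 2 ℕ.* k) R≡ h)))))
          sum≡ : ∀ k → klSum rank≥2 (möb rank≥2) cand F k ≡ circuitSum s p k
          sum≡ k = trans (klSum-single F B big out others k)
            (trans (cong (λ x → bin p (λ a → bin x (blockCoeff (circuitPoly s) k a))) m≡) (bin₂≡dot pascalRow bin≡dot p (21 ∸ s) (blockCoeff (circuitPoly s) k)))
          palin : ∀ k → k ℕ.≤ R F → klSum rank≥2 (möb rank≥2) cand F k ≡ klSum rank≥2 (möb rank≥2) cand F (R F ∸ k)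
          palin k h = trans (sum≡ k) (trans
            (subst (λ N → k ℕ.≤ N → circuitSum s p k ≡ circuitSum s p (N ∸ k)) (sym R≡)
              (mirror (circuitSum-palindromic s p c (size-4⊎3 B) (sym (inside-∁∁ B F)) big) k) h)
            (sym (sum≡ (R F ∸ k))))
        byKind (top full) = step isM isQ F fl (subst (0 ℕ.<_) (sym R≡) (s≤s z≤n)) deg palin ih
          where
          cardF : ∣ F ∣ ≡ 21
          cardF = trans (cong ∣_∣ (sym (∖⊥ F))) (trans (sym (trans (size-∁ rank≥2 ⊥ F (subᵇ-⊥ F)) (cong (ℕ._+ codim F ⊥) full))) (trans (cong ∣_∣ (trans (sym (⊤∖ ⊥)) (∖⊥ (⊤ {n})))) card))
          R≡ : R F ≡ 19
          R≡ = trans (rank-0 rank≥2 F (support-empty rank≥2 {∁ F} full)) (cong (_∸ 2) cardF)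
          in≡ : ∀ i → inside (block i) F ≡ size i
          in≡ i = trans (cong (ℕ._+ inside (block i) F) (sym (In≡0 rank≥2 {∁ F} full i))) (sym (inside-∁∁ i F))
          out≡ : ∀ i → outside (block i) F ≡ 21 ∸ size i
          out≡ i = trans (trans (cong (ℕ._+ outside (block i) F) (sym (Out≡0 rank≥2 {∁ F} full i))) (sym (outside-∁∁ i F))) (Out-⊤ i)
          cand≡ : ∀ k → cand F k ≡ coeffs Q-coeffs k
          cand≡ k = topPoly≡ (kind (∁ F)) full k
          deg : ∀ k → R F ℕ.≤ 2 ℕ.* k → cand F k ≡ 0ℤ
          deg k h = trans (cand≡ k) (coeffs-beyond Q-coeffs k (ℕ.*-cancelˡ-< 2 9 k (subst (ℕ._≤ 2 ℕ.* k) R≡ h)))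
          sum-rows : ∀ row → (∀ p φ → bin p φ ≡ dot (row p) φ) → ∀ k →
            klSum rank≥2 (möb rank≥2) cand F k ≡ partitionSum row k
          sum-rows row bin≡ k = trans (klSum-top F full k) (cong₂ _+_
            (trans (bin≡ ∣ F ∣ _) (cong (λ x → dot (row x) (topCoeff (coeffs Q-coeffs) k)) cardF))
            (trans (Σᶠ-cong (λ i → trans
                (cong₂ (λ x y → bin x (λ a → bin y (topBlockCoeff (circuitPoly (size i)) k a))) (in≡ i) (out≡ i))
                (bin₂≡dot row bin≡ (size i) (21 ∸ size i) (topBlockCoeff (circuitPoly (size i)) k))))
              (Σᶠ-sizes (partitionBlockSum row k))))
          sum≡ : ∀ k → klSum rank≥2 (möb rank≥2) cand F k ≡ partitionSum pascalRow k
          sum≡ = sum-rows pascalRow bin≡dot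
          palin : ∀ k → k ℕ.≤ R F → klSum rank≥2 (möb rank≥2) cand F k ≡ klSum rank≥2 (möb rank≥2) cand F (R F ∸ k)
          palin k h = trans (sum≡ k) (trans
            (subst (λ N → k ℕ.≤ N → partitionSum pascalRow k ≡ partitionSum pascalRow (N ∸ k)) (sym R≡) (mirror partitionSum-palindromic k) h)
            (sym (sum≡ (R F ∸ k))))

    Q-⊤ : ∀ {m q} → IsMobius R m → IsInverseKL R m q → ∀ k → q ⊤ k ≡ coeffs Q-coeffs k
    Q-⊤ isM isQ k = trans (determined isM isQ ⊤ flat k) (topPoly≡ (kind (∁ ⊤)) size-∁⊤ k)
      where
      size-∁⊤ : ∣ ∁ (⊤ {n}) ∣ ≡ 0
      size-∁⊤ = trans (cong ∣_∣ (sym (⊤∖ (⊤ {n})))) (codim-refl (⊤ {n}))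
      flat : Flat R ⊤
      flat = subst T (sym (kindFlat-correct rank≥2 ⊤ (empty size-∁⊤))) _

  module _ (λ′ : Fin 21 → Fin 6) (sizes : blockSizes λ′ ↭ (4 ∷ 4 ∷ 4 ∷ 3 ∷ 3 ∷ 3 ∷ [])) where
    open Blocks λ′

    size : Fin 6 → ℕ
    size i = In ⊤ i

    size≡ : map size (allFin 6) ≡ blockSizes λ′
    size≡ = map-cong (λ i → trans (inside-⊤ (λ e → does (λ′ e Fin.≟ i))) (sym (countᵇ≡countFin 21 (λ e → does (λ′ e Fin.≟ i))))) (allFin 6)

    size-4⊎3 : ∀ i → size i ≡ 4 ⊎ size i ≡ 3
    size-4⊎3 = All.tabulate⁻ (All.map⁻ {f = size} (subst (All (λ s → s ≡ 4 ⊎ s ≡ 3)) (sym size≡) (All-resp-↭ (↭-sym sizes)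
      (inj₁ refl ∷ inj₁ refl ∷ inj₁ refl ∷ inj₂ refl ∷ inj₂ refl ∷ inj₂ refl ∷ []))))

    rank≥2 : 2 ℕ.≤ support size
    rank≥2 = subst (2 ℕ.≤_) (sum-cong-≗ {6} {λ _ → 1} {λ i → ind (size i)} (λ i → positive (size-4⊎3 i))) (s≤s (s≤s z≤n))
      where
      positive : ∀ {s} → s ≡ 4 ⊎ s ≡ 3 → 1 ≡ ind s
      positive (inj₁ refl) = refl
      positive (inj₂ refl) = refl

    -- The blocks come in an unknown order, but they enter the top sum only through their sizes, and
    -- a sum is invariant under permutation.
    Σᶠ-sizes : (h : ℕ → ℤ) → Σᶠ (λ i → h (size i)) ≡ triple (h 4) + triple (h 3)
    Σᶠ-sizes h = trans (trans (cong (sumℤ ∘ map h) size≡) (sumℤ-↭ h sizes)) (l (h 4) (h 3))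
      where
      l : ∀ x y → x + (x + (x + (y + (y + (y + 0ℤ))))) ≡ (x + (x + x)) + (y + (y + y))
      l = solve-∀

    Q-partition : ∀ {m q} → IsMobius (partitionMatroid λ′) m → IsInverseKL (partitionMatroid λ′) m q →
      ∀ k → q ⊤ k ≡ coeffs Q-coeffs k
    Q-partition = Determined.Q-⊤ λ′ rank≥2 refl size-4⊎3 Σᶠ-sizes

open Enumeration using (coeffs; coeffs-beyond; Q-coeffs; Q-partition)

-- Arithmetic in a complete ordered field

module Field (R : CompleteOrderedField) where
  open CompleteOrderedField R
  open Complex R

  ring : CommutativeRing _ _
  ring = record
    { Carrier = Carrier ; _≈_ = _≡_ ; _+_ = _+_ ; _*_ = _*_ ; -_ = -_ ; 0# = 0# ; 1# = 1#
    ; isCommutativeRing = record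
      { isRing = record
        { +-isAbelianGroup = record
          { isGroup = record
            { isMonoid = record
              { isSemigroup = record
                { isMagma = record { isEquivalence = isEquivalence ; ∙-cong = cong₂ _+_ }
                ; assoc = +-assoc }
              ; identity = +-identityˡ , λ x → trans (+-comm x 0#) (+-identityˡ x) }
            ; inverse = -‿inverseˡ , λ x → trans (+-comm x (- x)) (-‿inverseˡ x)
            ; ⁻¹-cong = cong -_ }
          ; comm = +-comm }
        ; *-cong = cong₂ _*_
        ; *-assoc = *-assoc
        ; *-identity = *-identityˡ , λ x → trans (*-comm x 1#) (*-identityˡ x)
        ; distrib = (λ x y z → trans (*-comm x _) (trans (distribʳ x y z) (cong₂ _+_ (*-comm y x) (*-comm z x)))) , distribʳ }
      ; *-comm = *-comm } }

  open CommutativeRing ring using (+-identityʳ; *-identityʳ; zeroˡ; zeroʳ; -‿inverseʳ) public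
  open Algebra.Properties.Ring (CommutativeRing.ring ring)
    using (-‿distribˡ-*; -‿distribʳ-*; -‿involutive; -0#≈0#; -‿+-comm) public

  fromℕ-+ : ∀ m n → fromℕ (m ℕ.+ n) ≡ fromℕ m + fromℕ n
  fromℕ-+ zero    n = sym (+-identityˡ _)
  fromℕ-+ (suc m) n = trans (cong (1# +_) (fromℕ-+ m n)) (sym (+-assoc 1# _ _))

  fromℕ-* : ∀ m n → fromℕ (m ℕ.* n) ≡ fromℕ m * fromℕ n
  fromℕ-* zero    n = sym (zeroˡ _)
  fromℕ-* (suc m) n = trans (fromℕ-+ n (m ℕ.* n))
    (trans (cong₂ _+_ (sym (*-identityˡ _)) (fromℕ-* m n)) (sym (distribʳ (fromℕ n) 1# (fromℕ m))))

  fromℤ-neg : ∀ i → fromℤ (ℤ.- i) ≡ - fromℤ i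
  fromℤ-neg (ℤ.+ zero)    = sym -0#≈0#
  fromℤ-neg (ℤ.+ suc n)   = refl
  fromℤ-neg (ℤ.-[1+ n ])  = sym (-‿involutive _)

  fromℤ-⊖ : ∀ m n → fromℤ (m ℤ.⊖ n) ≡ fromℕ m + - fromℕ n
  fromℤ-⊖ m       zero    = sym (trans (cong (fromℕ m +_) -0#≈0#) (+-identityʳ _))
  fromℤ-⊖ zero    (suc n) = sym (+-identityˡ _)
  fromℤ-⊖ (suc m) (suc n) = trans (cong fromℤ (ℤ.[1+m]⊖[1+n]≡m⊖n m n)) (trans (fromℤ-⊖ m n) (sym (begin
    (1# + fromℕ m) + - (1# + fromℕ n)       ≡⟨ cong₂ _+_ (+-comm 1# (fromℕ m)) (sym (-‿+-comm 1# (fromℕ n))) ⟩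
    (fromℕ m + 1#) + (- 1# + - fromℕ n)     ≡⟨ +-assoc (fromℕ m) 1# _ ⟩
    fromℕ m + (1# + (- 1# + - fromℕ n))     ≡⟨ cong (fromℕ m +_) (sym (+-assoc 1# (- 1#) _)) ⟩
    fromℕ m + ((1# + - 1#) + - fromℕ n)     ≡⟨ cong (λ x → fromℕ m + (x + - fromℕ n)) (-‿inverseʳ 1#) ⟩
    fromℕ m + (0# + - fromℕ n)              ≡⟨ cong (fromℕ m +_) (+-identityˡ _) ⟩
    fromℕ m + - fromℕ n                     ∎)))
    where open ≡-Reasoning

  fromℤ-+ : ∀ i j → fromℤ (i ℤ.+ j) ≡ fromℤ i + fromℤ j
  fromℤ-+ (ℤ.+ m)      (ℤ.+ n)      = fromℕ-+ m n
  fromℤ-+ (ℤ.+ m)      ℤ.-[1+ n ]   = fromℤ-⊖ m (suc n)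
  fromℤ-+ ℤ.-[1+ m ]   (ℤ.+ n)      = trans (fromℤ-⊖ n (suc m)) (+-comm _ _)
  fromℤ-+ ℤ.-[1+ m ]   ℤ.-[1+ n ]   = trans (cong (λ x → - fromℕ (suc x)) (sym (ℕ.+-suc m n)))
    (trans (cong -_ (fromℕ-+ (suc m) (suc n))) (sym (-‿+-comm _ _)))

  fromℤ-pos* : ∀ m j → fromℤ (ℤ.+ m ℤ.* j) ≡ fromℕ m * fromℤ j
  fromℤ-pos* m (ℤ.+ n)    = trans (cong fromℤ (sym (ℤ.pos-* m n))) (fromℕ-* m n)
  fromℤ-pos* m ℤ.-[1+ n ] = trans (cong fromℤ (sym (ℤ.neg-distribʳ-* (ℤ.+ m) (ℤ.+ suc n))))
    (trans (fromℤ-neg (ℤ.+ m ℤ.* ℤ.+ suc n)) (trans (cong -_ (fromℤ-pos* m (ℤ.+ suc n))) (-‿distribʳ-* _ _)))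

  fromℤ-* : ∀ i j → fromℤ (i ℤ.* j) ≡ fromℤ i * fromℤ j
  fromℤ-* (ℤ.+ m)    j = fromℤ-pos* m j
  fromℤ-* ℤ.-[1+ m ] j = trans (cong fromℤ (sym (ℤ.neg-distribˡ-* (ℤ.+ suc m) j)))
    (trans (fromℤ-neg (ℤ.+ suc m ℤ.* j)) (trans (cong -_ (fromℤ-pos* (suc m) j)) (-‿distribˡ-* _ _)))

  ringℤ : AlmostCommutativeRing _ _
  ringℤ = fromCommutativeRing ring

  fromℤ-homo : ℤ.+-*-rawRing -Raw-AlmostCommutative⟶ ringℤ
  fromℤ-homo = record
    { ⟦_⟧ = fromℤ ; +-homo = fromℤ-+ ; *-homo = fromℤ-* ; -‿homo = fromℤ-neg
    ; 0-homo = refl ; 1-homo = +-identityʳ 1# }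

  open Algebra.Solver.Ring ℤ.+-*-rawRing ringℤ fromℤ-homo
    (λ i j → Maybe.map (cong fromℤ) (dec⇒maybe (i ℤ.≟ j))) public
    using (solve; con; _:+_; _:*_; :-_; _:=_)

  -- Inequalities are stated as nonnegativity of one expression, so that the ring solver can
  -- rearrange them.
  NN : Carrier → Set
  NN x = 0# ≤ x

  nn-+ : ∀ {x y} → NN x → NN y → NN (x + y)
  nn-+ {x} {y} (inj₁ p) (inj₁ q) = inj₁ (<-trans q (subst (_< x + y) (+-identityˡ y) (+-mono-< y p)))
  nn-+ {x} {y} (inj₁ p) (inj₂ refl) = inj₁ (subst (0# <_) (sym (+-identityʳ x)) p)
  nn-+ {x} {y} (inj₂ refl) q = subst NN (sym (+-identityˡ y)) q

  nn-* : ∀ {x y} → NN x → NN y → NN (x * y)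
  nn-* (inj₁ p) (inj₁ q) = inj₁ (*-pos p q)
  nn-* {x} (inj₁ p) (inj₂ refl) = inj₂ (sym (zeroʳ x))
  nn-* {y = y} (inj₂ refl) q = inj₂ (sym (zeroˡ y))

  neg-pos : ∀ {x} → x < 0# → 0# < - x
  neg-pos {x} p = subst₂ _<_ (-‿inverseʳ x) (+-identityˡ (- x)) (+-mono-< (- x) p)

  nn-total : ∀ x → NN x ⊎ NN (- x)
  nn-total x with <-trichotomy 0# x
  ... | inj₁ p        = inj₁ (inj₁ p)
  ... | inj₂ (inj₁ p) = inj₁ (inj₂ p)
  ... | inj₂ (inj₂ p) = inj₂ (inj₁ (neg-pos p))

  nn-antisym : ∀ {x} → NN x → NN (- x) → x ≡ 0#
  nn-antisym (inj₂ p) q = sym p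
  nn-antisym {x} (inj₁ p) (inj₂ q) = trans (sym (-‿involutive x)) (trans (cong -_ (sym q)) -0#≈0#)
  nn-antisym {x} (inj₁ p) (inj₁ q) = ⊥-elim (<-irrefl 0# (<-trans p
    (subst₂ _<_ (+-identityˡ x) (-‿inverseˡ x) (+-mono-< x q))))

  ≤⇒nn : ∀ {x y} → x ≤ y → NN (y + - x)
  ≤⇒nn {x} {y} (inj₁ p) = inj₁ (subst (_< y + - x) (-‿inverseʳ x) (+-mono-< (- x) p))
  ≤⇒nn {x} (inj₂ refl) = inj₂ (sym (-‿inverseʳ x))

  nn⇒≤ : ∀ {x y} → NN (y + - x) → x ≤ y
  nn⇒≤ {x} {y} (inj₁ p) = inj₁ (subst₂ _<_ (+-identityˡ x) (solve 2 (λ x y → (y :+ :- x) :+ x := y) refl x y) (+-mono-< x p))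
  nn⇒≤ {x} {y} (inj₂ p) = inj₂ (trans (sym (+-identityˡ x)) (trans (cong (_+ x) p) (solve 2 (λ x y → (y :+ :- x) :+ x := y) refl x y)))

  nn-1 : NN 1#
  nn-1 with <-trichotomy 0# 1#
  ... | inj₁ p        = inj₁ p
  ... | inj₂ (inj₁ p) = inj₂ p
  ... | inj₂ (inj₂ p) = inj₁ (subst (0# <_) (trans (solve 1 (λ x → :- x :* :- x := x :* x) refl 1#) (*-identityˡ 1#))
    (*-pos (neg-pos p) (neg-pos p)))

  ¬nn-−1 : ¬ NN (- 1#)
  ¬nn-−1 p = 0≢1 (sym (nn-antisym nn-1 p))

  nn-fromℕ : ∀ n → NN (fromℕ n)
  nn-fromℕ zero    = inj₂ refl
  nn-fromℕ (suc n) = nn-+ nn-1 (nn-fromℕ n)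

  nn-fromℕ-∸ : ∀ {m n} → m ℕ.≤ n → NN (fromℕ n + - fromℕ m)
  nn-fromℕ-∸ {m} {n} le = subst NN (begin
    fromℕ (n ℕ.∸ m)                          ≡⟨ solve 2 (λ x y → x := (y :+ x) :+ :- y) refl _ _ ⟩
    (fromℕ m + fromℕ (n ℕ.∸ m)) + - fromℕ m  ≡⟨ cong (_+ - fromℕ m) (sym (fromℕ-+ m (n ℕ.∸ m))) ⟩
    fromℕ (m ℕ.+ (n ℕ.∸ m)) + - fromℕ m      ≡⟨ cong (λ x → fromℕ x + - fromℕ m) (ℕ.m+[n∸m]≡n le) ⟩
    fromℕ n + - fromℕ m                      ∎) (nn-fromℕ (n ℕ.∸ m))
    where open ≡-Reasoning

  fromℕ-suc≢0 : ∀ n → fromℕ (suc n) ≢ 0#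
  fromℕ-suc≢0 n e = ¬nn-−1 (subst NN (begin
    fromℕ n                        ≡⟨ solve 2 (λ o x → x := :- o :+ (o :+ x)) refl 1# (fromℕ n) ⟩
    - 1# + (1# + fromℕ n)          ≡⟨ cong (- 1# +_) e ⟩
    - 1# + 0#                      ≡⟨ +-identityʳ _ ⟩
    - 1#                           ∎) (nn-fromℕ n))
    where open ≡-Reasoning

  inv : ∀ n → ∃ λ y → fromℕ (suc n) * y ≡ 1#
  inv n = inverse (fromℕ (suc n)) (fromℕ-suc≢0 n)

  nn-inv : ∀ n {y} → fromℕ (suc n) * y ≡ 1# → NN y
  nn-inv n {y} e with nn-total y
  ... | inj₁ p = p
  ... | inj₂ p = ⊥-elim (¬nn-−1 (subst NN (trans (sym (-‿distribʳ-* _ y)) (cong -_ e)) (nn-* (nn-fromℕ (suc n)) p)))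

  -- One half, the contraction ratio below.
  h : Carrier
  h = proj₁ (inv 1)

  h+h : h + h ≡ 1#
  h+h = trans (begin
    h + h                       ≡⟨ cong₂ _+_ (sym (*-identityˡ h)) (sym (*-identityˡ h)) ⟩
    1# * h + 1# * h             ≡⟨ sym (distribʳ h 1# 1#) ⟩
    (1# + 1#) * h               ≡⟨ cong (λ x → (1# + x) * h) (sym (+-identityʳ 1#)) ⟩
    fromℕ 2 * h                 ∎) (proj₂ (inv 1))
    where open ≡-Reasoning

  nn-h : NN h
  nn-h = nn-inv 1 (proj₂ (inv 1))

  double : ∀ x → h * (x + x) ≡ x
  double x = trans (solve 2 (λ h x → h :* (x :+ x) := (h :+ h) :* x) refl h x) (trans (cong (_* x) h+h) (*-identityˡ x))

  nn-half : ∀ {x} → NN (x + x) → NN x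
  nn-half {x} p = subst NN (double x) (nn-* nn-h p)

  hpow : ℕ → Carrier
  hpow zero    = 1#
  hpow (suc n) = h * hpow n

  nn-hpow : ∀ n → NN (hpow n)
  nn-hpow zero    = nn-1
  nn-hpow (suc n) = nn-* nn-h (nn-hpow n)

  hpow-double : ∀ n → hpow (suc n) + hpow (suc n) ≡ hpow n
  hpow-double n = trans (sym (distribʳ (hpow n) h h)) (trans (cong (_* hpow n) h+h) (*-identityˡ _))

  -- The absolute value of `x` is at most `c`, without a case distinction on the sign of `x`.
  Bd : Carrier → Carrier → Set
  Bd x c = NN (c + - x) × NN (c + x)

  bd-+ : ∀ {x y c d} → Bd x c → Bd y d → Bd (x + y) (c + d)
  bd-+ {x} {y} {c} {d} (p , q) (p′ , q′) =
    subst NN (solve 4 (λ x y c d → (c :+ :- x) :+ (d :+ :- y) := (c :+ d) :+ :- (x :+ y)) refl x y c d) (nn-+ p p′) ,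
    subst NN (solve 4 (λ x y c d → (c :+ x) :+ (d :+ y) := (c :+ d) :+ (x :+ y)) refl x y c d) (nn-+ q q′)

  bd-neg : ∀ {x c} → Bd x c → Bd (- x) c
  bd-neg {x} {c} (p , q) = subst NN (cong (c +_) (sym (-‿involutive x))) q , p

  -- The products `(c - x)(d + y)` and `(c + x)(d - y)` are nonnegative and add up to `2(cd - xy)`;
  -- equal signs within each product give the other inequality.
  bd-* : ∀ {x y c d} → Bd x c → Bd y d → Bd (x * y) (c * d)
  bd-* {x} {y} {c} {d} (p , q) (p′ , q′) =
    nn-half (subst NN (solve 4 (λ x y c d → (c :+ :- x) :* (d :+ y) :+ (c :+ x) :* (d :+ :- y) :=
      (c :* d :+ :- (x :* y)) :+ (c :* d :+ :- (x :* y))) refl x y c d) (nn-+ (nn-* p q′) (nn-* q p′))) ,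
    nn-half (subst NN (solve 4 (λ x y c d → (c :+ :- x) :* (d :+ :- y) :+ (c :+ x) :* (d :+ y) :=
      (c :* d :+ x :* y) :+ (c :* d :+ x :* y)) refl x y c d) (nn-+ (nn-* p p′) (nn-* q q′)))

  bd-weaken : ∀ {x c d} → NN (d + - c) → Bd x c → Bd x d
  bd-weaken {x} {c} {d} le (p , q) =
    subst NN (solve 3 (λ x c d → (d :+ :- c) :+ (c :+ :- x) := d :+ :- x) refl x c d) (nn-+ le p) ,
    subst NN (solve 3 (λ x c d → (d :+ :- c) :+ (c :+ x) := d :+ x) refl x c d) (nn-+ le q)

  bd-0 : ∀ {c} → NN c → Bd 0# c
  bd-0 {c} p = subst NN (sym (trans (cong (c +_) -0#≈0#) (+-identityʳ c))) p , subst NN (sym (+-identityʳ c)) p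

  bd-self : ∀ {x} → NN x → Bd x x
  bd-self {x} p = inj₂ (sym (-‿inverseʳ x)) , nn-+ p p

  -- Consequences of completeness: the Archimedean property and limits

  nn-tail : ∀ {x} → NN x → (∀ n → NN (hpow n + - x)) → x ≡ 0#
  nn-tail {x} p small = nn-antisym p nn-neg
    where
    -- the supremum l of the numbers 2ⁿ x satisfies l ≤ h l
    two : ℕ → Carrier
    two zero    = x
    two (suc n) = two n + two n
    two-hpow : ∀ n → hpow n * two n ≡ x
    two-hpow zero    = *-identityˡ x
    two-hpow (suc n) = trans (solve 3 (λ h p t → (h :* p) :* (t :+ t) := p :* (h :* (t :+ t))) refl h (hpow n) (two n))
      (trans (cong (hpow n *_) (double (two n))) (two-hpow n))
    two-bound : ∀ n → NN (1# + - two n)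
    two-bound n = go n 1# refl
      where
      pow2 : ℕ → Carrier
      pow2 zero    = 1#
      pow2 (suc n) = pow2 n + pow2 n
      nn-pow2 : ∀ n → NN (pow2 n)
      nn-pow2 zero    = nn-1
      nn-pow2 (suc n) = nn-+ (nn-pow2 n) (nn-pow2 n)
      pow2-hpow : ∀ n → pow2 n * hpow n ≡ 1#
      pow2-hpow zero    = *-identityˡ 1#
      pow2-hpow (suc n) = trans (solve 3 (λ h p t → (t :+ t) :* (h :* p) := (h :* (t :+ t)) :* p) refl h (hpow n) (pow2 n))
        (trans (cong (_* hpow n) (double (pow2 n))) (pow2-hpow n))
      pow2-x : ∀ n → pow2 n * x ≡ two n
      pow2-x zero    = *-identityˡ x
      pow2-x (suc n) = trans (distribʳ x _ _) (cong₂ _+_ (pow2-x n) (pow2-x n))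
      go : ∀ n o → o ≡ 1# → NN (o + - two n)
      go n o e = subst NN (trans (solve 3 (λ a b x → a :* (b :+ :- x) := a :* b :+ :- (a :* x)) refl (pow2 n) (hpow n) x)
        (cong₂ (λ u v → u + - v) (trans (pow2-hpow n) (sym e)) (pow2-x n))) (nn-* (nn-pow2 n) (small n))
    sup : ∃ λ l → (∀ y → (∃ λ n → y ≡ two n) → y ≤ l) × (∀ u → (∀ y → (∃ λ n → y ≡ two n) → y ≤ u) → l ≤ u)
    sup = lub (λ y → ∃ λ n → y ≡ two n) (x , zero , refl) (1# , λ { y (n , refl) → nn⇒≤ (two-bound n) })
    l = proj₁ sup
    upper : ∀ n → NN (l + - two n)
    upper n = ≤⇒nn (proj₁ (proj₂ sup) (two n) (n , refl))
    l≤hl : NN (h * l + - l)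
    l≤hl = ≤⇒nn (proj₂ (proj₂ sup) (h * l) (λ { y (n , refl) → nn⇒≤ (subst NN
      (trans (solve 3 (λ h l t → h :* (l :+ :- (t :+ t)) := h :* l :+ :- (h :* (t :+ t))) refl h l (two n))
        (cong (λ z → h * l + - z) (double (two n)))) (nn-* nn-h (upper (suc n)))) }))
    nn-neg-hl : NN (- (h * l))
    nn-neg-hl = subst NN (trans (cong (λ z → h * l + - z) (sym (double l)))
      (solve 2 (λ h l → h :* l :+ :- (h :* (l :+ l)) := :- (h :* l)) refl h l)) l≤hl
    nn-neg-hx : NN (- (h * x))
    nn-neg-hx = subst NN (solve 3 (λ h l x → :- (h :* l) :+ h :* (l :+ :- x) := :- (h :* x)) refl h l x)
      (nn-+ nn-neg-hl (nn-* nn-h (upper 0)))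
    nn-neg : NN (- x)
    nn-neg = subst NN (trans (solve 2 (λ h x → :- (h :* x) :+ :- (h :* x) := :- (h :* (x :+ x))) refl h x)
      (cong -_ (double x))) (nn-+ nn-neg-hx nn-neg-hx)

  bd-tail : ∀ {x} → (∀ n → Bd x (hpow n)) → x ≡ 0#
  bd-tail {x} b with nn-total x
  ... | inj₁ p = nn-tail p (λ n → proj₁ (b n))
  ... | inj₂ p = trans (sym (-‿involutive x)) (trans (cong -_ (nn-tail p (λ n → proj₁ (bd-neg (b n))))) -0#≈0#)

  -- The intervals of radius `hpow n` around `x n` are nested: the centre moves by at most
  -- `hpow (suc n)`, which is exactly how much the radius shrinks. The limit is the supremum of the
  -- lower ends.
  limit : (x : ℕ → Carrier) → (∀ n → Bd (x (suc n) + - x n) (hpow (suc n))) →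
    ∃ λ l → ∀ n → Bd (l + - x n) (hpow n)
  limit x step = l , λ n →
    subst NN (solve 3 (λ x p l → (x :+ p) :+ :- l := p :+ :- (l :+ :- x)) refl (x n) (hpow n) l) (≤⇒nn (below n)) ,
    subst NN (solve 3 (λ x p l → l :+ :- (x :+ :- p) := p :+ (l :+ :- x)) refl (x n) (hpow n) l) (≤⇒nn (above n))
    where
    lo hi : ℕ → Carrier
    lo n = x n + - hpow n
    hi n = x n + hpow n
    nn-trans : ∀ {a b c} → NN (b + - a) → NN (c + - b) → NN (c + - a)
    nn-trans {a} {b} {c} p q = subst NN (solve 3 (λ a b c → (b :+ :- a) :+ (c :+ :- b) := c :+ :- a) refl a b c) (nn-+ p q)
    lo-step : ∀ n → NN (lo (suc n) + - lo n)
    lo-step n = subst NN (trans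
      (solve 3 (λ p x y → p :+ (y :+ :- x) := (y :+ :- p) :+ :- (x :+ :- (p :+ p))) refl (hpow (suc n)) (x n) (x (suc n)))
      (cong (λ z → lo (suc n) + - (x n + - z)) (hpow-double n))) (proj₂ (step n))
    hi-step : ∀ n → NN (hi n + - hi (suc n))
    hi-step n = subst NN (trans
      (solve 3 (λ p x y → p :+ :- (y :+ :- x) := (x :+ (p :+ p)) :+ :- (y :+ p)) refl (hpow (suc n)) (x n) (x (suc n)))
      (cong (λ z → (x n + z) + - hi (suc n)) (hpow-double n))) (proj₁ (step n))
    lo-mono : ∀ n k → NN (lo (k ℕ.+ n) + - lo n)
    lo-mono n zero    = inj₂ (sym (-‿inverseʳ _))
    lo-mono n (suc k) = nn-trans (lo-mono n k) (lo-step (k ℕ.+ n))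
    hi-mono : ∀ n k → NN (hi n + - hi (k ℕ.+ n))
    hi-mono n zero    = inj₂ (sym (-‿inverseʳ _))
    hi-mono n (suc k) = nn-trans (hi-step (k ℕ.+ n)) (hi-mono n k)
    lo≤hi : ∀ n → NN (hi n + - lo n)
    lo≤hi n = subst NN (solve 2 (λ x p → p :+ p := (x :+ p) :+ :- (x :+ :- p)) refl (x n) (hpow n)) (nn-+ (nn-hpow n) (nn-hpow n))
    cross : ∀ m n → lo n ≤ hi m
    cross m n with ℕ.≤-total m n
    ... | inj₁ le = nn⇒≤ (subst (λ z → NN (hi m + - lo z)) (ℕ.m∸n+n≡m le)
                      (nn-trans (lo≤hi ((n ℕ.∸ m) ℕ.+ m)) (hi-mono m (n ℕ.∸ m))))
    ... | inj₂ le = nn⇒≤ (nn-trans (subst (λ z → NN (lo z + - lo n)) (ℕ.m∸n+n≡m le) (lo-mono n (m ℕ.∸ n))) (lo≤hi m))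
    sup = lub (λ y → ∃ λ n → y ≡ lo n) (lo 0 , 0 , refl) (hi 0 , λ { y (n , refl) → cross 0 n })
    l = proj₁ sup
    above : ∀ n → lo n ≤ l
    above n = proj₁ (proj₂ sup) (lo n) (n , refl)
    below : ∀ n → l ≤ hi n
    below n = proj₂ (proj₂ sup) (hi n) (λ { y (m , refl) → cross n m })

-- Exact polynomial arithmetic over the Gaussian integers

Gaussian : Set
Gaussian = ℤ × ℤ

infixl 6 _+ᴳ_
infixl 7 _*ᴳ_
_+ᴳ_ _*ᴳ_ : Gaussian → Gaussian → Gaussian
(a , b) +ᴳ (c , d) = (a ℤ.+ c , b ℤ.+ d)
(a , b) *ᴳ (c , d) = (a ℤ.* c ℤ.+ ℤ.- (b ℤ.* d) , a ℤ.* d ℤ.+ b ℤ.* c)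

negᴳ : Gaussian → Gaussian
negᴳ (a , b) = (ℤ.- a , ℤ.- b)

realᴳ : ℤ → Gaussian
realᴳ x = (x , 0ℤ)

infixl 6 _⊞_
_⊞_ : List Gaussian → List Gaussian → List Gaussian
[]       ⊞ ys       = ys
(x ∷ xs) ⊞ []       = x ∷ xs
(x ∷ xs) ⊞ (y ∷ ys) = (x +ᴳ y) ∷ (xs ⊞ ys)

scale : Gaussian → List Gaussian → List Gaussian
scale c = map (c *ᴳ_)

-- coefficients of p(a + w) as a polynomial in w
taylor : Gaussian → List Gaussian → List Gaussian
taylor a []       = []
taylor a (c ∷ cs) = step (taylor a cs)
  where
  step : List Gaussian → List Gaussian
  -- One Horner step, `c + (w + a) q(w)`.
  step q = (c ∷ q) ⊞ scale a q

-- coefficients of D^(deg p) p(y / D) as a polynomial in y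
rescale : ℤ → List ℤ → List ℤ
rescale D []       = []
rescale D (p ∷ ps) = p ℤ.* D ℤ.^ length ps ∷ rescale D ps

normᴳ : Gaussian → ℕ
normᴳ (a , b) = ℤ.∣ a ∣ ℕ.+ ℤ.∣ b ∣

-- bounds for the values and the Lipschitz constant on the box |Re w|, |Im w| ≤ 1; a product
-- of complex numbers can have twice the product of the sup norms
bound lipschitz : List Gaussian → ℕ
bound []       = 0
bound (c ∷ cs) = normᴳ c ℕ.+ 2 ℕ.* bound cs
lipschitz []       = 0
lipschitz (c ∷ cs) = 2 ℕ.* bound cs ℕ.+ 2 ℕ.* lipschitz cs

-- Complex numbers, evaluation and sup norm estimates

module Plane (R : CompleteOrderedField) where
  open CompleteOrderedField R
  open Complex R
  open Field R

  0ℂ 1ℂ : ℂ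
  0ℂ = (0# , 0#)
  1ℂ = (1# , 0#)

  -ℂ_ : ℂ → ℂ
  -ℂ (a , b) = (- a , - b)

  ringℂ : CommutativeRing _ _
  ringℂ = record
    { Carrier = ℂ ; _≈_ = _≡_ ; _+_ = _+ℂ_ ; _*_ = _*ℂ_ ; -_ = -ℂ_ ; 0# = 0ℂ ; 1# = 1ℂ
    ; isCommutativeRing = record
      { isRing = record
        { +-isAbelianGroup = record
          { isGroup = record
            { isMonoid = record
              { isSemigroup = record
                { isMagma = record { isEquivalence = isEquivalence ; ∙-cong = cong₂ _+ℂ_ }
                ; assoc = λ (a , b) (c , d) (e , f) → cong₂ _,_ (+-assoc a c e) (+-assoc b d f) }
              ; identity = (λ (a , b) → cong₂ _,_ (+-identityˡ a) (+-identityˡ b)) ,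
                           (λ (a , b) → cong₂ _,_ (+-identityʳ a) (+-identityʳ b)) }
            ; inverse = (λ (a , b) → cong₂ _,_ (-‿inverseˡ a) (-‿inverseˡ b)) ,
                        (λ (a , b) → cong₂ _,_ (-‿inverseʳ a) (-‿inverseʳ b))
            ; ⁻¹-cong = cong -ℂ_ }
          ; comm = λ (a , b) (c , d) → cong₂ _,_ (+-comm a c) (+-comm b d) }
        ; *-cong = cong₂ _*ℂ_
        ; *-assoc = λ (a , b) (c , d) (e , f) → cong₂ _,_
            (solve 6 (λ a b c d e f → (a :* c :+ :- (b :* d)) :* e :+ :- ((a :* d :+ b :* c) :* f) :=
              a :* (c :* e :+ :- (d :* f)) :+ :- (b :* (c :* f :+ d :* e))) refl a b c d e f)
            (solve 6 (λ a b c d e f → (a :* c :+ :- (b :* d)) :* f :+ (a :* d :+ b :* c) :* e :=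
              a :* (c :* f :+ d :* e) :+ b :* (c :* e :+ :- (d :* f))) refl a b c d e f)
        ; *-identity = *-identityˡℂ , λ z → trans (*-commℂ z 1ℂ) (*-identityˡℂ z)
        ; distrib = (λ x y z → trans (*-commℂ x _) (trans (distribʳℂ x y z) (cong₂ _+ℂ_ (*-commℂ y x) (*-commℂ z x)))) , distribʳℂ }
      ; *-comm = *-commℂ } }
    where
    *-commℂ : ∀ z w → z *ℂ w ≡ w *ℂ z
    *-commℂ (a , b) (c , d) = cong₂ _,_
      (solve 4 (λ a b c d → a :* c :+ :- (b :* d) := c :* a :+ :- (d :* b)) refl a b c d)
      (solve 4 (λ a b c d → a :* d :+ b :* c := c :* b :+ d :* a) refl a b c d)
    *-identityˡℂ : ∀ z → 1ℂ *ℂ z ≡ z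
    *-identityˡℂ (a , b) = cong₂ _,_
      (trans (cong₂ (λ x y → x + - y) (*-identityˡ a) (zeroˡ b)) (trans (cong (a +_) -0#≈0#) (+-identityʳ a)))
      (trans (cong₂ _+_ (*-identityˡ b) (zeroˡ a)) (+-identityʳ b))
    distribʳℂ : ∀ x y z → (y +ℂ z) *ℂ x ≡ (y *ℂ x) +ℂ (z *ℂ x)
    distribʳℂ (a , b) (c , d) (e , f) = cong₂ _,_
      (solve 6 (λ a b c d e f → (c :+ e) :* a :+ :- ((d :+ f) :* b) :=
        (c :* a :+ :- (d :* b)) :+ (e :* a :+ :- (f :* b))) refl a b c d e f)
      (solve 6 (λ a b c d e f → (c :+ e) :* b :+ (d :+ f) :* a :=
        (c :* b :+ d :* a) :+ (e :* b :+ f :* a)) refl a b c d e f)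

  module ℂ = CommutativeRing ringℂ

  fromGaussian : Gaussian → ℂ
  fromGaussian (a , b) = (fromℤ a , fromℤ b)

  real : Carrier → ℂ
  real x = (x , 0#)

  real-+ : ∀ x y → real (x + y) ≡ real x +ℂ real y
  real-+ x y = cong (x + y ,_) (sym (+-identityˡ 0#))

  real-* : ∀ x y → real (x * y) ≡ real x *ℂ real y
  real-* x y = cong₂ _,_
    (sym (trans (cong (λ z → x * y + - z) (zeroˡ 0#)) (trans (cong (x * y +_) -0#≈0#) (+-identityʳ _))))
    (sym (trans (cong₂ _+_ (zeroʳ x) (zeroˡ y)) (+-identityˡ 0#)))

  acrℂ : AlmostCommutativeRing _ _
  acrℂ = fromCommutativeRing ringℂ

  ℤ⟶ℂ : ℤ.+-*-rawRing -Raw-AlmostCommutative⟶ acrℂ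
  ℤ⟶ℂ = record
    { ⟦_⟧ = λ i → real (fromℤ i)
    ; +-homo = λ i j → trans (cong real (fromℤ-+ i j)) (real-+ (fromℤ i) (fromℤ j))
    ; *-homo = λ i j → trans (cong real (fromℤ-* i j)) (real-* (fromℤ i) (fromℤ j))
    ; -‿homo = λ i → cong₂ _,_ (fromℤ-neg i) (sym -0#≈0#)
    ; 0-homo = refl ; 1-homo = cong real (+-identityʳ 1#) }

  module Solverℂ = Algebra.Solver.Ring ℤ.+-*-rawRing acrℂ ℤ⟶ℂ
    (λ i j → Maybe.map (cong (λ i → real (fromℤ i))) (dec⇒maybe (i ℤ.≟ j)))

  fromGaussian-+ : ∀ g h → fromGaussian (g +ᴳ h) ≡ fromGaussian g +ℂ fromGaussian h
  fromGaussian-+ (a , b) (c , d) = cong₂ _,_ (fromℤ-+ a c) (fromℤ-+ b d)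

  fromGaussian-* : ∀ g h → fromGaussian (g *ᴳ h) ≡ fromGaussian g *ℂ fromGaussian h
  fromGaussian-* (a , b) (c , d) = cong₂ _,_
    (trans (fromℤ-+ (a ℤ.* c) _) (cong₂ _+_ (fromℤ-* a c) (trans (fromℤ-neg (b ℤ.* d)) (cong -_ (fromℤ-* b d)))))
    (trans (fromℤ-+ (a ℤ.* d) _) (cong₂ _+_ (fromℤ-* a d) (fromℤ-* b c)))

  fromGaussian-neg : ∀ g → fromGaussian (negᴳ g) ≡ -ℂ fromGaussian g
  fromGaussian-neg (a , b) = cong₂ _,_ (fromℤ-neg a) (fromℤ-neg b)

  horner : List Gaussian → ℂ → ℂ
  horner []       w = 0ℂ
  horner (c ∷ cs) w = fromGaussian c +ℂ (w *ℂ horner cs w)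

  horner-⊞ : ∀ xs ys w → horner (xs ⊞ ys) w ≡ horner xs w +ℂ horner ys w
  horner-⊞ []       ys       w = sym (ℂ.+-identityˡ _)
  horner-⊞ (x ∷ xs) []       w = sym (ℂ.+-identityʳ _)
  horner-⊞ (x ∷ xs) (y ∷ ys) w = trans
    (cong₂ (λ u v → u +ℂ (w *ℂ v)) (fromGaussian-+ x y) (horner-⊞ xs ys w))
    (S.solve 5 (λ x y w u v → (x S.:+ y) S.:+ w S.:* (u S.:+ v) S.:= (x S.:+ w S.:* u) S.:+ (y S.:+ w S.:* v)) refl
      (fromGaussian x) (fromGaussian y) w (horner xs w) (horner ys w))
    where module S = Solverℂ

  horner-scale : ∀ c xs w → horner (scale c xs) w ≡ fromGaussian c *ℂ horner xs w
  horner-scale c []       w = sym (ℂ.zeroʳ (fromGaussian c))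
  horner-scale c (x ∷ xs) w = trans
    (cong₂ (λ u v → u +ℂ (w *ℂ v)) (fromGaussian-* c x) (horner-scale c xs w))
    (S.solve 4 (λ c x w u → c S.:* x S.:+ w S.:* (c S.:* u) S.:= c S.:* (x S.:+ w S.:* u)) refl
      (fromGaussian c) (fromGaussian x) w (horner xs w))
    where module S = Solverℂ

  horner-neg : ∀ xs w → horner (map negᴳ xs) w ≡ -ℂ horner xs w
  horner-neg []       w = sym (cong₂ _,_ -0#≈0# -0#≈0#)
  horner-neg (x ∷ xs) w = trans
    (cong₂ (λ u v → u +ℂ (w *ℂ v)) (fromGaussian-neg x) (horner-neg xs w))
    (S.solve 3 (λ x w u → (S.:- x) S.:+ w S.:* (S.:- u) S.:= S.:- (x S.:+ w S.:* u)) refl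
      (fromGaussian x) w (horner xs w))
    where module S = Solverℂ

  horner-taylor : ∀ a cs w → horner (taylor a cs) w ≡ horner cs (fromGaussian a +ℂ w)
  horner-taylor a []       w = refl
  horner-taylor a (c ∷ cs) w = trans (horner-⊞ (c ∷ taylor a cs) (scale a (taylor a cs)) w)
    (trans (cong (horner (c ∷ taylor a cs) w +ℂ_) (horner-scale a (taylor a cs) w))
    (trans (cong (λ u → (fromGaussian c +ℂ (w *ℂ u)) +ℂ (fromGaussian a *ℂ u)) (horner-taylor a cs w))
    (S.solve 4 (λ c w a u → (c S.:+ w S.:* u) S.:+ a S.:* u S.:= c S.:+ (a S.:+ w) S.:* u) refl
      (fromGaussian c) w (fromGaussian a) (horner cs (fromGaussian a +ℂ w)))))
    where module S = Solverℂ

  infixr 8 _^ℂ_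
  _^ℂ_ : ℂ → ℕ → ℂ
  z ^ℂ zero  = 1ℂ
  z ^ℂ suc n = z *ℂ (z ^ℂ n)

  real-^ : ∀ D n → real (fromℤ (D ℤ.^ n)) ≡ real (fromℤ D) ^ℂ n
  real-^ D zero    = cong real (+-identityʳ 1#)
  real-^ D (suc n) = trans (cong real (fromℤ-* D (D ℤ.^ n)))
    (trans (real-* (fromℤ D) _) (cong (real (fromℤ D) *ℂ_) (real-^ D n)))

  -- The length of `ps` exceeds the degree by one, hence the extra factor `d` on the left. This form
  -- also covers the empty list.
  horner-rescale : ∀ D ps z → let d = real (fromℤ D) in
    horner (map realᴳ (rescale D ps)) (z *ℂ d) *ℂ d ≡ (d ^ℂ length ps) *ℂ horner (map realᴳ ps) z
  horner-rescale D []       z = trans (ℂ.zeroˡ _) (sym (ℂ.zeroʳ _))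
  horner-rescale D (p ∷ ps) z = trans (cong (λ x → (x +ℂ ((z *ℂ d) *ℂ u)) *ℂ d)
      (trans (cong real (fromℤ-* p (D ℤ.^ length ps))) (trans (real-* (fromℤ p) _) (cong (real (fromℤ p) *ℂ_) (real-^ D (length ps))))))
    (trans (S.solve 5 (λ p e z d u → (p S.:* e S.:+ (z S.:* d) S.:* u) S.:* d S.:= d S.:* (p S.:* e) S.:+ (z S.:* d) S.:* (u S.:* d)) refl
      (real (fromℤ p)) e z d u)
    (trans (cong (λ x → (d *ℂ (real (fromℤ p) *ℂ e)) +ℂ ((z *ℂ d) *ℂ x)) (horner-rescale D ps z))
    (S.solve 5 (λ p e z d u → d S.:* (p S.:* e) S.:+ (z S.:* d) S.:* (e S.:* u) S.:= (d S.:* e) S.:* (p S.:+ z S.:* u)) refl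
      (real (fromℤ p)) e z d (horner (map realᴳ ps) z))))
    where
    module S = Solverℂ
    d = real (fromℤ D)
    e = d ^ℂ length ps
    u = horner (map realᴳ (rescale D ps)) (z *ℂ d)

  -- bounds in the sup norm
  Bdℂ : ℂ → Carrier → Set
  Bdℂ (a , b) c = Bd a c × Bd b c

  bdℂ-+ : ∀ {z w c d} → Bdℂ z c → Bdℂ w d → Bdℂ (z +ℂ w) (c + d)
  bdℂ-+ (p , q) (p′ , q′) = bd-+ p p′ , bd-+ q q′

  bdℂ-* : ∀ {z w c d} → Bdℂ z c → Bdℂ w d → Bdℂ (z *ℂ w) (c * d + c * d)
  bdℂ-* (p , q) (p′ , q′) = bd-+ (bd-* p p′) (bd-neg (bd-* q q′)) , bd-+ (bd-* p q′) (bd-* q p′)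

  bdℂ-weaken : ∀ {z c d} → NN (d + - c) → Bdℂ z c → Bdℂ z d
  bdℂ-weaken le (p , q) = bd-weaken le p , bd-weaken le q

  bd-fromℤ : ∀ i → Bd (fromℤ i) (fromℕ ℤ.∣ i ∣)
  bd-fromℤ (ℤ.+ n)    = bd-self (nn-fromℕ n)
  bd-fromℤ ℤ.-[1+ n ] = bd-neg (bd-self (nn-fromℕ (suc n)))

  bdℂ-fromGaussian : ∀ g → Bdℂ (fromGaussian g) (fromℕ (normᴳ g))
  bdℂ-fromGaussian (a , b) = bd-weaken (nn-fromℕ-∸ (ℕ.m≤m+n ℤ.∣ a ∣ ℤ.∣ b ∣)) (bd-fromℤ a) ,
                             bd-weaken (nn-fromℕ-∸ (ℕ.m≤n+m ℤ.∣ b ∣ ℤ.∣ a ∣)) (bd-fromℤ b)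

  fromℕ-double : ∀ n → fromℕ (2 ℕ.* n) ≡ fromℕ n + fromℕ n
  fromℕ-double n = trans (cong (λ x → fromℕ (n ℕ.+ x)) (ℕ.+-identityʳ n)) (fromℕ-+ n n)

  bdℂ-horner : ∀ cs {w} → Bdℂ w 1# → Bdℂ (horner cs w) (fromℕ (bound cs))
  bdℂ-horner []       b = bd-0 (inj₂ refl) , bd-0 (inj₂ refl)
  bdℂ-horner (c ∷ cs) b = subst (Bdℂ _) (sym (trans (fromℕ-+ (normᴳ c) _) (cong (fromℕ (normᴳ c) +_)
      (trans (fromℕ-double (bound cs)) (sym (cong₂ _+_ (*-identityˡ _) (*-identityˡ _)))))))
    (bdℂ-+ (bdℂ-fromGaussian c) (bdℂ-* b (bdℂ-horner cs b)))

  -- Product rule: `w p(w) - v p(v) = (w - v) p(w) + v (p(w) - p(v))`, with `bound` for the first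
  -- summand and induction for the second.
  bdℂ-lipschitz : ∀ cs {w v e} → Bdℂ w 1# → Bdℂ v 1# → Bdℂ (w +ℂ (-ℂ v)) e →
    Bdℂ (horner cs w +ℂ (-ℂ horner cs v)) (fromℕ (lipschitz cs) * e)
  bdℂ-lipschitz [] {e = e} bw bv be = subst (λ z → Bdℂ z (0# * e)) (sym (ℂ.-‿inverseʳ 0ℂ))
    (subst (Bdℂ 0ℂ) (sym (zeroˡ e)) (bd-0 (inj₂ refl) , bd-0 (inj₂ refl)))
  bdℂ-lipschitz (c ∷ cs) {w} {v} {e} bw bv be =
    subst₂ Bdℂ
      (S.solve 5 (λ c w v p q → (w S.:+ (S.:- v)) S.:* p S.:+ v S.:* (p S.:+ (S.:- q)) S.:=
        (c S.:+ w S.:* p) S.:+ (S.:- (c S.:+ v S.:* q))) refl (fromGaussian c) w v (horner cs w) (horner cs v))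
      (trans (cong (λ x → (e * m + e * m) + (x + x)) (*-identityˡ (l * e)))
        (trans (solve 3 (λ e m l → (e :* m :+ e :* m) :+ (l :* e :+ l :* e) := ((m :+ m) :+ (l :+ l)) :* e) refl e m l)
          (cong (_* e) (sym (trans (fromℕ-+ (2 ℕ.* bound cs) _) (cong₂ _+_ (fromℕ-double (bound cs)) (fromℕ-double (lipschitz cs))))))))
      (bdℂ-+ (bdℂ-* be (bdℂ-horner cs bw)) (bdℂ-* bv (bdℂ-lipschitz cs bw bv be)))
    where
    module S = Solverℂ
    m = fromℕ (bound cs)
    l = fromℕ (lipschitz cs)

  -- Banach's fixed point theorem for w ↦ horner cs w / (N + 1) on the unit box
  module Contraction (N : ℕ) (cs : List Gaussian)
    (small : 2 ℕ.* bound cs ℕ.≤ suc N) (contracts : 2 ℕ.* lipschitz cs ℕ.≤ suc N) where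

    ν : Carrier
    ν = proj₁ (inv N)

    Nν : fromℕ (suc N) * ν ≡ 1#
    Nν = proj₂ (inv N)

    nn-ν : NN ν
    nn-ν = nn-inv N Nν

    -- Division by `N + 1` turns a factor `A` into at most one half as soon as `2A` is at most
    -- `N + 1`. It serves both for the size of the image and for the contraction.
    bd-ν : ∀ A {x e} → 2 ℕ.* A ℕ.≤ suc N → NN e → Bd x (fromℕ A * e) → Bd (ν * x) (h * e)
    bd-ν A {x} {e} le pe b = bd-weaken (subst NN eq (nn-* (nn-* nn-ν nn-h) (nn-* (nn-fromℕ-∸ le) pe)))
      (bd-* (bd-self nn-ν) b)
      where
      a = fromℕ A
      eq : (ν * h) * ((fromℕ (suc N) + - fromℕ (2 ℕ.* A)) * e) ≡ h * e + - (ν * (a * e))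
      eq = trans (cong (λ z → (ν * h) * ((fromℕ (suc N) + - z) * e)) (fromℕ-double A))
        (trans (solve 5 (λ v h n a e → (v :* h) :* ((n :+ :- (a :+ a)) :* e) :=
            (n :* v) :* (h :* e) :+ :- (h :* ((v :* (a :* e)) :+ (v :* (a :* e))))) refl ν h (fromℕ (suc N)) a e)
          (cong₂ (λ y z → y + - z) (trans (cong (_* (h * e)) Nν) (*-identityˡ _)) (double (ν * (a * e)))))

    Φ : ℂ → ℂ
    Φ w = (ν * proj₁ (horner cs w) , ν * proj₂ (horner cs w))

    Φ-bound : ∀ {w} → Bdℂ w 1# → Bdℂ (Φ w) h
    Φ-bound b with p , q ← bdℂ-horner cs b = at p , at q
      where
      at : ∀ {x} → Bd x (fromℕ (bound cs)) → Bd (ν * x) h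
      at {x} b = subst (Bd (ν * x)) (*-identityʳ h) (bd-ν (bound cs) small nn-1 (subst (Bd x) (sym (*-identityʳ _)) b))

    Φ-contracts : ∀ {w v e} → NN e → Bdℂ w 1# → Bdℂ v 1# → Bdℂ (w +ℂ (-ℂ v)) e → Bdℂ (Φ w +ℂ (-ℂ Φ v)) (h * e)
    Φ-contracts {w} {v} {e} pe bw bv be with p , q ← bdℂ-lipschitz cs bw bv be = at p , at q
      where
      at : ∀ {x y} → Bd (x + - y) (fromℕ (lipschitz cs) * e) → Bd (ν * x + - (ν * y)) (h * e)
      at {x} {y} b = subst (λ z → Bd z (h * e)) (solve 3 (λ n x y → n :* (x :+ :- y) := n :* x :+ :- (n :* y)) refl ν x y)
        (bd-ν (lipschitz cs) contracts pe b)

    h≤1 : NN (1# + - h)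
    h≤1 = subst NN (trans (solve 1 (λ h → h := (h :+ h) :+ :- h) refl h) (cong (_+ - h) h+h)) nn-h

    iterate : ℕ → ℂ
    iterate zero    = 0ℂ
    iterate (suc n) = Φ (iterate n)

    iterate-bound : ∀ n → Bdℂ (iterate n) 1#
    iterate-bound zero    = bd-0 nn-1 , bd-0 nn-1
    iterate-bound (suc n) = bdℂ-weaken h≤1 (Φ-bound (iterate-bound n))

    iterate-step : ∀ n → Bdℂ (iterate (suc n) +ℂ (-ℂ iterate n)) (hpow (suc n))
    iterate-step zero    = subst₂ Bdℂ (sym (trans (cong (Φ 0ℂ +ℂ_) (cong₂ _,_ -0#≈0# -0#≈0#)) (ℂ.+-identityʳ _)))
      (sym (*-identityʳ h)) (Φ-bound (iterate-bound 0))
    iterate-step (suc n) = Φ-contracts (nn-hpow (suc n)) (iterate-bound (suc n)) (iterate-bound n) (iterate-step n)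

    limit-re = limit (λ n → proj₁ (iterate n)) (λ n → proj₁ (iterate-step n))
    limit-im = limit (λ n → proj₂ (iterate n)) (λ n → proj₂ (iterate-step n))

    fixed : ℂ
    fixed = (proj₁ limit-re , proj₁ limit-im)

    fixed-near : ∀ n → Bdℂ (fixed +ℂ (-ℂ iterate n)) (hpow n)
    fixed-near n = proj₂ limit-re n , proj₂ limit-im n

    fixed-bound : Bdℂ fixed 1#
    fixed-bound = subst (λ z → Bdℂ z 1#) (trans (cong (fixed +ℂ_) (cong₂ _,_ -0#≈0# -0#≈0#)) (ℂ.+-identityʳ _)) (fixed-near 0)

    -- `Φ fixed` and `fixed` both lie within `hpow (suc n)` of `iterate (suc n)`. As `n` is
    -- arbitrary, `bd-tail` makes them equal.
    Φ-fixed-near : ∀ n → Bdℂ (Φ fixed +ℂ (-ℂ fixed)) (hpow n)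
    Φ-fixed-near n = subst₂ Bdℂ
      (S.solve 3 (λ a b c → (a S.:+ (S.:- b)) S.:+ (S.:- (c S.:+ (S.:- b))) S.:= a S.:+ (S.:- c)) refl (Φ fixed) (iterate (suc n)) fixed)
      (hpow-double n)
      (bdℂ-+ (Φ-contracts (nn-hpow n) fixed-bound (iterate-bound n) (fixed-near n)) (negate (fixed-near (suc n))))
      where
      module S = Solverℂ
      negate : ∀ {z c} → Bdℂ z c → Bdℂ (-ℂ z) c
      negate (p , q) = bd-neg p , bd-neg q

    fixed-equation : real (fromℕ (suc N)) *ℂ fixed ≡ horner cs fixed
    fixed-equation = cong₂ _,_
      (trans (trans (cong (λ z → fromℕ (suc N) * x + - z) (zeroˡ y)) (trans (cong (fromℕ (suc N) * x +_) -0#≈0#) (+-identityʳ _)))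
        (at (bd-tail (λ n → proj₁ (Φ-fixed-near n)))))
      (trans (trans (cong (fromℕ (suc N) * y +_) (zeroˡ x)) (+-identityʳ _)) (at (bd-tail (λ n → proj₂ (Φ-fixed-near n)))))
      where
      x = proj₁ fixed
      y = proj₂ fixed
      at : ∀ {x u} → ν * u + - x ≡ 0# → fromℕ (suc N) * x ≡ u
      at {x} {u} e = trans (cong (fromℕ (suc N) *_) (trans (solve 2 (λ x v → x := v :+ :- (v :+ :- x)) refl x (ν * u))
          (trans (cong (λ z → ν * u + - z) e) (trans (cong (ν * u +_) -0#≈0#) (+-identityʳ _)))))
        (trans (sym (*-assoc _ ν u)) (trans (cong (_* u) Nν) (*-identityˡ u)))

-- The Newton step and the nonreal root

conjᴳ : Gaussian → Gaussian
conjᴳ (a , b) = (a , ℤ.- b)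

constantTerm linearTerm : List Gaussian → Gaussian
constantTerm []      = realᴳ 0ℤ
constantTerm (c ∷ _) = c
linearTerm (_ ∷ c ∷ _) = c
linearTerm _           = realᴳ 0ℤ

quadraticTail : List Gaussian → List Gaussian
quadraticTail (_ ∷ _ ∷ cs) = cs
quadraticTail _            = []

-- The equation c₀ + c₁ w + w² r(w) = 0, multiplied by κ with κ c₁ = N, reads N w = newtonStep κ cs.
newtonStep : Gaussian → List Gaussian → List Gaussian
newtonStep κ cs = map negᴳ (κ *ᴳ constantTerm cs ∷ realᴳ 0ℤ ∷ scale κ (quadraticTail cs))

coeffList : ℕ → Poly → List ℤ
coeffList zero    p = p 0 ∷ []
coeffList (suc N) p = p 0 ∷ coeffList N (λ j → p (suc j))

coeffList-cong : ∀ N {p q : Poly} → (∀ j → p j ≡ q j) → coeffList N p ≡ coeffList N q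
coeffList-cong zero    e = cong (_∷ []) (e 0)
coeffList-cong (suc N) e = cong₂ _∷_ (e 0) (coeffList-cong N (λ j → e (suc j)))

module Roots (R : CompleteOrderedField) where
  open CompleteOrderedField R
  open Complex R
  open Field R
  open Plane R

  -- `evalℂ` splits off the leading term whereas `horner` splits off the constant one; this passes
  -- from one to the other.
  evalℂ-suc : ∀ N p z → evalℂ (suc N) p z ≡ real (fromℤ (p 0)) +ℂ (z *ℂ evalℂ N (λ j → p (suc j)) z)
  evalℂ-suc zero    p z = S.solve 4 (λ a b z o → a S.:* o S.:+ b S.:* (z S.:* o) S.:= a S.:* o S.:+ z S.:* (b S.:* o)) refl
      (real (fromℤ (p 0))) (real (fromℤ (p 1))) z 1ℂ
    ∙ cong (_+ℂ (z *ℂ evalℂ 0 (λ j → p (suc j)) z)) (ℂ.*-identityʳ _)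
    where
    module S = Solverℂ
    infixl 5 _∙_
    _∙_ = trans
  evalℂ-suc (suc N) p z = trans (cong (_+ℂ (c *ℂ (z *ℂ y))) (evalℂ-suc N p z))
    (S.solve 5 (λ a z u c y → (a S.:+ z S.:* u) S.:+ c S.:* (z S.:* y) S.:= a S.:+ z S.:* (u S.:+ c S.:* y)) refl
      (real (fromℤ (p 0))) z (evalℂ N (λ j → p (suc j)) z) c y)
    where
    module S = Solverℂ
    c = real (fromℤ (p (suc (suc N))))
    y = powℂ z (suc N)

  evalℂ-horner : ∀ N p z → evalℂ N p z ≡ horner (map realᴳ (coeffList N p)) z
  evalℂ-horner zero    p z = trans (ℂ.*-identityʳ _) (sym (trans (cong (real (fromℤ (p 0)) +ℂ_) (ℂ.zeroʳ z)) (ℂ.+-identityʳ _)))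
  evalℂ-horner (suc N) p z = trans (evalℂ-suc N p z)
    (cong (λ u → real (fromℤ (p 0)) +ℂ (z *ℂ u)) (evalℂ-horner N (λ j → p (suc j)) z))

  cancelℂ : ∀ c {u v} → v *ℂ c ≡ 1ℂ → c *ℂ u ≡ 0ℂ → u ≡ 0ℂ
  cancelℂ c {u} {v} inv e = trans (sym (trans (cong (_*ℂ u) inv) (ℂ.*-identityˡ u)))
    (trans (ℂ.*-assoc v c u) (trans (cong (v *ℂ_) e) (ℂ.zeroʳ v)))

  cancel-^ : ∀ n c {u v} → v *ℂ c ≡ 1ℂ → (c ^ℂ n) *ℂ u ≡ 0ℂ → u ≡ 0ℂ
  cancel-^ zero    c {u} inv e = trans (sym (ℂ.*-identityˡ u)) e
  cancel-^ (suc n) c {u} inv e = cancel-^ n c inv (cancelℂ c inv (trans (sym (ℂ.*-assoc c (c ^ℂ n) u)) e))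

  -- The root is `(α + w) / (D + 1)` with `w` the fixed point of the Newton step in the unit box.
  -- The imaginary part of `α` is at least 2, and `w` changes it by at most 1, so it stays positive.
  nonreal-root : (ps : List ℤ) (D m : ℕ) (a : ℤ) (κ : Gaussian) (N : ℕ) →
    let cs = taylor (a , ℤ.+ suc (suc m)) (map realᴳ (rescale (ℤ.+ suc D) ps)) in
    cs ≡ constantTerm cs ∷ linearTerm cs ∷ quadraticTail cs →
    κ *ᴳ linearTerm cs ≡ realᴳ (ℤ.+ suc N) →
    T (2 ℕ.* bound (newtonStep κ cs) ℕ.≤ᵇ suc N) → T (2 ℕ.* lipschitz (newtonStep κ cs) ℕ.≤ᵇ suc N) →
    ∃ λ x → ∃ λ y → horner (map realᴳ ps) (x , y) ≡ 0ℂ × y ≢ 0#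
  nonreal-root ps D m a κ N shape κc₁ small contracts = proj₁ z , proj₂ z , root , imaginary
    where
    module S = Solverℂ
    d = real (fromℕ (suc D))
    δ = real (proj₁ (inv D))
    δd : δ *ℂ d ≡ 1ℂ
    δd = trans (sym (real-* (proj₁ (inv D)) (fromℕ (suc D)))) (cong real (trans (*-comm (proj₁ (inv D)) _) (proj₂ (inv D))))
    α : Gaussian
    α = (a , ℤ.+ suc (suc m))
    cs = taylor α (map realᴳ (rescale (ℤ.+ suc D) ps))
    open Contraction N (newtonStep κ cs) (ℕ.≤ᵇ⇒≤ _ _ small) (ℕ.≤ᵇ⇒≤ _ _ contracts) using (fixed; fixed-bound; fixed-equation; ν; Nν)
    w = fixed
    z = (fromGaussian α +ℂ w) *ℂ δ
    zd : z *ℂ d ≡ fromGaussian α +ℂ w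
    zd = trans (ℂ.*-assoc _ δ d) (trans (cong ((fromGaussian α +ℂ w) *ℂ_) δd) (ℂ.*-identityʳ _))
    n k : ℂ
    n = real (fromℕ (suc N))
    k = fromGaussian κ
    c₀ = fromGaussian (constantTerm cs)
    c₁ = fromGaussian (linearTerm cs)
    r = horner (quadraticTail cs) w
    kc₁ : k *ℂ c₁ ≡ n
    kc₁ = trans (sym (fromGaussian-* κ (linearTerm cs))) (cong fromGaussian κc₁)
    step≡ : n *ℂ w ≡ -ℂ ((k *ℂ c₀) +ℂ (w *ℂ (0ℂ +ℂ (w *ℂ (k *ℂ r)))))
    step≡ = trans fixed-equation (trans (horner-neg (κ *ᴳ constantTerm cs ∷ realᴳ 0ℤ ∷ scale κ (quadraticTail cs)) w)
      (cong -ℂ_ (cong₂ (λ u v → u +ℂ (w *ℂ (0ℂ +ℂ (w *ℂ v)))) (fromGaussian-* κ (constantTerm cs)) (horner-scale κ (quadraticTail cs) w))))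
    scaled : k *ℂ (c₀ +ℂ (w *ℂ (c₁ +ℂ (w *ℂ r)))) ≡ 0ℂ
    scaled = trans (S.solve 5 (λ k c₀ c₁ w r → k S.:* (c₀ S.:+ w S.:* (c₁ S.:+ w S.:* r)) S.:=
        (k S.:* c₁) S.:* w S.:+ (k S.:* c₀ S.:+ w S.:* (S.con 0ℤ S.:+ w S.:* (k S.:* r)))) refl k c₀ c₁ w r)
      (trans (cong (λ u → (u *ℂ w) +ℂ rest) kc₁) (trans (cong (_+ℂ rest) step≡) (ℂ.-‿inverseˡ rest)))
      where
      rest = (k *ℂ c₀) +ℂ (w *ℂ (0ℂ +ℂ (w *ℂ (k *ℂ r))))
    -- The multiplier is invertible because its product with the linear coefficient is the nonzero
    -- integer `N + 1`.
    inverse-k : (real ν *ℂ c₁) *ℂ k ≡ 1ℂ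
    inverse-k = trans (S.solve 3 (λ v c k → (v S.:* c) S.:* k S.:= (k S.:* c) S.:* v) refl (real ν) c₁ k)
      (trans (cong (_*ℂ real ν) kc₁) (trans (sym (real-* (fromℕ (suc N)) ν)) (cong real Nν)))
    zero-at-w : horner cs w ≡ 0ℂ
    -- For a variable `ps` the list `cs` does not reduce, so `shape` supplies its splitting into
    -- constant, linear and higher terms.
    zero-at-w = trans (cong (λ x → horner x w) shape) (cancelℂ k inverse-k scaled)
    root : horner (map realᴳ ps) z ≡ 0ℂ
    root = cancel-^ (length ps) d δd (trans (sym (horner-rescale (ℤ.+ suc D) ps z))
      (trans (cong (_*ℂ d) (trans (cong (horner (map realᴳ (rescale (ℤ.+ suc D) ps))) zd)
        (trans (sym (horner-taylor α (map realᴳ (rescale (ℤ.+ suc D) ps)) w)) zero-at-w))) (ℂ.zeroˡ d)))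
    imaginary : proj₂ z ≢ 0#
    imaginary y≡0 = fromℕ-suc≢0 m (nn-antisym (nn-fromℕ (suc m)) (subst NN negative (proj₂ (proj₂ fixed-bound))))
      where
      sum≡0 : fromℕ (suc (suc m)) + proj₂ w ≡ 0#
      sum≡0 = trans (sym (cong proj₂ zd)) (trans (cong₂ _+_ (zeroʳ (proj₁ z)) (trans (cong (_* fromℕ (suc D)) y≡0) (zeroˡ _))) (+-identityʳ 0#))
      negative : 1# + proj₂ w ≡ - fromℕ (suc m)
      negative = trans (solve 3 (λ o m y → o :+ y := (:- m) :+ ((o :+ m) :+ y)) refl 1# (fromℕ (suc m)) (proj₂ w))
        (trans (cong (- fromℕ (suc m) +_) sum≡0) (+-identityʳ _))

-- The numerical data

B-coeffs : List ℤ
B-coeffs = map ℤ.+_ (163 ∷ 16110 ∷ 371628 ∷ 3294228 ∷ 13439034 ∷ 27111294 ∷ 27186264 ∷ 12614544 ∷ 2093958 ∷ 71162 ∷ [])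

normB-coeffs : coeffList 9 (normB 9 (coeffs Q-coeffs)) ≡ B-coeffs
normB-coeffs = refl

degree-9 : ∀ {p : Poly} s → (∀ k → p k ≡ coeffs Q-coeffs k) → IsDegree p s → s ≡ 9
degree-9 {p} s e (nonzero , beyond) with ℕ.<-cmp s 9
... | tri< lt _ _ = ⊥-elim (absurd (trans (sym (e 9)) (beyond 9 lt)))
  where
  absurd : coeffs Q-coeffs 9 ≢ 0ℤ
  absurd ()
... | tri≈ _ eq _ = eq
... | tri> _ _ gt = ⊥-elim (nonzero (trans (e s) (coeffs-beyond Q-coeffs s gt)))

startingPoint : Gaussian
startingPoint = (ℤ.- ℤ.+ 206 , ℤ.+ 22)

B-taylor : List Gaussian
B-taylor = taylor startingPoint (map realᴳ (rescale (ℤ.+ 200) B-coeffs))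

-- The multiplier of the Newton step is the conjugate of the linear coefficient, so that the product
-- is the positive integer `suc linearNorm-1` and the iteration divides by an integer only. The
-- predecessor is stored because `Contraction` divides by `suc N`.
linearNorm-1 : ℕ
linearNorm-1 = 817467022023900004437570589986630166118399999999

B-linear-norm : conjᴳ (linearTerm B-taylor) *ᴳ linearTerm B-taylor ≡ realᴳ (ℤ.+ suc linearNorm-1)
B-linear-norm = refl

B-step-bound : T (2 ℕ.* bound (newtonStep (conjᴳ (linearTerm B-taylor)) B-taylor) ℕ.≤ᵇ suc linearNorm-1)
B-step-bound = _

B-step-lipschitz : T (2 ℕ.* lipschitz (newtonStep (conjᴳ (linearTerm B-taylor)) B-taylor) ℕ.≤ᵇ suc linearNorm-1)
B-step-lipschitz = _

B-taylor-shape : B-taylor ≡ constantTerm B-taylor ∷ linearTerm B-taylor ∷ quadraticTail B-taylor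
B-taylor-shape = refl

B-root : (R : CompleteOrderedField) → let open CompleteOrderedField R; open Plane R in
  ∃ λ x → ∃ λ y → horner (map realᴳ B-coeffs) (x , y) ≡ 0ℂ × y ≢ 0#
-- The arguments 199 and 20 stand for the denominator 200 and the imaginary part 22, through `suc D`
-- and `suc (suc m)`.
B-root R = Roots.nonreal-root R B-coeffs 199 20 (ℤ.- ℤ.+ 206) (conjᴳ (linearTerm B-taylor)) linearNorm-1 B-taylor-shape B-linear-norm B-step-bound B-step-lipschitz

normB-nonreal : (R : CompleteOrderedField) (q : Poly) → (∀ k → q k ≡ coeffs Q-coeffs k) →
  ∀ s → IsDegree q s → ¬ RealRooted R s (normB s q)
normB-nonreal R q q≡ s deg realRooted = y≢0 (subst (λ s → RealRooted R s (normB s q)) (degree-9 s q≡ deg) realRooted x y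
    (trans (evalℂ-horner 9 (normB 9 q) (x , y))
      (trans (cong (λ ps → horner (map realᴳ ps) (x , y)) normB≡) root)))
  where
  open Roots R using (evalℂ-horner)
  open Plane R using (horner; 0ℂ)
  open CompleteOrderedField R using (Carrier; 0#)
  x y : Carrier
  x = proj₁ (B-root R)
  y = proj₁ (proj₂ (B-root R))
  root : horner (map realᴳ B-coeffs) (x , y) ≡ 0ℂ
  root = proj₁ (proj₂ (proj₂ (B-root R)))
  y≢0 : y ≢ 0#
  y≢0 = proj₂ (proj₂ (proj₂ (B-root R)))
  normB≡ : coeffList 9 (normB 9 q) ≡ B-coeffs
  normB≡ = trans (coeffList-cong 9 (λ j → cong (ℤ.+ (9 choose j) ℤ.*_) (q≡ j))) normB-coeffs

theorem5p3 : (R : CompleteOrderedField) →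
    (λ′ : Fin 21 → Fin 6) →
    blockSizes λ′ ↭ (4 ∷ 4 ∷ 4 ∷ 3 ∷ 3 ∷ 3 ∷ []) →
    (μ : Subset 21 → Subset 21 → ℤ) →
    IsMobius (partitionMatroid λ′) μ →
    (Q : Subset 21 → Poly) →
    IsInverseKL (partitionMatroid λ′) μ Q →
    (s : ℕ) → IsDegree (Q ⊤) s →
    ¬ RealRooted R s (normB s (Q ⊤))
theorem5p3 R λ′ sizes μ isμ Q isQ = normB-nonreal R (Q ⊤) (Q-partition λ′ sizes isμ isQ)
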